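{- We have $$\lim_{n\to\infty}\max\{p(T_5^8;T_n) : T_n \text{ a tournament with } |T_n|=n\}=\frac{15}{128}.$$ Furthermore, if $(T_n)_{n\in\mathbb{N}}$ is a sequence of tournaments of increasing sizes, then $\lim_{n\to\infty}p(T_5^8;T_n)=15/128$ if and only if $(T_n)_{n\in\mathbb{N}}$ is quasi-random, i.e., if and only if for every fixed finite tournament $T$ $$\lim_{n\to\infty}p(T;T_n)=\phi_{\mathrm{qr}}(T):=\frac{|T|!}{|\mathrm{Aut}(T)|\,2^{\binom{|T|}{2}}}.$$
   Context: A tournament is a finite directed graph without loops having exactly one arc between each pair of distinct vertices; $|T|=|V(T)|$ is its size and $\mathrm{Aut}(T)$ its automorphism group. For tournaments $T,T'$ with $|T|\le|T'|$, $p(T;T')\in[0,1]$ is the (unlabelled, induced) density of $T$ in $T'$: the probability that a uniformly random $|T|$-element subset of $V(T')$ induces a subtournament isomorphic to $T$. A sequence $(T_n)$ has increasing sizes if $|T_n|<|T_{n+1}|$ for all $n$. $T_5^8$ is the tournament on vertices $1,\dots,5$ with arcs $1\to2,\ 1\to3,\ 1\to4,\ 2\to3,\ 2\to4,\ 2\to5,\ 3\to4,\ 4\to5,\ 5\to1,\ 5\to3$. The quasi-random homomorphism $\phi_{\mathrm{qr}}$ is the almost sure limit of the uniformly random tournaments on $n$ vertices (each arc oriented independently with probability $1/2$), given by the formula in the statement. -}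

module Defs where

open import Data.Bool using (Bool; true; false; not)
import Data.Bool.Properties as Bool
open import Data.Fin using (Fin; zero; suc; toℕ)
open import Data.Fin.Properties using (all?; any?; suc-injective)
  renaming (_≟_ to _≟ᶠ_)
open import Data.Fin.Subset using (Subset; inside; outside; ∣_∣)
open import Data.Integer using (+_)
open import Data.List using (List; []; _∷_; [_]; allFin; cartesianProductWith; filter; length)
import Data.List.Relation.Unary.Any as Any
open import Data.List.Membership.Propositional using (_∈_; lose; find)
open import Data.List.Membership.Propositional.Properties using (∈-allFin; ∈-cartesianProductWith⁺)
open import Data.Nat using (ℕ; zero; suc; _*_; _^_; _≟_; _!)
import Data.Nat as ℕ
open import Data.Nat.Combinatorics using (_C_)
open import Data.Product using (∃; _×_; _,_; proj₁; proj₂)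
import Data.Product.Properties as Product
open import Data.Rational using (ℚ; 0ℚ; _/_; _-_; _≤_; _<_)
import Data.Rational as ℚ
open import Data.Vec using (Vec; []; _∷_; lookup; tabulate)
open import Data.Vec.Properties using (lookup∘tabulate)
open import Function using (_∘_)
open import Function.Consequences.Propositional using (strictlySurjective⇒surjective)
open import Function.Definitions using (Bijective; Injective; Surjective)
open import Level using (Level; 0ℓ)
open import Relation.Binary.PropositionalEquality using (_≡_; _≢_; refl; sym; trans; cong; cong₂)
open import Relation.Nullary using (Dec; does)
open import Relation.Nullary.Decidable using (map′; _×-dec_; _→-dec_; ¬?; from-yes)
open import Relation.Unary using (Pred; Decidable)

private
  variable
    a p : Level
    A : Set a
    k m n : ℕ

-- The condition `exactly-one` says that precisely one of i → j and j → i
-- is an arc.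
record Tournament (n : ℕ) : Set where
  field
    arc         : Fin n → Fin n → Bool
    loopless    : ∀ i → arc i i ≡ false
    exactly-one : ∀ i j → i ≢ j → arc i j ≡ not (arc j i)

open Tournament public

IsIsomorphism : Tournament m → Tournament n → (Fin m → Fin n) → Set
IsIsomorphism T T′ f =
  Bijective _≡_ _≡_ f × (∀ i j → arc T i j ≡ arc T′ (f i) (f j))

infix 4 _≅_ _≅?_

_≅_ : Tournament m → Tournament n → Set
T ≅ T′ = ∃ (IsIsomorphism T T′)

private
  injective? : (f : Fin m → Fin n) → Dec (Injective _≡_ _≡_ f)
  injective? f = map′ (λ h {x} {y} → h x y) (λ h x y → h {x} {y})
    (all? λ x → all? λ y → (f x ≟ᶠ f y) →-dec (x ≟ᶠ y))

  surjective? : (f : Fin m → Fin n) → Dec (Surjective _≡_ _≡_ f)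
  surjective? f = map′ strictlySurjective⇒surjective
    (λ h y → proj₁ (h y) , proj₂ (h y) refl)
    (all? λ y → any? λ x → f x ≟ᶠ y)

isIsomorphism? : (T : Tournament m) (T′ : Tournament n) → Decidable (IsIsomorphism T T′)
isIsomorphism? T T′ f =
  (injective? f ×-dec surjective? f) ×-dec
  (all? λ i → all? λ j → arc T i j Bool.≟ arc T′ (f i) (f j))

-- All vectors with entries from xs; no repetitions if xs has none.
allVecs : List A → ∀ n → List (Vec A n)
allVecs xs zero    = [ [] ]
allVecs xs (suc n) = cartesianProductWith _∷_ xs (allVecs xs n)

∈-allVecs : {xs : List A} → (∀ x → x ∈ xs) → (v : Vec A n) → v ∈ allVecs xs n
∈-allVecs ∈xs []      = Any.here refl
∈-allVecs ∈xs (x ∷ v) = ∈-cartesianProductWith⁺ _∷_ (∈xs x) (∈-allVecs ∈xs v)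

private
  IsIsomorphism-resp : (T : Tournament m) (T′ : Tournament n) {f g : Fin m → Fin n} →
    (∀ i → f i ≡ g i) → IsIsomorphism T T′ f → IsIsomorphism T T′ g
  IsIsomorphism-resp T T′ f≗g ((inj , surj) , arcs) =
    ( (λ {x} {y} e → inj (trans (f≗g x) (trans e (sym (f≗g y)))))
    , (λ y → proj₁ (surj y) , λ { {z} e → trans (sym (f≗g z)) (proj₂ (surj y) e) }))
    , (λ i j → trans (arcs i j) (cong₂ (arc T′) (f≗g i) (f≗g j)))

_≅?_ : (T : Tournament m) (T′ : Tournament n) → Dec (T ≅ T′)
_≅?_ {m} {n} T T′ = map′
  (λ any → let v , _ , iso = find any in lookup v , iso)
  (λ { (f , iso) → lose (∈-allVecs ∈-allFin (tabulate f))
         (IsIsomorphism-resp T T′ (λ i → sym (lookup∘tabulate f i)) iso) })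
  (Any.any? (isIsomorphism? T T′ ∘ lookup) (allVecs (allFin n) m))

-- |Aut(T)|, with self-maps of Fin n listed as their value vectors.
∣Aut_∣ : Tournament n → ℕ
∣Aut_∣ {n} T = length (filter (isIsomorphism? T T ∘ lookup) (allVecs (allFin n) n))

-- The increasing enumeration of the elements of S.
element : (S : Subset n) → Fin ∣ S ∣ → Fin n
element (inside  ∷ S) zero    = zero
element (inside  ∷ S) (suc i) = suc (element S i)
element (outside ∷ S) i       = suc (element S i)

element-injective : (S : Subset n) → Injective _≡_ _≡_ (element S)
element-injective (inside  ∷ S) {zero}  {zero}  e = refl
element-injective (inside  ∷ S) {suc i} {suc j} e =
  cong suc (element-injective S (suc-injective e))
element-injective (outside ∷ S) e = element-injective S (suc-injective e)

-- The subtournament of T induced by S, relabelled by `element S`.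
induced : Tournament n → (S : Subset n) → Tournament ∣ S ∣
induced T S = record
  { arc         = λ i j → arc T (element S i) (element S j)
  ; loopless    = λ i → loopless T (element S i)
  ; exactly-one = λ i j i≢j →
      exactly-one T (element S i) (element S j) (i≢j ∘ element-injective S)
  }

-- Division of naturals with the convention x ÷ 0 = 0.
infixl 7 _÷_

_÷_ : ℕ → ℕ → ℚ
x ÷ zero  = 0ℚ
x ÷ suc y = + x / suc y

-- The probability that a uniformly random entry of the list satisfies P.
probability : {P : Pred A p} → Decidable P → List A → ℚ
probability P? xs = length (filter P? xs) ÷ length xs

subsetsOfSize : ∀ n → ℕ → List (Subset n)
subsetsOfSize n k = filter (λ S → ∣ S ∣ ≟ k) (allVecs (inside ∷ outside ∷ []) n)

-- The density p(T;T′). It is only meaningful for k ≤ n; for k > n there are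
-- no k-element subsets and the value is 0 by the convention for _÷_.
density : Tournament k → Tournament n → ℚ
density {k} {n} T T′ = probability (λ S → T ≅? induced T′ S) (subsetsOfSize n k)

-- The denominator is positive, as the identity is an automorphism.
φqr : Tournament k → ℚ
φqr {k} T = (k !) ÷ (∣Aut T ∣ * 2 ^ (k C 2))

T₅⁸ : Tournament 5
T₅⁸ = record
  { arc         = arc₅⁸
  ; loopless    = from-yes (all? λ i → arc₅⁸ i i Bool.≟ false)
  ; exactly-one = from-yes (all? λ i → all? λ j →
      ¬? (i ≟ᶠ j) →-dec (arc₅⁸ i j Bool.≟ not (arc₅⁸ j i)))
  }
  where
  open import Data.List.Membership.DecPropositional (Product.≡-dec _≟_ _≟_) using (_∈?_)

  arcs : List (ℕ × ℕ)
  arcs = (1 , 2) ∷ (1 , 3) ∷ (1 , 4) ∷ (2 , 3) ∷ (2 , 4) ∷ (2 , 5)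
       ∷ (3 , 4) ∷ (4 , 5) ∷ (5 , 1) ∷ (5 , 3) ∷ []

  -- The element i of Fin 5 stands for the vertex i + 1.
  arc₅⁸ : Fin 5 → Fin 5 → Bool
  arc₅⁸ i j = does ((suc (toℕ i) , suc (toℕ j)) ∈? arcs)

IsMaximum : Pred ℚ 0ℓ → ℚ → Set
IsMaximum P x = P x × (∀ y → P y → y ≤ x)

infix 4 _⟶_

_⟶_ : (ℕ → ℚ) → ℚ → Set
x ⟶ L = ∀ ε → 0ℚ < ε → ∃ λ N → ∀ n → N ℕ.≤ n → ℚ.∣ x n - L ∣ < ε

QuasiRandom : {size : ℕ → ℕ} → (∀ n → Tournament (size n)) → Set
QuasiRandom T = ∀ {k} (S : Tournament k) → (λ n → density S (T n)) ⟶ φqr S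

{-# OPTIONS --safe #-}

-- Let f(x, y) = ±1 be the skew-symmetric matrix of arc signs of a tournament
-- with n vertices. Up to O(n⁴) collisions, 2¹⁰ times the number of embeddings
-- of T₅⁸ is the sum over all 5-tuples of the product of 1 ± f over the ten
-- pairs. Expanding it and averaging over S₅ leaves n⁵ − Φ(f), where
--   54 Φ = 36 n C₄(f) + sums of squares,   C₄(f) = Σ_xy (Σ_z f(x, z) f(y, z))²,
-- an identity between multi-affine polynomials that is checked by computation.
-- So the density is at most 15/128 + O(1/n), and if it tends to 15/128 then
-- C₄(f) = o(n⁴). The latter gives all densities their quasi-random limits, since
-- by Cauchy–Schwarz replacing one factor 1 ± f by 1 changes the weighted count
-- of k-tuples by o(nᵏ). The maximum attains the bound in the limit because skew
-- Hadamard matrices yield tournaments of every size with C₄(f) = O(n³).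

module Submission where

open import Data.Bool using (Bool; true; false; not; _∧_; if_then_else_)
import Data.Bool.Properties as Bool
open import Data.Empty using (⊥-elim)
open import Data.Fin using (Fin; zero; suc; toℕ; #_)
open import Data.Fin.Properties using (suc-injective; all?; any?) renaming (_≟_ to _≟ᶠ_)
import Data.Fin.Properties as Fin using (injective⇒≤; <-cmp)
open import Data.Fin.Subset using (Subset; inside; outside; ∣_∣; ⊤)
open import Data.Fin.Subset.Properties using (∣p∣≡n⇒p≡⊤; ∣⊤∣≡n)
open import Data.Integer using (ℤ; +_; -_; 0ℤ; 1ℤ; _+_; _*_; _-_; _≤_; +≤+)
import Data.Integer as ℤ
import Data.Integer.Properties as ℤ
open import Data.Integer.Tactic.RingSolver using (solve-∀)
open import Data.List using (List; []; _∷_; _++_; allFin; cartesianProduct; cartesianProductWith; filter; foldl; foldr; length; map; take)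
import Data.List as List using (lookup)
import Data.List.Properties as List
open import Data.List.Membership.Propositional using (_∈_)
open import Data.List.Membership.Propositional.Properties using (∈-map⁺; ∈-map⁻; ∈-filter⁺; ∈-filter⁻; ∈-allFin; ∈-++⁺ˡ; ∈-++⁺ʳ; ∈-lookup; ∈-length)
open import Data.List.Membership.Propositional.Properties.WithK using (unique∧set⇒bag)
open import Data.List.Relation.Binary.BagAndSetEquality using (∼bag⇒↭)
open import Data.List.Relation.Binary.Permutation.Propositional.Properties using (↭-length)
open import Data.List.Relation.Unary.All using (All; []; _∷_)
import Data.List.Relation.Unary.All as All using (map; universal; lookup)
import Data.List.Relation.Unary.All.Properties as All using (map⁺; ++⁺)
open import Data.List.Relation.Unary.AllPairs using (AllPairs; []; _∷_)
import Data.List.Relation.Unary.AllPairs as AllPairs using (map)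
import Data.List.Relation.Unary.AllPairs.Properties as AllPairs using (map⁺; ++⁺)
open import Data.List.Relation.Unary.Any using (here; there)
open import Data.List.Relation.Unary.Unique.Propositional using (Unique)
import Data.List.Relation.Unary.Unique.Propositional.Properties as Unique
open import Data.Nat using (ℕ; zero; suc; z≤n; s≤s; _!; _<_)
import Data.Nat as ℕ
open import Data.Nat.Combinatorics using (_C_; nC1≡n; nCk+nC[k+1]≡[n+1]C[k+1])
open import Data.Nat.Properties using (_!≢0)
import Data.Nat.Properties as ℕ
open import Data.Nat.Tactic.RingSolver using () renaming (solve-∀ to ℕ-solve-∀)
open import Data.List.Extrema ℕ.≤-totalOrder using (argmax; f[xs]≤f[argmax])
open import Data.Product using (∃; _×_; _,_; proj₁; proj₂)
open import Data.Rational using (ℚ; mkℚ; 0ℚ; _/_)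
import Data.Rational as ℚ
import Data.Rational.Properties as ℚ
open import Data.Rational.Unnormalised using (ℚᵘ; mkℚᵘ)
import Data.Rational.Unnormalised as ℚᵘ
import Data.Rational.Unnormalised.Properties as ℚᵘ
open import Data.Sum using (_⊎_; inj₁; inj₂)
open import Data.Vec using (Vec; []; _∷_; lookup; tabulate; _[_]≔_)
import Data.Vec as Vec
open import Data.Vec.Properties using (lookup∘update; lookup∘update′; lookup∘tabulate; tabulate∘lookup; tabulate-cong; tabulate-∘; lookup-map; ≡-dec)
import Data.Vec.Properties as Vec using (∷-injectiveˡ; ∷-injectiveʳ)
open import Function using (_∘_; id; case_of_)
open import Function.Bundles using (_⇔_; mk⇔)
open import Function.Consequences.Propositional using (strictlySurjective⇒surjective)
open import Function.Definitions using (Bijective; Injective; Surjective)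
open import Relation.Binary.Definitions using (tri<; tri≈; tri>)
open import Relation.Binary.PropositionalEquality using (_≡_; _≢_; refl; sym; trans; cong; cong₂; subst; subst₂; module ≡-Reasoning)
open import Relation.Nullary using (Dec; yes; no; ¬_; does)
open import Relation.Nullary.Decidable using (map′; _×-dec_; _→-dec_)
open import Defs

-- Finite sums

-- All sums run over all tuples, repeated vertices included. This makes the squares of the
-- certificate exact, so that its inequality holds for every n without error term; it uses only
-- skewness of f and |f| ≤ 1, never f² = 1, which fails on the diagonal. A square (Σᵤ L(u))² stays
-- multi-affine because its two factors are summed over different vertices. Tuples with repetitions
-- matter only when weights are compared with embeddings; their weights are nonnegative, so the
-- upper bound on embeddings is free of errors as well.
--
-- In the quasi-random limit every term of the certificate except the constant and the weighted
-- count of T₅⁸ must be o(n⁵). A positive multiple of C₄ is split off from the other terms because a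
-- density near the optimum then bounds C₄ directly.
--
-- The constant is 15/128 = 5!/2¹⁰, as T₅⁸ has only the trivial automorphism. Estimates are made in
-- ℕ with explicit parameters: `Few m` states m⁴ C₄ ≤ n⁴, where the fourth power compensates the two
-- squarings by Cauchy-Schwarz and leaves relative errors of order 1/m.

∑ : {A : Set} → List A → (A → ℤ) → ℤ
∑ []       h = 0ℤ
∑ (x ∷ xs) h = h x + ∑ xs h

infix 3 ∑
syntax ∑ xs (λ x → e) = ∑[ x ∈ xs ] e

∑-cong : {A : Set} (xs : List A) {g h : A → ℤ} → (∀ x → g x ≡ h x) → ∑ xs g ≡ ∑ xs h
∑-cong []       e = refl
∑-cong (x ∷ xs) e = cong₂ _+_ (e x) (∑-cong xs e)

∑-mono-≤ : {A : Set} (xs : List A) {g h : A → ℤ} → (∀ x → g x ≤ h x) → ∑ xs g ≤ ∑ xs h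
∑-mono-≤ []       e = ℤ.≤-refl
∑-mono-≤ (x ∷ xs) e = ℤ.+-mono-≤ (e x) (∑-mono-≤ xs e)

∑-distrib-+ : {A : Set} (xs : List A) (g h : A → ℤ) → ∑ xs (λ x → g x + h x) ≡ ∑ xs g + ∑ xs h
∑-distrib-+ []       g h = refl
∑-distrib-+ (x ∷ xs) g h = trans (cong (_+_ (g x + h x)) (∑-distrib-+ xs g h))
  (interchange (g x) (h x) (∑ xs g) (∑ xs h))
  where
  interchange : ∀ a b c d → a + b + (c + d) ≡ a + c + (b + d)
  interchange = solve-∀

∑-zero : {A : Set} (xs : List A) → ∑ xs (λ _ → 0ℤ) ≡ 0ℤ
∑-zero []       = refl
∑-zero (x ∷ xs) = trans (ℤ.+-identityˡ _) (∑-zero xs)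

∑-nonneg : {A : Set} (xs : List A) {h : A → ℤ} → (∀ x → 0ℤ ≤ h x) → 0ℤ ≤ ∑ xs h
∑-nonneg xs {h} 0≤h = subst (_≤ ∑ xs h) (∑-zero xs) (∑-mono-≤ xs 0≤h)

*-distribˡ-∑ : {A : Set} (xs : List A) (c : ℤ) (h : A → ℤ) → c * ∑ xs h ≡ ∑ xs (λ x → c * h x)
*-distribˡ-∑ []       c h = ℤ.*-zeroʳ c
*-distribˡ-∑ (x ∷ xs) c h = trans (ℤ.*-distribˡ-+ c (h x) _) (cong (_+_ (c * h x)) (*-distribˡ-∑ xs c h))

*-distribʳ-∑ : {A : Set} (xs : List A) (c : ℤ) (h : A → ℤ) → ∑ xs h * c ≡ ∑ xs (λ x → h x * c)
*-distribʳ-∑ xs c h = trans (ℤ.*-comm _ c)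
  (trans (*-distribˡ-∑ xs c h) (∑-cong xs λ x → ℤ.*-comm c (h x)))

∑-swap : {A B : Set} (xs : List A) (ys : List B) (h : A → B → ℤ) →
  ∑ xs (λ x → ∑ ys (h x)) ≡ ∑ ys (λ y → ∑ xs (λ x → h x y))
∑-swap []       ys h = sym (∑-zero ys)
∑-swap (x ∷ xs) ys h = trans (cong (_+_ (∑ ys (h x))) (∑-swap xs ys h))
  (sym (∑-distrib-+ ys (h x) (λ y → ∑ xs (λ z → h z y))))

∑-const : {A : Set} (xs : List A) (c : ℤ) → ∑ xs (λ _ → c) ≡ + length xs * c
∑-const []       c = refl
∑-const (x ∷ xs) c = trans (cong (_+_ (c)) (∑-const xs c))
  (sym (ℤ.suc-* (+ length xs) c))

∑-*-∑ : {A B : Set} (xs : List A) (ys : List B) (g : A → ℤ) (h : B → ℤ) →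
  ∑ xs g * ∑ ys h ≡ ∑ xs (λ x → ∑ ys (λ y → g x * h y))
∑-*-∑ xs ys g h = trans (*-distribʳ-∑ xs _ g) (∑-cong xs λ x → *-distribˡ-∑ ys (g x) h)

∑-++ : {A : Set} (xs ys : List A) (h : A → ℤ) → ∑ (xs ++ ys) h ≡ ∑ xs h + ∑ ys h
∑-++ []       ys h = sym (ℤ.+-identityˡ _)
∑-++ (x ∷ xs) ys h = trans (cong (_+_ (h x)) (∑-++ xs ys h)) (sym (ℤ.+-assoc (h x) _ _))

∑-map : {A B : Set} (f : A → B) (xs : List A) (h : B → ℤ) → ∑ (map f xs) h ≡ ∑ xs (h ∘ f)
∑-map f []       h = refl
∑-map f (x ∷ xs) h = cong (_+_ (h (f x))) (∑-map f xs h)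

∑-allVecs : {A : Set} (xs : List A) (k : ℕ) (h : Vec A (suc k) → ℤ) →
  ∑ (allVecs xs (suc k)) h ≡ ∑ xs (λ x → ∑ (allVecs xs k) (λ v → h (x ∷ v)))
∑-allVecs xs k h = go xs
  where
  go : ∀ ys → ∑ (cartesianProductWith _∷_ ys (allVecs xs k)) h ≡ ∑ ys (λ x → ∑ (allVecs xs k) (λ v → h (x ∷ v)))
  go []       = refl
  go (y ∷ ys) = trans (∑-++ (map (y ∷_) (allVecs xs k)) _ h)
    (cong₂ _+_ (∑-map (y ∷_) (allVecs xs k) h) (go ys))

length-allVecs : {A : Set} (xs : List A) (k : ℕ) → length (allVecs xs k) ≡ length xs ℕ.^ k
length-allVecs xs zero    = refl
length-allVecs xs (suc k) = trans (go xs) (cong (length xs ℕ.*_) (length-allVecs xs k))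
  where
  go : ∀ ys → length (cartesianProductWith _∷_ ys (allVecs xs k)) ≡ length ys ℕ.* length (allVecs xs k)
  go []       = refl
  go (y ∷ ys) = trans (List.length-++ (map (y ∷_) (allVecs xs k)))
    (cong₂ ℕ._+_ (List.length-map (y ∷_) (allVecs xs k)) (go ys))

0≤i*i : ∀ i → 0ℤ ≤ i * i
0≤i*i (+ n)      = subst (0ℤ ≤_) (ℤ.pos-* n n) (+≤+ z≤n)
0≤i*i (ℤ.-[1+ n ]) = +≤+ z≤n

-- Lagrange's identity: the difference is half the sum of all (gₓ hᵧ − gᵧ hₓ)².
cauchy-schwarz : {A : Set} (xs : List A) (g h : A → ℤ) →
  ∑ xs (λ x → g x * h x) * ∑ xs (λ x → g x * h x) ≤ ∑ xs (λ x → g x * g x) * ∑ xs (λ x → h x * h x)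
cauchy-schwarz {A} xs g h = ℤ.*-cancelˡ-≤-pos _ _ (+ 2) (ℤ.0≤i-j⇒j≤i (subst (0ℤ ≤_) lagrange
  (∑-nonneg xs λ x → ∑-nonneg xs λ y → 0≤i*i (g x * h y - g y * h x))))
  where
  G H GH : ℤ
  G = ∑ xs (λ x → g x * g x)
  H = ∑ xs (λ x → h x * h x)
  GH = ∑ xs (λ x → g x * h x)
  expand : ∀ a b c d → (a * d - b * c) * (a * d - b * c) ≡ (a * a) * (d * d) + ((c * c) * (b * b) + - + 2 * ((a * c) * (b * d)))
  expand = solve-∀
  collect : ∀ s t → s + (s + - + 2 * t) ≡ + 2 * s - + 2 * t
  collect = solve-∀
  ∑∑ : (A → A → ℤ) → ℤ
  ∑∑ k = ∑ xs λ x → ∑ xs λ y → k x y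
  ∑∑-+ : ∀ k l → ∑∑ (λ x y → k x y + l x y) ≡ ∑∑ k + ∑∑ l
  ∑∑-+ k l = trans (∑-cong xs λ x → ∑-distrib-+ xs (k x) (l x)) (∑-distrib-+ xs _ _)
  gg·hh hh·gg gh·gh : A → A → ℤ
  gg·hh x y = (g x * g x) * (h y * h y)
  hh·gg x y = (h x * h x) * (g y * g y)
  gh·gh x y = (g x * h x) * (g y * h y)
  ∑∑-* : ∀ c k → ∑∑ (λ x y → c * k x y) ≡ c * ∑∑ k
  ∑∑-* c k = sym (trans (*-distribˡ-∑ xs c _) (∑-cong xs λ x → *-distribˡ-∑ xs c (k x)))
  open ≡-Reasoning
  lagrange : ∑∑ (λ x y → (g x * h y - g y * h x) * (g x * h y - g y * h x)) ≡ + 2 * (G * H) - + 2 * (GH * GH)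
  lagrange = begin
    ∑∑ (λ x y → (g x * h y - g y * h x) * (g x * h y - g y * h x))
      ≡⟨ ∑-cong xs (λ x → ∑-cong xs λ y → expand (g x) (g y) (h x) (h y)) ⟩
    ∑∑ (λ x y → gg·hh x y + (hh·gg x y + - + 2 * gh·gh x y))
      ≡⟨ ∑∑-+ gg·hh (λ x y → hh·gg x y + - + 2 * gh·gh x y) ⟩
    ∑∑ gg·hh + ∑∑ (λ x y → hh·gg x y + - + 2 * gh·gh x y)
      ≡⟨ cong (_+_ (∑∑ gg·hh)) (trans (∑∑-+ hh·gg (λ x y → - + 2 * gh·gh x y)) (cong (_+_ (∑∑ hh·gg)) (∑∑-* (- + 2) gh·gh))) ⟩
    ∑∑ gg·hh + (∑∑ hh·gg + - + 2 * ∑∑ gh·gh)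
      ≡⟨ cong₂ _+_ (sym (∑-*-∑ xs xs _ _)) (cong₂ (λ s t → s + - + 2 * t)
           (trans (sym (∑-*-∑ xs xs _ _)) (ℤ.*-comm H G)) (sym (∑-*-∑ xs xs _ _))) ⟩
    G * H + (G * H + - + 2 * (GH * GH))
      ≡⟨ collect (G * H) (GH * GH) ⟩
    + 2 * (G * H) - + 2 * (GH * GH) ∎

-- Polynomials in the ten edge variables of K₅

-- The full binary tree of coefficients has a fixed shape, so vanishing is tested leaf by leaf and
-- permuting variables only moves subtrees.
data Poly : ℕ → Set where
  con  : ℤ → Poly 0
  node : ∀ {k} → Poly k → Poly k → Poly (suc k)

-- Polynomials of degree at most one in each variable; `node p q` stands for
-- p + x q, where x is the first variable.
⟦_⟧ : ∀ {k} → Poly k → Vec ℤ k → ℤ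
⟦ con c ⟧    []      = c
⟦ node p q ⟧ (x ∷ ρ) = ⟦ p ⟧ ρ + x * ⟦ q ⟧ ρ

infixl 6 _⊕_
infixr 7 _⊛_
infixr 8 _⊗_

_⊕_ : ∀ {k} → Poly k → Poly k → Poly k
con c    ⊕ con d      = con (c + d)
node p q ⊕ node p′ q′ = node (p ⊕ p′) (q ⊕ q′)

_⊛_ : ∀ {k} → ℤ → Poly k → Poly k
c ⊛ con d    = con (c * d)
c ⊛ node p q = node (c ⊛ p) (c ⊛ q)

-- The factors have disjoint variables, which keeps the product multi-affine.
_⊗_ : ∀ {k l} → Poly k → Poly l → Poly (k ℕ.+ l)
con c    ⊗ q = c ⊛ q
node p r ⊗ q = node (p ⊗ q) (r ⊗ q)

constant : ∀ k → ℤ → Poly k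
constant zero    c = con c
constant (suc k) c = node (constant k c) (constant k 0ℤ)

sgn : Bool → ℤ
sgn true  = + 1
sgn false = - + 1

linearProduct : ∀ {k} → Vec Bool k → Poly k
linearProduct []       = con 1ℤ
linearProduct (s ∷ ss) = node (linearProduct ss) (sgn s ⊛ linearProduct ss)

monomial : ∀ {k} → Vec Bool k → Poly k
monomial []           = con 1ℤ
monomial (true ∷ bs)  = node (constant _ 0ℤ) (monomial bs)
monomial (false ∷ bs) = node (monomial bs) (constant _ 0ℤ)

⟦⊕⟧ : ∀ {k} (p q : Poly k) ρ → ⟦ p ⊕ q ⟧ ρ ≡ ⟦ p ⟧ ρ + ⟦ q ⟧ ρ
⟦⊕⟧ (con c)    (con d)      []      = refl
⟦⊕⟧ (node p q) (node p′ q′) (x ∷ ρ) = trans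
  (cong₂ (λ s t → s + x * t) (⟦⊕⟧ p p′ ρ) (⟦⊕⟧ q q′ ρ))
  (regroup x (⟦ p ⟧ ρ) (⟦ p′ ⟧ ρ) (⟦ q ⟧ ρ) (⟦ q′ ⟧ ρ))
  where
  regroup : ∀ x a b c d → a + b + x * (c + d) ≡ a + x * c + (b + x * d)
  regroup = solve-∀

⟦⊛⟧ : ∀ {k} c (p : Poly k) ρ → ⟦ c ⊛ p ⟧ ρ ≡ c * ⟦ p ⟧ ρ
⟦⊛⟧ c (con d)    []      = refl
⟦⊛⟧ c (node p q) (x ∷ ρ) = trans
  (cong₂ (λ s t → s + x * t) (⟦⊛⟧ c p ρ) (⟦⊛⟧ c q ρ))
  (factor c x (⟦ p ⟧ ρ) (⟦ q ⟧ ρ))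
  where
  factor : ∀ c x a b → c * a + x * (c * b) ≡ c * (a + x * b)
  factor = solve-∀

⟦⊗⟧ : ∀ {k l} (p : Poly k) (q : Poly l) ρ σ → ⟦ p ⊗ q ⟧ (ρ Vec.++ σ) ≡ ⟦ p ⟧ ρ * ⟦ q ⟧ σ
⟦⊗⟧ (con c)    q []      σ = ⟦⊛⟧ c q σ
⟦⊗⟧ (node p r) q (x ∷ ρ) σ = trans
  (cong₂ (λ s t → s + x * t) (⟦⊗⟧ p q ρ σ) (⟦⊗⟧ r q ρ σ))
  (factor x (⟦ p ⟧ ρ) (⟦ r ⟧ ρ) (⟦ q ⟧ σ))
  where
  factor : ∀ x a b c → a * c + x * (b * c) ≡ (a + x * b) * c
  factor = solve-∀

⟦constant⟧ : ∀ k c ρ → ⟦ constant k c ⟧ ρ ≡ c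
⟦constant⟧ zero    c []      = refl
⟦constant⟧ (suc k) c (x ∷ ρ) = trans
  (cong₂ (λ s t → s + x * t) (⟦constant⟧ k c ρ) (⟦constant⟧ k 0ℤ ρ))
  (trans (cong (_+_ c) (ℤ.*-zeroʳ x)) (ℤ.+-identityʳ c))

linearFactors : ∀ {k} → Vec Bool k → Vec ℤ k → ℤ
linearFactors []       []      = 1ℤ
linearFactors (s ∷ ss) (x ∷ ρ) = (1ℤ + sgn s * x) * (linearFactors ss ρ)

⟦linearProduct⟧ : ∀ {k} (ss : Vec Bool k) ρ → ⟦ linearProduct ss ⟧ ρ ≡ linearFactors ss ρ
⟦linearProduct⟧ []       []      = refl
⟦linearProduct⟧ (s ∷ ss) (x ∷ ρ) = trans
  (cong₂ (λ a b → a + x * b) (⟦linearProduct⟧ ss ρ)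
    (trans (⟦⊛⟧ (sgn s) (linearProduct ss) ρ) (cong (sgn s *_) (⟦linearProduct⟧ ss ρ))))
  (factor x (sgn s) (linearFactors ss ρ))
  where
  factor : ∀ x s a → a + x * (s * a) ≡ (1ℤ + s * x) * a
  factor = solve-∀

-- Generators of the signed permutations of the variables.
data Move : ℕ → Set where
  swap  : ∀ {k} → Move (suc (suc k))
  flip  : ∀ {k} → Move (suc k)
  there : ∀ {k} → Move k → Move (suc k)

move : ∀ {k} → Move k → Poly k → Poly k
move swap      (node (node p q) (node r s)) = node (node p r) (node q s)
move flip      (node p q)                   = node p (- 1ℤ ⊛ q)
move (there m) (node p q)                   = node (move m p) (move m q)

moveᵛ : ∀ {k} → Move k → Vec ℤ k → Vec ℤ k
moveᵛ swap      (x ∷ y ∷ ρ) = y ∷ x ∷ ρ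
moveᵛ flip      (x ∷ ρ)     = - x ∷ ρ
moveᵛ (there m) (x ∷ ρ)     = x ∷ moveᵛ m ρ

⟦move⟧ : ∀ {k} (m : Move k) p ρ → ⟦ move m p ⟧ ρ ≡ ⟦ p ⟧ (moveᵛ m ρ)
⟦move⟧ swap (node (node p q) (node r s)) (x ∷ y ∷ ρ) =
  regroup x y (⟦ p ⟧ ρ) (⟦ q ⟧ ρ) (⟦ r ⟧ ρ) (⟦ s ⟧ ρ)
  where
  regroup : ∀ x y p q r s → p + y * r + x * (q + y * s) ≡ p + x * q + y * (r + x * s)
  regroup = solve-∀
⟦move⟧ flip (node p q) (x ∷ ρ) = cong (_+_ (⟦ p ⟧ ρ))
  (trans (cong (x *_) (⟦⊛⟧ (- 1ℤ) q ρ)) (sign x (⟦ q ⟧ ρ)))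
  where
  sign : ∀ x a → x * (- 1ℤ * a) ≡ - x * a
  sign = solve-∀
⟦move⟧ (there m) (node p q) (x ∷ ρ) = cong₂ (λ s t → s + x * t) (⟦move⟧ m p ρ) (⟦move⟧ m q ρ)

moves : ∀ {k} → List (Move k) → Poly k → Poly k
moves ms p = foldr move p ms

movesᵛ : ∀ {k} → List (Move k) → Vec ℤ k → Vec ℤ k
movesᵛ ms ρ = foldl (λ ρ m → moveᵛ m ρ) ρ ms

⟦moves⟧ : ∀ {k} (ms : List (Move k)) p ρ → ⟦ moves ms p ⟧ ρ ≡ ⟦ p ⟧ (movesᵛ ms ρ)
⟦moves⟧ []       p ρ = refl
⟦moves⟧ (m ∷ ms) p ρ = trans (⟦move⟧ m (moves ms p) ρ) (⟦moves⟧ ms p (moveᵛ m ρ))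

-- Relabelling the five vertices

swapAt : {A : Set} {k : ℕ} → ℕ → Vec A k → Vec A k
swapAt zero    (x ∷ y ∷ v) = y ∷ x ∷ v
swapAt (suc i) (x ∷ v)     = x ∷ swapAt i v
swapAt _       v           = v

∑-swapAt : {A : Set} (xs : List A) (k i : ℕ) (h : Vec A k → ℤ) →
  ∑ (allVecs xs k) (h ∘ swapAt i) ≡ ∑ (allVecs xs k) h
∑-swapAt xs zero          zero    h = refl
∑-swapAt xs zero          (suc i) h = refl
∑-swapAt xs (suc zero)    zero    h =
  trans (∑-allVecs xs 0 (h ∘ swapAt 0)) (sym (∑-allVecs xs 0 h))
∑-swapAt xs (suc (suc k)) zero    h = begin
  ∑ (allVecs xs (suc (suc k))) (h ∘ swapAt 0)
    ≡⟨ nested (h ∘ swapAt 0) ⟩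
  ∑ xs (λ x → ∑ xs λ y → ∑ (allVecs xs k) λ v → h (y ∷ x ∷ v))
    ≡⟨ ∑-swap xs xs _ ⟩
  ∑ xs (λ y → ∑ xs λ x → ∑ (allVecs xs k) λ v → h (y ∷ x ∷ v))
    ≡⟨ sym (nested h) ⟩
  ∑ (allVecs xs (suc (suc k))) h ∎
  where
  open ≡-Reasoning
  nested : ∀ g → ∑ (allVecs xs (suc (suc k))) g ≡ ∑ xs (λ x → ∑ xs λ y → ∑ (allVecs xs k) λ v → g (x ∷ y ∷ v))
  nested g = trans (∑-allVecs xs (suc k) g) (∑-cong xs λ x → ∑-allVecs xs k _)
∑-swapAt xs (suc k) (suc i) h = trans (∑-allVecs xs k (h ∘ swapAt (suc i)))
  (trans (∑-cong xs λ x → ∑-swapAt xs k i (λ v → h (x ∷ v))) (sym (∑-allVecs xs k h)))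

Skew : {A : Set} → (A → A → ℤ) → Set
Skew f = ∀ x y → f y x ≡ - f x y

edges : {A : Set} → (A → A → ℤ) → Vec A 5 → Vec ℤ 10
edges f (a ∷ b ∷ c ∷ d ∷ e ∷ []) =
  f a b ∷ f a c ∷ f a d ∷ f a e ∷ f b c ∷ f b d ∷ f b e ∷ f c d ∷ f c e ∷ f d e ∷ []

private
  at : ∀ {k} (i : ℕ) → Move k → Move (i ℕ.+ k)
  at zero    m = m
  at (suc i) m = there (at i m)

-- `transposition i` exchanges the vertices i and i + 1.
transposition : Fin 4 → List (Move 10)
transposition zero =
  at 0 flip ∷ at 3 swap ∷ at 2 swap ∷ at 1 swap ∷ at 4 swap ∷ at 3 swap
  ∷ at 2 swap ∷ at 5 swap ∷ at 4 swap ∷ at 3 swap ∷ []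
transposition (suc zero) =
  at 0 swap ∷ at 4 flip ∷ at 6 swap ∷ at 5 swap ∷ at 7 swap ∷ at 6 swap ∷ []
transposition (suc (suc zero)) =
  at 1 swap ∷ at 4 swap ∷ at 7 flip ∷ at 8 swap ∷ []
transposition (suc (suc (suc zero))) =
  at 2 swap ∷ at 5 swap ∷ at 7 swap ∷ at 9 flip ∷ []

-- The certificate

-- The moves permute the entries definitionally. Only the edge joining the two exchanged vertices is
-- reversed, and its sign is where skewness enters.
moves-transposition : {A : Set} {f : A → A → ℤ} → Skew f → ∀ i v →
  movesᵛ (transposition i) (edges f v) ≡ edges f (swapAt (toℕ i) v)
moves-transposition {f = f} skew zero (a ∷ b ∷ c ∷ d ∷ e ∷ []) =
  cong (λ x → x ∷ f b c ∷ f b d ∷ f b e ∷ f a c ∷ f a d ∷ f a e ∷ f c d ∷ f c e ∷ f d e ∷ []) (sym (skew a b))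
moves-transposition {f = f} skew (suc zero) (a ∷ b ∷ c ∷ d ∷ e ∷ []) =
  cong (λ x → f a c ∷ f a b ∷ f a d ∷ f a e ∷ x ∷ f c d ∷ f c e ∷ f b d ∷ f b e ∷ f d e ∷ []) (sym (skew b c))
moves-transposition {f = f} skew (suc (suc zero)) (a ∷ b ∷ c ∷ d ∷ e ∷ []) =
  cong (λ x → f a b ∷ f a d ∷ f a c ∷ f a e ∷ f b d ∷ f b c ∷ f b e ∷ x ∷ f d e ∷ f c e ∷ []) (sym (skew c d))
moves-transposition {f = f} skew (suc (suc (suc zero))) (a ∷ b ∷ c ∷ d ∷ e ∷ []) =
  cong (λ x → f a b ∷ f a c ∷ f a e ∷ f a d ∷ f b c ∷ f b e ∷ f b d ∷ f c e ∷ f c d ∷ x ∷ []) (sym (skew d e))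

partialOrbit : List (Fin 4) → Poly 10 → Poly 10
partialOrbit []       p = p
partialOrbit (i ∷ is) p = p ⊕ partialOrbit is (moves (transposition i) p)

-- Each step runs over coset representatives of Sₖ in Sₖ₊₁.
symmetrise : Poly 10 → Poly 10
symmetrise p = foldl (λ q is → partialOrbit is q) p
  ((# 0 ∷ []) ∷ (# 1 ∷ # 0 ∷ []) ∷ (# 2 ∷ # 1 ∷ # 0 ∷ []) ∷ (# 3 ∷ # 2 ∷ # 1 ∷ # 0 ∷ []) ∷ [])

total : {A : Set} → List A → (A → A → ℤ) → Poly 10 → ℤ
total xs f p = ∑[ v ∈ allVecs xs 5 ] ⟦ p ⟧ (edges f v)

total-⊕ : {A : Set} (xs : List A) (f : A → A → ℤ) (p q : Poly 10) →
  total xs f (p ⊕ q) ≡ total xs f p + total xs f q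
total-⊕ xs f p q = trans (∑-cong (allVecs xs 5) λ v → ⟦⊕⟧ p q (edges f v)) (∑-distrib-+ (allVecs xs 5) _ _)

total-⊛ : {A : Set} (xs : List A) (f : A → A → ℤ) (c : ℤ) (p : Poly 10) →
  total xs f (c ⊛ p) ≡ c * total xs f p
total-⊛ xs f c p = trans (∑-cong (allVecs xs 5) λ v → ⟦⊛⟧ c p (edges f v)) (sym (*-distribˡ-∑ (allVecs xs 5) c _))

total-transposition : {A : Set} (xs : List A) {f : A → A → ℤ} → Skew f → ∀ i p →
  total xs f (moves (transposition i) p) ≡ total xs f p
total-transposition xs {f} skew i p = trans
  (∑-cong (allVecs xs 5) λ v → trans (⟦moves⟧ (transposition i) p (edges f v))
    (cong ⟦ p ⟧ (moves-transposition skew i v)))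
  (∑-swapAt xs 5 (toℕ i) (λ v → ⟦ p ⟧ (edges f v)))

-- Consecutive summands of `partialOrbit` differ by a transposition and so have equal totals; the
-- factor counts them.
total-partialOrbit : {A : Set} (xs : List A) {f : A → A → ℤ} → Skew f → ∀ is p →
  total xs f (partialOrbit is p) ≡ + suc (length is) * total xs f p
total-partialOrbit xs     skew []       p = sym (ℤ.*-identityˡ _)
total-partialOrbit xs {f} skew (i ∷ is) p = begin
  total xs f (p ⊕ partialOrbit is (moves (transposition i) p))
    ≡⟨ total-⊕ xs f p _ ⟩
  total xs f p + total xs f (partialOrbit is (moves (transposition i) p))
    ≡⟨ cong (_+_ (total xs f p)) (total-partialOrbit xs skew is _) ⟩
  total xs f p + + suc (length is) * total xs f (moves (transposition i) p)
    ≡⟨ cong (λ t → total xs f p + + suc (length is) * t) (total-transposition xs skew i p) ⟩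
  total xs f p + + suc (length is) * total xs f p
    ≡⟨ sym (ℤ.suc-* (+ suc (length is)) (total xs f p)) ⟩
  + suc (suc (length is)) * total xs f p ∎
  where open ≡-Reasoning

total-symmetrise : {A : Set} (xs : List A) {f : A → A → ℤ} → Skew f → ∀ p →
  total xs f (symmetrise p) ≡ + 120 * total xs f p
total-symmetrise xs {f} skew p = begin
  total xs f (symmetrise p)  ≡⟨ total-partialOrbit xs skew (# 3 ∷ # 2 ∷ # 1 ∷ # 0 ∷ []) p₃ ⟩
  + 5 * total xs f p₃        ≡⟨ cong (+ 5 *_) (total-partialOrbit xs skew (# 2 ∷ # 1 ∷ # 0 ∷ []) p₂) ⟩
  + 5 * (+ 4 * total xs f p₂) ≡⟨ cong (λ t → + 5 * (+ 4 * t)) (total-partialOrbit xs skew (# 1 ∷ # 0 ∷ []) p₁) ⟩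
  + 5 * (+ 4 * (+ 3 * total xs f p₁)) ≡⟨ cong (λ t → + 5 * (+ 4 * (+ 3 * t))) (total-partialOrbit xs skew (# 0 ∷ []) p) ⟩
  + 5 * (+ 4 * (+ 3 * (+ 2 * total xs f p))) ≡⟨ regroup (total xs f p) ⟩
  + 120 * total xs f p ∎
  where
  open ≡-Reasoning
  p₁ p₂ p₃ : Poly 10
  p₁ = partialOrbit (# 0 ∷ []) p
  p₂ = partialOrbit (# 1 ∷ # 0 ∷ []) p₁
  p₃ = partialOrbit (# 2 ∷ # 1 ∷ # 0 ∷ []) p₂
  regroup : ∀ t → + 5 * (+ 4 * (+ 3 * (+ 2 * t))) ≡ + 120 * t
  regroup = solve-∀

isZero : ∀ {k} → Poly k → Bool
isZero (con (+ 0)) = true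
isZero (con _)     = false
isZero (node p q)  = isZero p ∧ isZero q

⟦⟧-zero : ∀ {k} (p : Poly k) → isZero p ≡ true → ∀ ρ → ⟦ p ⟧ ρ ≡ 0ℤ
⟦⟧-zero (con (+ 0)) e [] = refl
⟦⟧-zero (node p q)  e (x ∷ ρ) with isZero p in p≡0 | isZero q in q≡0
... | true | true = trans (cong₂ (λ s t → s + x * t) (⟦⟧-zero p p≡0 ρ) (⟦⟧-zero q q≡0 ρ))
  (trans (ℤ.+-identityˡ (x * 0ℤ)) (ℤ.*-zeroʳ x))

-- The certificate is not the zero polynomial; it vanishes modulo relabellings, which are invisible
-- to the sum over all 5-tuples.
total-zero : {A : Set} (xs : List A) {f : A → A → ℤ} → Skew f → ∀ p →
  isZero (symmetrise p) ≡ true → total xs f p ≡ 0ℤ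
total-zero xs {f} skew p sym-p≡0 = ℤ.*-cancelˡ-≡ (+ 120) (total xs f p) 0ℤ (begin
  + 120 * total xs f p            ≡⟨ sym (total-symmetrise xs skew p) ⟩
  total xs f (symmetrise p)       ≡⟨ ∑-cong (allVecs xs 5) (λ v → ⟦⟧-zero (symmetrise p) sym-p≡0 (edges f v)) ⟩
  ∑ (allVecs xs 5) (λ _ → 0ℤ)     ≡⟨ ∑-zero (allVecs xs 5) ⟩
  0ℤ ∎)
  where open ≡-Reasoning

one : Poly 10
one = constant 10 1ℤ

pattern ○ = false
pattern ● = true

-- A square of the flag algebra certificate over the types (a , b , c). The
-- product of the 1 ± f over the pairs ab, ac, bc, with the signs of `type`,
-- vanishes unless a → b → c and a → c (for ● ● ●), or a → b → c → a (for
-- ● ○ ●), and the polynomial `flag` in f u a, f u b, f u c is summed over u.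
record Square : Set where
  constructor square
  field
    weight : ℕ
    type   : Vec Bool 3
    flag   : Poly 3

-- The list `edges` falls into the blocks ab | ac, ad, ae | bc, bd, be | cd, ce, de. The type sits
-- on (c , d , e), the two factors of the square are summed over a and over b, and the pair ab does
-- not occur.
squarePoly : Square → Poly 10
squarePoly (square w t L) = + w ⊛ constant 1 1ℤ ⊗ L ⊗ L ⊗ linearProduct t

-- Each argument is named after its monomial in f u a, f u b, f u c. The constant term is zero:
-- quasi-random tournaments attain the bound asymptotically, and there it would make the square
-- contribute order n⁵.
flagPoly : (c b bc a ac ab abc : ℤ) → Poly 3
flagPoly c b bc a ac ab abc =
  node (node (node (con 0ℤ) (con c)) (node (con b) (con bc)))
       (node (node (con a) (con ac)) (node (con ab) (con abc)))

-- The coefficients were found numerically by semidefinite programming and then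
-- rounded to a rational solution.
squares : List Square
squares =
    square 9   (● ∷ ● ∷ ● ∷ []) (flagPoly (- + 2) (+ 1) (+ 1) (- + 2) (+ 0) (- + 1) (+ 3))
  ∷ square 10  (● ∷ ○ ∷ ● ∷ []) (flagPoly (+ 0) (+ 0) (+ 1) (+ 0) (+ 1) (+ 1) (+ 0))
  ∷ square 9   (● ∷ ○ ∷ ● ∷ []) (flagPoly (+ 1) (+ 1) (+ 0) (+ 1) (+ 0) (+ 0) (+ 1))
  ∷ square 108 (● ∷ ○ ∷ ● ∷ []) (flagPoly (+ 0) (+ 0) (+ 0) (+ 0) (+ 0) (+ 0) (+ 1))
  ∷ square 39  (● ∷ ○ ∷ ● ∷ []) (flagPoly (+ 0) (+ 0) (- + 1) (+ 0) (+ 0) (+ 1) (+ 0))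
  ∷ []

-- Σₓ (Σᵤᵥ f x u · f x v)², Σₓ (Σᵤᵥ f x u · f u v)² and n · C₄(f).
starEdges pathEdges cycleEdges : Vec Bool 10
starEdges  = ● ∷ ● ∷ ● ∷ ● ∷ ○ ∷ ○ ∷ ○ ∷ ○ ∷ ○ ∷ ○ ∷ []
pathEdges  = ● ∷ ○ ∷ ● ∷ ○ ∷ ● ∷ ○ ∷ ○ ∷ ○ ∷ ○ ∷ ● ∷ []
cycleEdges = ○ ∷ ○ ∷ ○ ∷ ○ ∷ ○ ∷ ● ∷ ● ∷ ● ∷ ● ∷ ○ ∷ []

star path cycle : Poly 10
star  = monomial starEdges
path  = monomial pathEdges
cycle = monomial cycleEdges

signs₅⁸ : Vec Bool 10
signs₅⁸ = ● ∷ ● ∷ ● ∷ ○ ∷ ● ∷ ● ∷ ● ∷ ● ∷ ○ ∷ ● ∷ []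

remainder : Poly 10
remainder = (+ 126 ⊛ star) ⊕ (+ 126 ⊛ path) ⊕ foldr (λ s p → squarePoly s ⊕ p) (constant 10 0ℤ) squares

certificate : Poly 10
certificate = (+ 54 ⊛ linearProduct signs₅⁸) ⊕ (+ 36 ⊛ cycle) ⊕ remainder ⊕ (- + 54 ⊛ one)

-- Checked by evaluating all 2¹⁰ coefficients. The coset steps take 1 + 2 + 3 + 4 transpositions in
-- place of 120 permutations.
symmetrise-certificate : isZero (symmetrise certificate) ≡ true
symmetrise-certificate = refl

-- Totals of the terms of the certificate

∑-allVecs₅ : {A : Set} (xs : List A) (h : Vec A 5 → ℤ) → ∑ (allVecs xs 5) h ≡
  ∑ xs (λ a → ∑ xs λ b → ∑ xs λ c → ∑ xs λ d → ∑ xs λ e → h (a ∷ b ∷ c ∷ d ∷ e ∷ []))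
∑-allVecs₅ xs h =
  trans (∑-allVecs xs 4 h) (∑-cong xs λ a →
  trans (∑-allVecs xs 3 _) (∑-cong xs λ b →
  trans (∑-allVecs xs 2 _) (∑-cong xs λ c →
  trans (∑-allVecs xs 1 _) (∑-cong xs λ d →
  trans (∑-allVecs xs 0 _) (∑-cong xs λ e → ℤ.+-identityʳ _)))))

selected : ∀ {k} → Vec Bool k → Vec ℤ k → ℤ
selected []           []      = 1ℤ
selected (true ∷ bs)  (x ∷ ρ) = x * selected bs ρ
selected (false ∷ bs) (x ∷ ρ) = selected bs ρ

⟦monomial⟧ : ∀ {k} (bs : Vec Bool k) ρ → ⟦ monomial bs ⟧ ρ ≡ selected bs ρ
⟦monomial⟧ []           []      = refl
⟦monomial⟧ (true ∷ bs)  (x ∷ ρ) = trans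
  (cong₂ (λ s t → s + x * t) (⟦constant⟧ _ 0ℤ ρ) (⟦monomial⟧ bs ρ)) (ℤ.+-identityˡ _)
⟦monomial⟧ (false ∷ bs) (x ∷ ρ) = trans
  (cong₂ (λ s t → s + x * t) (⟦monomial⟧ bs ρ) (⟦constant⟧ _ 0ℤ ρ))
  (trans (cong (_+_ (selected bs ρ)) (ℤ.*-zeroʳ x)) (ℤ.+-identityʳ _))

codegree : {A B : Set} → List B → (A → B → ℤ) → A → A → ℤ
codegree xs f x y = ∑[ z ∈ xs ] f x z * f y z

C₄ : {A : Set} → List A → (A → A → ℤ) → ℤ
C₄ xs f = ∑ xs λ x → ∑ xs λ y → codegree xs f x y * codegree xs f x y

total-one : {A : Set} (xs : List A) (f : A → A → ℤ) → total xs f one ≡ + (length xs ℕ.^ 5)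
total-one xs f = begin
  total xs f one                     ≡⟨ ∑-cong (allVecs xs 5) (λ v → ⟦constant⟧ 10 1ℤ (edges f v)) ⟩
  ∑ (allVecs xs 5) (λ _ → 1ℤ)        ≡⟨ ∑-const (allVecs xs 5) 1ℤ ⟩
  + length (allVecs xs 5) * 1ℤ       ≡⟨ ℤ.*-identityʳ _ ⟩
  + length (allVecs xs 5)            ≡⟨ cong +_ (length-allVecs xs 5) ⟩
  + (length xs ℕ.^ 5) ∎
  where open ≡-Reasoning

-- The vertex a lies on no edge of the cycle and yields the factor n; summing over d and over e
-- gives the codegree of b and c twice.
total-cycle : {A : Set} (xs : List A) (f : A → A → ℤ) → total xs f cycle ≡ + length xs * C₄ xs f
total-cycle xs f = begin
  total xs f cycle
    ≡⟨ ∑-allVecs₅ xs _ ⟩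
  ∑ xs (λ a → ∑ xs λ b → ∑ xs λ c → ∑ xs λ d → ∑ xs λ e → ⟦ cycle ⟧ (edges f (a ∷ b ∷ c ∷ d ∷ e ∷ [])))
    ≡⟨ ∑-cong xs (λ a → ∑-cong xs λ b → ∑-cong xs λ c → trans
         (∑-cong xs λ d → ∑-cong xs λ e → trans
           (⟦monomial⟧ cycleEdges (edges f (a ∷ b ∷ c ∷ d ∷ e ∷ [])))
           (regroup (f b d) (f b e) (f c d) (f c e)))
         (sym (∑-*-∑ xs xs _ _))) ⟩
  ∑ xs (λ a → C₄ xs f)
    ≡⟨ ∑-const xs _ ⟩
  + length xs * C₄ xs f ∎
  where
  open ≡-Reasoning
  regroup : ∀ p q r s → p * (q * (r * (s * 1ℤ))) ≡ (p * r) * (q * s)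
  regroup = solve-∀

-- Star and path consist of two equal halves that share only the vertex a, so for each a the sum is
-- a square.
∑-square-nonneg : {A : Set} (xs : List A) (M : A → A → A → ℤ) →
  0ℤ ≤ ∑ xs (λ a → ∑ xs λ b → ∑ xs λ c → ∑ xs λ d → ∑ xs λ e → M a b c * M a d e)
∑-square-nonneg xs M = ∑-nonneg xs λ a → subst (0ℤ ≤_) (square-sum a) (0≤i*i (∑ xs λ b → ∑ xs λ c → M a b c))
  where
  square-sum : ∀ a → (∑ xs λ b → ∑ xs λ c → M a b c) * (∑ xs λ b → ∑ xs λ c → M a b c) ≡
    ∑ xs (λ b → ∑ xs λ c → ∑ xs λ d → ∑ xs λ e → M a b c * M a d e)
  square-sum a = trans (*-distribʳ-∑ xs _ _) (∑-cong xs λ b → trans (*-distribʳ-∑ xs _ _) (∑-cong xs λ c →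
    trans (*-distribˡ-∑ xs (M a b c) _) (∑-cong xs λ d → *-distribˡ-∑ xs (M a b c) (M a d))))

total-star-nonneg : {A : Set} (xs : List A) (f : A → A → ℤ) → 0ℤ ≤ total xs f star
total-star-nonneg xs f = subst (0ℤ ≤_) (sym (trans (∑-allVecs₅ xs _)
  (∑-cong xs λ a → ∑-cong xs λ b → ∑-cong xs λ c → ∑-cong xs λ d → ∑-cong xs λ e →
    trans (⟦monomial⟧ starEdges (edges f (a ∷ b ∷ c ∷ d ∷ e ∷ []))) (regroup (f a b) (f a c) (f a d) (f a e)))))
  (∑-square-nonneg xs λ a b c → f a b * f a c)
  where
  regroup : ∀ p q r s → p * (q * (r * (s * 1ℤ))) ≡ (p * q) * (r * s)
  regroup = solve-∀

total-path-nonneg : {A : Set} (xs : List A) (f : A → A → ℤ) → 0ℤ ≤ total xs f path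
total-path-nonneg xs f = subst (0ℤ ≤_) (sym (trans (∑-allVecs₅ xs _)
  (∑-cong xs λ a → ∑-cong xs λ b → ∑-cong xs λ c → ∑-cong xs λ d → ∑-cong xs λ e →
    trans (⟦monomial⟧ pathEdges (edges f (a ∷ b ∷ c ∷ d ∷ e ∷ []))) (regroup (f a b) (f a d) (f b c) (f d e)))))
  (∑-square-nonneg xs λ a b c → f a b * f b c)
  where
  regroup : ∀ p q r s → p * (q * (r * (s * 1ℤ))) ≡ (p * r) * (q * s)
  regroup = solve-∀

0≤* : ∀ {i j} → 0ℤ ≤ i → 0ℤ ≤ j → 0ℤ ≤ i * j
0≤* {+ m} {+ n} (+≤+ _) (+≤+ _) = subst (0ℤ ≤_) (ℤ.pos-* m n) (+≤+ z≤n)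

0≤1+sgn* : ∀ s x → ℤ.∣ x ∣ ℕ.≤ 1 → 0ℤ ≤ 1ℤ + sgn s * x
0≤1+sgn* true  (+ 0)          _        = +≤+ z≤n
0≤1+sgn* false (+ 0)          _        = +≤+ z≤n
0≤1+sgn* true  (+ 1)          _        = +≤+ z≤n
0≤1+sgn* false (+ 1)          _        = +≤+ z≤n
0≤1+sgn* true  (ℤ.-[1+ 0 ])   _        = +≤+ z≤n
0≤1+sgn* false (ℤ.-[1+ 0 ])   _        = +≤+ z≤n
0≤1+sgn* _     (+ suc (suc n)) (s≤s ())
0≤1+sgn* _     (ℤ.-[1+ suc n ]) (s≤s ())

Bounded : {A : Set} → (A → A → ℤ) → Set
Bounded f = ∀ x y → ℤ.∣ f x y ∣ ℕ.≤ 1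

-- For fixed (c , d , e) the sums over a and over b are independent and form an exact square; the
-- factors `1 ± f` of the type are nonnegative weights because |f| ≤ 1.
total-square-nonneg : {A : Set} (xs : List A) {f : A → A → ℤ} → Bounded f → ∀ s →
  0ℤ ≤ total xs f (squarePoly s)
total-square-nonneg {A} xs {f} bounded (square w (s₁ ∷ s₂ ∷ s₃ ∷ []) L) =
  subst (0ℤ ≤_) (sym total≡) (∑-nonneg (allVecs xs 3) λ where
    (c ∷ d ∷ e ∷ []) → 0≤* {+ w} (+≤+ z≤n) (0≤* (0≤i*i (flagSum (c ∷ d ∷ e ∷ [])))
      (0≤* (0≤1+sgn* s₁ _ (bounded c d)) (0≤* (0≤1+sgn* s₂ _ (bounded c e))
        (0≤* (0≤1+sgn* s₃ _ (bounded d e)) (+≤+ z≤n))))))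
  where
  open ≡-Reasoning
  ss : Vec Bool 3
  ss = s₁ ∷ s₂ ∷ s₃ ∷ []
  typeEdges : Vec A 3 → Vec ℤ 3
  typeEdges (c ∷ d ∷ e ∷ []) = f c d ∷ f c e ∷ f d e ∷ []
  flag : A → Vec A 3 → ℤ
  flag a v = ⟦ L ⟧ (Vec.map (f a) v)
  flagSum : Vec A 3 → ℤ
  flagSum v = ∑[ a ∈ xs ] flag a v
  term : A → A → Vec A 3 → ℤ
  term a b v = + w * (flag a v * flag b v * linearFactors ss (typeEdges v))
  regroup : ∀ w x y t → w * (x * (y * t)) ≡ w * (x * y * t)
  regroup = solve-∀
  value : ∀ a b v → ⟦ squarePoly (square w ss L) ⟧ (edges f (a ∷ b ∷ v)) ≡ term a b v
  value a b v@(c ∷ d ∷ e ∷ []) = begin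
    ⟦ + w ⊛ constant 1 1ℤ ⊗ L ⊗ L ⊗ linearProduct ss ⟧ (edges f (a ∷ b ∷ v))
      ≡⟨ ⟦⊛⟧ (+ w) (constant 1 1ℤ ⊗ L ⊗ L ⊗ linearProduct ss) (edges f (a ∷ b ∷ v)) ⟩
    + w * ⟦ constant 1 1ℤ ⊗ L ⊗ L ⊗ linearProduct ss ⟧ (edges f (a ∷ b ∷ v))
      ≡⟨ cong (+ w *_) (trans (⟦⊗⟧ (constant 1 1ℤ) (L ⊗ L ⊗ linearProduct ss) (f a b ∷ []) _)
           (cong₂ _*_ (⟦constant⟧ 1 1ℤ (f a b ∷ [])) (trans (⟦⊗⟧ L (L ⊗ linearProduct ss) (Vec.map (f a) v) _)
             (cong (flag a v *_) (trans (⟦⊗⟧ L (linearProduct ss) (Vec.map (f b) v) (typeEdges v))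
               (cong (flag b v *_) (⟦linearProduct⟧ ss (typeEdges v)))))))) ⟩
    + w * (1ℤ * (flag a v * (flag b v * linearFactors ss (typeEdges v))))
      ≡⟨ cong (+ w *_) (ℤ.*-identityˡ _) ⟩
    + w * (flag a v * (flag b v * linearFactors ss (typeEdges v)))
      ≡⟨ regroup (+ w) (flag a v) (flag b v) _ ⟩
    term a b v ∎
  collect : ∀ v → ∑ xs (λ a → ∑ xs λ b → term a b v) ≡ + w * (flagSum v * flagSum v * linearFactors ss (typeEdges v))
  collect v = begin
    ∑ xs (λ a → ∑ xs λ b → term a b v)
      ≡⟨ ∑-cong xs (λ a → sym (*-distribˡ-∑ xs (+ w) _)) ⟩
    ∑ xs (λ a → + w * ∑ xs λ b → flag a v * flag b v * t)
      ≡⟨ sym (*-distribˡ-∑ xs (+ w) _) ⟩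
    + w * ∑ xs (λ a → ∑ xs λ b → flag a v * flag b v * t)
      ≡⟨ cong (+ w *_) (∑-cong xs λ a → sym (*-distribʳ-∑ xs t _)) ⟩
    + w * ∑ xs (λ a → ∑ xs (λ b → flag a v * flag b v) * t)
      ≡⟨ cong (+ w *_) (sym (*-distribʳ-∑ xs t _)) ⟩
    + w * (∑ xs (λ a → ∑ xs λ b → flag a v * flag b v) * t)
      ≡⟨ cong (λ s → + w * (s * t)) (sym (∑-*-∑ xs xs _ _)) ⟩
    + w * (flagSum v * flagSum v * t) ∎
    where
    t : ℤ
    t = linearFactors ss (typeEdges v)
  total≡ : total xs f (squarePoly (square w ss L)) ≡
    ∑ (allVecs xs 3) (λ v → + w * (flagSum v * flagSum v * linearFactors ss (typeEdges v)))
  total≡ = begin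
    total xs f (squarePoly (square w ss L))
      ≡⟨ trans (∑-allVecs xs 4 _) (∑-cong xs λ a → ∑-allVecs xs 3 _) ⟩
    ∑ xs (λ a → ∑ xs λ b → ∑ (allVecs xs 3) λ v → ⟦ squarePoly (square w ss L) ⟧ (edges f (a ∷ b ∷ v)))
      ≡⟨ ∑-cong xs (λ a → ∑-cong xs λ b → ∑-cong (allVecs xs 3) λ v → value a b v) ⟩
    ∑ xs (λ a → ∑ xs λ b → ∑ (allVecs xs 3) λ v → term a b v)
      ≡⟨ ∑-cong xs (λ a → ∑-swap xs (allVecs xs 3) (term a)) ⟩
    ∑ xs (λ a → ∑ (allVecs xs 3) λ v → ∑ xs λ b → term a b v)
      ≡⟨ ∑-swap xs (allVecs xs 3) (λ a v → ∑ xs λ b → term a b v) ⟩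
    ∑ (allVecs xs 3) (λ v → ∑ xs λ a → ∑ xs λ b → term a b v)
      ≡⟨ ∑-cong (allVecs xs 3) collect ⟩
    ∑ (allVecs xs 3) (λ v → + w * (flagSum v * flagSum v * linearFactors ss (typeEdges v))) ∎

total-squares-nonneg : {A : Set} (xs : List A) {f : A → A → ℤ} → Bounded f → ∀ ss →
  0ℤ ≤ total xs f (foldr (λ s p → squarePoly s ⊕ p) (constant 10 0ℤ) ss)
total-squares-nonneg xs {f} bounded [] = ∑-nonneg (allVecs xs 5) λ v → ℤ.≤-reflexive (sym (⟦constant⟧ 10 0ℤ (edges f v)))
total-squares-nonneg xs {f} bounded (s ∷ ss) =
  subst (0ℤ ≤_) (sym (total-⊕ xs f (squarePoly s) (foldr (λ s p → squarePoly s ⊕ p) (constant 10 0ℤ) ss)))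
  (ℤ.+-mono-≤ (total-square-nonneg xs {f} bounded s) (total-squares-nonneg xs {f} bounded ss))

total-remainder-nonneg : {A : Set} (xs : List A) {f : A → A → ℤ} → Bounded f → 0ℤ ≤ total xs f remainder
total-remainder-nonneg xs {f} bounded = subst (0ℤ ≤_) (sym split)
  (ℤ.+-mono-≤ (ℤ.+-mono-≤ (0≤* {+ 126} (+≤+ z≤n) (total-star-nonneg xs f))
    (0≤* {+ 126} (+≤+ z≤n) (total-path-nonneg xs f))) (total-squares-nonneg xs {f} bounded squares))
  where
  rest : Poly 10
  rest = foldr (λ s p → squarePoly s ⊕ p) (constant 10 0ℤ) squares
  split : total xs f remainder ≡ + 126 * total xs f star + + 126 * total xs f path + total xs f rest
  split = trans (total-⊕ xs f ((+ 126 ⊛ star) ⊕ (+ 126 ⊛ path)) rest) (cong (_+ total xs f rest)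
    (trans (total-⊕ xs f (+ 126 ⊛ star) (+ 126 ⊛ path))
      (cong₂ _+_ (total-⊛ xs f (+ 126) star) (total-⊛ xs f (+ 126) path))))

-- Since the certificate has total zero, the gap between the two sides is exactly the total of
-- `remainder`.
weighted-count₅⁸ : {A : Set} (xs : List A) {f : A → A → ℤ} → Skew f → Bounded f →
  + 54 * ∑ (allVecs xs 5) (λ v → linearFactors signs₅⁸ (edges f v)) + + 36 * (+ length xs * C₄ xs f) ≤ + 54 * + (length xs ℕ.^ 5)
weighted-count₅⁸ xs {f} skew bounded = ℤ.0≤i-j⇒j≤i (subst (0ℤ ≤_) difference (total-remainder-nonneg xs {f} bounded))
  where
  open ≡-Reasoning
  W W′ Z R N : ℤ
  W  = total xs f (linearProduct signs₅⁸)
  W′ = ∑ (allVecs xs 5) (λ v → linearFactors signs₅⁸ (edges f v))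
  Z  = total xs f cycle
  R  = total xs f remainder
  N  = total xs f one
  isolate : ∀ w c r n → r ≡ + 54 * n - (+ 54 * w + + 36 * c) + (+ 54 * w + + 36 * c + r + - + 54 * n)
  isolate = solve-∀
  certified : + 54 * W + + 36 * Z + R + - + 54 * N ≡ 0ℤ
  certified = begin
    + 54 * W + + 36 * Z + R + - + 54 * N
      ≡⟨ sym (cong₂ (λ s t → s + t) (trans (total-⊕ xs f (w ⊕ c) remainder) (cong (_+ R)
           (trans (total-⊕ xs f w c) (cong₂ _+_ (total-⊛ xs f (+ 54) (linearProduct signs₅⁸)) (total-⊛ xs f (+ 36) cycle)))))
           (total-⊛ xs f (- + 54) one)) ⟩
    total xs f (w ⊕ c ⊕ remainder) + total xs f (- + 54 ⊛ one)
      ≡⟨ sym (total-⊕ xs f (w ⊕ c ⊕ remainder) (- + 54 ⊛ one)) ⟩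
    total xs f certificate
      ≡⟨ total-zero xs skew certificate symmetrise-certificate ⟩
    0ℤ ∎
    where
    w c : Poly 10
    w = + 54 ⊛ linearProduct signs₅⁸
    c = + 36 ⊛ cycle
  difference : R ≡ + 54 * + (length xs ℕ.^ 5) - (+ 54 * W′ + + 36 * (+ length xs * C₄ xs f))
  difference = begin
    R ≡⟨ isolate W Z R N ⟩
    + 54 * N - (+ 54 * W + + 36 * Z) + (+ 54 * W + + 36 * Z + R + - + 54 * N)
      ≡⟨ cong (_+_ (+ 54 * N - (+ 54 * W + + 36 * Z))) certified ⟩
    + 54 * N - (+ 54 * W + + 36 * Z) + 0ℤ
      ≡⟨ ℤ.+-identityʳ _ ⟩
    + 54 * N - (+ 54 * W + + 36 * Z)
      ≡⟨ cong₂ (λ s t → + 54 * s - t) (total-one xs f) (cong₂ (λ s t → + 54 * s + + 36 * t)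
           (∑-cong (allVecs xs 5) λ v → ⟦linearProduct⟧ signs₅⁸ (edges f v)) (total-cycle xs f)) ⟩
    + 54 * + (length xs ℕ.^ 5) - (+ 54 * W′ + + 36 * (+ length xs * C₄ xs f)) ∎

-- Few four-cycles force uniform counts

abs-square : ∀ i → i * i ≡ + (ℤ.∣ i ∣ ℕ.* ℤ.∣ i ∣)
abs-square i = trans (sym (ℤ.0≤i⇒+∣i∣≡i (0≤i*i i))) (cong +_ (ℤ.abs-* i i))

abs-*-≤ : ∀ {i j a b} → ℤ.∣ i ∣ ℕ.≤ a → ℤ.∣ j ∣ ℕ.≤ b → ℤ.∣ i * j ∣ ℕ.≤ a ℕ.* b
abs-*-≤ {i} {j} p q = subst (ℕ._≤ _) (sym (ℤ.abs-* i j)) (ℕ.*-mono-≤ p q)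

abs-∑-≤ : {A : Set} (xs : List A) {h : A → ℤ} {b : ℕ} → (∀ x → ℤ.∣ h x ∣ ℕ.≤ b) → ℤ.∣ ∑ xs h ∣ ℕ.≤ length xs ℕ.* b
abs-∑-≤ []       p = z≤n
abs-∑-≤ (x ∷ xs) {h} p = ℕ.≤-trans (ℤ.∣i+j∣≤∣i∣+∣j∣ (h x) (∑ xs h)) (ℕ.+-mono-≤ (p x) (abs-∑-≤ xs p))

abs-cauchy-schwarz : {A : Set} (xs : List A) (g h : A → ℤ) →
  ℤ.∣ ∑ xs (λ x → g x * h x) ∣ ℕ.* ℤ.∣ ∑ xs (λ x → g x * h x) ∣ ℕ.≤
  ℤ.∣ ∑ xs (λ x → g x * g x) ∣ ℕ.* ℤ.∣ ∑ xs (λ x → h x * h x) ∣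
abs-cauchy-schwarz xs g h = ℤ.drop‿+≤+ (subst₂ _≤_ (abs-square (∑ xs (λ x → g x * h x))) nonneg (cauchy-schwarz xs g h))
  where
  G H : ℤ
  G = ∑ xs (λ x → g x * g x)
  H = ∑ xs (λ x → h x * h x)
  nonneg : G * H ≡ + (ℤ.∣ G ∣ ℕ.* ℤ.∣ H ∣)
  nonneg = trans (sym (ℤ.0≤i⇒+∣i∣≡i (0≤* (∑-nonneg xs λ x → 0≤i*i (g x)) (∑-nonneg xs λ x → 0≤i*i (h x)))))
    (cong +_ (ℤ.abs-* G H))

∑-cartesianProduct : {A B : Set} (xs : List A) (ys : List B) (h : A × B → ℤ) →
  ∑ (cartesianProduct xs ys) h ≡ ∑ xs (λ x → ∑ ys λ y → h (x , y))
∑-cartesianProduct []       ys h = refl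
∑-cartesianProduct (x ∷ xs) ys h = trans (∑-++ (map (x ,_) ys) _ h)
  (cong₂ _+_ (∑-map (x ,_) ys h) (∑-cartesianProduct xs ys h))

square-cancel-≤ : ∀ a b → a ℕ.* a ℕ.≤ b ℕ.* b → a ℕ.≤ b
square-cancel-≤ a b p = ℕ.≮⇒≥ λ b<a → ℕ.<⇒≱ (ℕ.*-mono-< b<a b<a) p

-- Two applications of the Cauchy–Schwarz inequality, the first eliminating U
-- and the second V.
discrepancy : {A : Set} (xs : List A) {f : A → A → ℤ} → Skew f → (m : ℕ) →
  let n = length xs in
  m ℕ.* m ℕ.* (m ℕ.* m) ℕ.* ℤ.∣ C₄ xs f ∣ ℕ.≤ n ℕ.* n ℕ.* (n ℕ.* n) →
  (b : ℕ) (U V : A → ℤ) → (∀ x → ℤ.∣ U x ∣ ℕ.≤ b) → (∀ x → ℤ.∣ V x ∣ ℕ.≤ b) →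
  m ℕ.* ℤ.∣ ∑ xs (λ x → ∑ xs λ y → f x y * (U x * V y)) ∣ ℕ.≤ b ℕ.* b ℕ.* (n ℕ.* n)
-- The fourth powers are compared, as each use of Cauchy-Schwarz squares the sum.
discrepancy {A} xs {f} skew m few b U V U≤b V≤b = square-cancel-≤ _ _ (square-cancel-≤ _ _ (begin
  (m ℕ.* x ℕ.* (m ℕ.* x)) ℕ.* (m ℕ.* x ℕ.* (m ℕ.* x))
    ≡⟨ regroup₁ m x ⟩
  m⁴ ℕ.* (x ℕ.* x ℕ.* (x ℕ.* x))
    ≤⟨ ℕ.*-monoʳ-≤ m⁴ (ℕ.*-mono-≤ x²≤ x²≤) ⟩
  m⁴ ℕ.* (n ℕ.* (b ℕ.* b) ℕ.* s ℕ.* (n ℕ.* (b ℕ.* b) ℕ.* s))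
    ≡⟨ regroup₂ m⁴ n b s ⟩
  m⁴ ℕ.* (n ℕ.* n ℕ.* (b ℕ.* b ℕ.* (b ℕ.* b))) ℕ.* (s ℕ.* s)
    ≤⟨ ℕ.*-monoʳ-≤ (m⁴ ℕ.* (n ℕ.* n ℕ.* (b ℕ.* b ℕ.* (b ℕ.* b)))) s²≤ ⟩
  m⁴ ℕ.* (n ℕ.* n ℕ.* (b ℕ.* b ℕ.* (b ℕ.* b))) ℕ.* (n ℕ.* (n ℕ.* (b ℕ.* b ℕ.* (b ℕ.* b))) ℕ.* c)
    ≡⟨ regroup₃ m⁴ n b c ⟩
  n ℕ.* n ℕ.* (b ℕ.* b ℕ.* (b ℕ.* b)) ℕ.* (n ℕ.* n ℕ.* (b ℕ.* b ℕ.* (b ℕ.* b))) ℕ.* (m⁴ ℕ.* c)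
    ≤⟨ ℕ.*-monoʳ-≤ (n ℕ.* n ℕ.* (b ℕ.* b ℕ.* (b ℕ.* b)) ℕ.* (n ℕ.* n ℕ.* (b ℕ.* b ℕ.* (b ℕ.* b)))) few ⟩
  n ℕ.* n ℕ.* (b ℕ.* b ℕ.* (b ℕ.* b)) ℕ.* (n ℕ.* n ℕ.* (b ℕ.* b ℕ.* (b ℕ.* b))) ℕ.* (n ℕ.* n ℕ.* (n ℕ.* n))
    ≡⟨ regroup₄ n b ⟩
  (b ℕ.* b ℕ.* (n ℕ.* n) ℕ.* (b ℕ.* b ℕ.* (n ℕ.* n))) ℕ.* (b ℕ.* b ℕ.* (n ℕ.* n) ℕ.* (b ℕ.* b ℕ.* (n ℕ.* n))) ∎))
  where
  open ℕ.≤-Reasoning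
  G : A → ℤ
  G x = ∑[ y ∈ xs ] f x y * V y
  X S : ℤ
  X = ∑ xs λ x → ∑ xs λ y → f x y * (U x * V y)
  S = ∑ xs λ x → G x * G x
  n m⁴ x s c : ℕ
  n  = length xs
  m⁴ = m ℕ.* m ℕ.* (m ℕ.* m)
  x  = ℤ.∣ X ∣
  s  = ℤ.∣ S ∣
  c  = ℤ.∣ C₄ xs f ∣
  regroup₁ : ∀ m x → (m ℕ.* x ℕ.* (m ℕ.* x)) ℕ.* (m ℕ.* x ℕ.* (m ℕ.* x)) ≡ m ℕ.* m ℕ.* (m ℕ.* m) ℕ.* (x ℕ.* x ℕ.* (x ℕ.* x))
  regroup₁ = ℕ-solve-∀
  regroup₂ : ∀ m n b s → m ℕ.* (n ℕ.* (b ℕ.* b) ℕ.* s ℕ.* (n ℕ.* (b ℕ.* b) ℕ.* s)) ≡ m ℕ.* (n ℕ.* n ℕ.* (b ℕ.* b ℕ.* (b ℕ.* b))) ℕ.* (s ℕ.* s)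
  regroup₂ = ℕ-solve-∀
  regroup₃ : ∀ m n b c → m ℕ.* (n ℕ.* n ℕ.* (b ℕ.* b ℕ.* (b ℕ.* b))) ℕ.* (n ℕ.* (n ℕ.* (b ℕ.* b ℕ.* (b ℕ.* b))) ℕ.* c) ≡
    n ℕ.* n ℕ.* (b ℕ.* b ℕ.* (b ℕ.* b)) ℕ.* (n ℕ.* n ℕ.* (b ℕ.* b ℕ.* (b ℕ.* b))) ℕ.* (m ℕ.* c)
  regroup₃ = ℕ-solve-∀
  regroup₄ : ∀ n b → n ℕ.* n ℕ.* (b ℕ.* b ℕ.* (b ℕ.* b)) ℕ.* (n ℕ.* n ℕ.* (b ℕ.* b ℕ.* (b ℕ.* b))) ℕ.* (n ℕ.* n ℕ.* (n ℕ.* n)) ≡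
    (b ℕ.* b ℕ.* (n ℕ.* n) ℕ.* (b ℕ.* b ℕ.* (n ℕ.* n))) ℕ.* (b ℕ.* b ℕ.* (n ℕ.* n) ℕ.* (b ℕ.* b ℕ.* (n ℕ.* n)))
  regroup₄ = ℕ-solve-∀
  X≡ : X ≡ ∑ xs (λ x → U x * G x)
  X≡ = ∑-cong xs λ x → trans (∑-cong xs λ y → pull (f x y) (U x) (V y)) (sym (*-distribˡ-∑ xs (U x) _))
    where
    pull : ∀ a u v → a * (u * v) ≡ u * (a * v)
    pull = solve-∀
  x²≤ : x ℕ.* x ℕ.≤ n ℕ.* (b ℕ.* b) ℕ.* s
  x²≤ = ℕ.≤-trans (subst (λ t → ℤ.∣ t ∣ ℕ.* ℤ.∣ t ∣ ℕ.≤ ℤ.∣ ∑ xs (λ x → U x * U x) ∣ ℕ.* s) (sym X≡) (abs-cauchy-schwarz xs U G))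
    (ℕ.*-monoˡ-≤ s (abs-∑-≤ xs λ x → abs-*-≤ {U x} {U x} (U≤b x) (U≤b x)))
  VV cod : A × A → ℤ
  VV  (y , z) = V y * V z
  cod (y , z) = codegree xs f y z
  -- The square of G sums over the first argument of f, the codegree over the second; the two signs
  -- from transposing cancel.
  skew-product : ∀ x y z → f x y * f x z ≡ f y x * f z x
  skew-product x y z = trans (cong₂ _*_ (skew y x) (skew z x)) (signs (f y x) (f z x))
    where
    signs : ∀ a b → - a * - b ≡ a * b
    signs = solve-∀
  S≡ : S ≡ ∑ (cartesianProduct xs xs) (λ p → VV p * cod p)
  S≡ = trans (∑-cong xs (λ x → trans (∑-*-∑ xs xs _ _) (∑-cong xs λ y → ∑-cong xs λ z →
           trans (pull (f x y) (V y) (f x z) (V z)) (cong (V y * V z *_) (skew-product x y z)))))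
    (trans (∑-swap xs xs _) (trans (∑-cong xs λ y → trans (∑-swap xs xs (λ x z → V y * V z * (f y x * f z x)))
      (∑-cong xs λ z → sym (*-distribˡ-∑ xs (V y * V z) _))) (sym (∑-cartesianProduct xs xs _))))
    where
    pull : ∀ a v b w → a * v * (b * w) ≡ v * w * (a * b)
    pull = solve-∀
  s²≤ : s ℕ.* s ℕ.≤ n ℕ.* (n ℕ.* (b ℕ.* b ℕ.* (b ℕ.* b))) ℕ.* c
  s²≤ = ℕ.≤-trans
    (subst₂ (λ t t′ → ℤ.∣ t ∣ ℕ.* ℤ.∣ t ∣ ℕ.≤ ℤ.∣ ∑ (cartesianProduct xs xs) (λ p → VV p * VV p) ∣ ℕ.* ℤ.∣ t′ ∣)
      (sym S≡) (∑-cartesianProduct xs xs _) (abs-cauchy-schwarz (cartesianProduct xs xs) VV cod))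
    (ℕ.*-monoˡ-≤ c (subst (λ t → ℤ.∣ t ∣ ℕ.≤ n ℕ.* (n ℕ.* (b ℕ.* b ℕ.* (b ℕ.* b)))) (sym (∑-cartesianProduct xs xs _))
      (abs-∑-≤ xs λ y → abs-∑-≤ xs λ z → abs-*-≤ {VV (y , z)} {VV (y , z)} (VV≤ y z) (VV≤ y z))))
    where
    VV≤ : ∀ y z → ℤ.∣ V y * V z ∣ ℕ.≤ b ℕ.* b
    VV≤ y z = abs-*-≤ {V y} {V z} (V≤b y) (V≤b z)

-- Weights of tuples, edge by edge

pairs : ∀ k → List (Fin k × Fin k)
pairs zero    = []
pairs (suc k) = map (λ j → zero , suc j) (allFin k) ++ map (λ (i , j) → suc i , suc j) (pairs k)

weight : {A : Set} {k : ℕ} → (A → A → ℤ) → (Fin k → Fin k → Bool) → List (Fin k × Fin k) → Vec A k → ℤ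
weight f σ []            v = 1ℤ
weight f σ ((i , j) ∷ L) v = (1ℤ + sgn (σ i j) * f (lookup v i) (lookup v j)) * weight f σ L v

-- Distinct as unordered pairs.
Apart : {k : ℕ} → Fin k × Fin k → Fin k × Fin k → Set
Apart (i , j) (i′ , j′) = (i ≢ i′ × i ≢ j′) ⊎ (j ≢ i′ × j ≢ j′)

pairs-apart : ∀ k → AllPairs Apart (pairs k)
pairs-apart zero    = []
pairs-apart (suc k) = AllPairs.++⁺
  (AllPairs.map⁺ (AllPairs.map (λ j≢j′ → inj₂ ((λ ()) , λ e → j≢j′ (suc-injective e))) (Unique.allFin⁺ k)))
  (AllPairs.map⁺ (AllPairs.map apart-suc (pairs-apart k)))
  (All.map⁺ (All.universal (λ _ → All.map⁺ (All.universal (λ _ → inj₁ ((λ ()) , λ ())) (pairs k))) (allFin k)))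
  where
  apart-suc : ∀ {k} {e e′ : Fin k × Fin k} → Apart e e′ →
    Apart (suc (proj₁ e) , suc (proj₂ e)) (suc (proj₁ e′) , suc (proj₂ e′))
  apart-suc (inj₁ (p , q)) = inj₁ ((λ e → p (suc-injective e)) , λ e → q (suc-injective e))
  apart-suc (inj₂ (p , q)) = inj₂ ((λ e → p (suc-injective e)) , λ e → q (suc-injective e))

pairs-distinct : ∀ k → All (λ (i , j) → i ≢ j) (pairs k)
pairs-distinct zero    = []
pairs-distinct (suc k) = All.++⁺
  (All.map⁺ (All.universal (λ _ ()) (allFin k)))
  (All.map⁺ (All.map (λ i≢j e → i≢j (suc-injective e)) (pairs-distinct k)))

abs-1+sgn* : ∀ s x → ℤ.∣ x ∣ ℕ.≤ 1 → ℤ.∣ 1ℤ + sgn s * x ∣ ℕ.≤ 2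
abs-1+sgn* s x p = ℕ.≤-trans (ℤ.∣i+j∣≤∣i∣+∣j∣ 1ℤ (sgn s * x))
  (ℕ.+-monoʳ-≤ 1 (abs-*-≤ {sgn s} {x} (abs-sgn s) p))
  where
  abs-sgn : ∀ s → ℤ.∣ sgn s ∣ ℕ.≤ 1
  abs-sgn true  = ℕ.≤-refl
  abs-sgn false = ℕ.≤-refl

-- Resampling a coordinate costs only a factor n. This frees the endpoints of an edge wherever they
-- stand in the vector, with the other coordinates fixed.
∑-update : {A : Set} (xs : List A) {k : ℕ} (i : Fin k) (h : Vec A k → ℤ) →
  ∑ (allVecs xs k) (λ v → ∑ xs λ a → h (v [ i ]≔ a)) ≡ + length xs * ∑ (allVecs xs k) h
∑-update xs {suc k} zero h = begin
  ∑ (allVecs xs (suc k)) (λ v → ∑ xs λ a → h (v [ zero ]≔ a))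
    ≡⟨ ∑-allVecs xs k _ ⟩
  ∑ xs (λ x → ∑ (allVecs xs k) λ v → ∑ xs λ a → h (a ∷ v))
    ≡⟨ ∑-const xs _ ⟩
  + length xs * ∑ (allVecs xs k) (λ v → ∑ xs λ a → h (a ∷ v))
    ≡⟨ cong (+ length xs *_) (trans (∑-swap (allVecs xs k) xs _) (sym (∑-allVecs xs k h))) ⟩
  + length xs * ∑ (allVecs xs (suc k)) h ∎
  where open ≡-Reasoning
∑-update xs {suc k} (suc i) h = begin
  ∑ (allVecs xs (suc k)) (λ v → ∑ xs λ a → h (v [ suc i ]≔ a))
    ≡⟨ ∑-allVecs xs k _ ⟩
  ∑ xs (λ x → ∑ (allVecs xs k) λ v → ∑ xs λ a → h (x ∷ (v [ i ]≔ a)))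
    ≡⟨ ∑-cong xs (λ x → ∑-update xs i (λ v → h (x ∷ v))) ⟩
  ∑ xs (λ x → + length xs * ∑ (allVecs xs k) λ v → h (x ∷ v))
    ≡⟨ sym (*-distribˡ-∑ xs (+ length xs) _) ⟩
  + length xs * ∑ xs (λ x → ∑ (allVecs xs k) λ v → h (x ∷ v))
    ≡⟨ cong (+ length xs *_) (sym (∑-allVecs xs k h)) ⟩
  + length xs * ∑ (allVecs xs (suc k)) h ∎
  where open ≡-Reasoning

record Splits {A : Set} (b : ℕ) (h : A → A → ℤ) : Set where
  constructor splits
  field
    left right : A → ℤ
    left-≤     : ∀ x → ℤ.∣ left x ∣ ℕ.≤ b
    right-≤    : ∀ x → ℤ.∣ right x ∣ ℕ.≤ b
    factors    : ∀ x y → h x y ≡ left x * right y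

-- Every other edge misses i or j, so its factor depends on at most one of a and b and is absorbed
-- by the corresponding side. Each factor is at most 2 in absolute value.
weight-splits : {A : Set} {f : A → A → ℤ} → Bounded f → {k : ℕ} (σ : Fin k → Fin k → Bool)
  (i j : Fin k) (L : List (Fin k × Fin k)) → All (Apart (i , j)) L → i ≢ j → (v : Vec A k) →
  Splits (2 ℕ.^ length L) (λ a b → weight f σ L (v [ i ]≔ a [ j ]≔ b))
weight-splits bounded σ i j [] [] i≢j v = splits (λ _ → 1ℤ) (λ _ → 1ℤ) (λ _ → ℕ.≤-refl) (λ _ → ℕ.≤-refl) λ _ _ → refl
weight-splits {f = f} bounded σ i j ((i′ , j′) ∷ L) (apart ∷ aparts) i≢j v
  with weight-splits bounded σ i j L aparts i≢j v | apart
... | splits U V U≤ V≤ W≡UV | inj₁ (i≢i′ , i≢j′) = splits U (λ b → φ b * V b)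
  (λ a → ℕ.≤-trans (U≤ a) (ℕ.m≤m+n _ _))
  (λ b → abs-*-≤ {φ b} {V b} (abs-1+sgn* (σ i′ j′) _ (bounded _ _)) (V≤ b))
  (λ a b → trans (cong₂ (λ x y → (1ℤ + sgn (σ i′ j′) * f x y) * weight f σ L (v [ i ]≔ a [ j ]≔ b))
      (forget a b i′ i≢i′) (forget a b j′ i≢j′))
    (trans (cong (φ b *_) (W≡UV a b)) (exchange (φ b) (U a) (V b))))
  where
  φ : _ → ℤ
  φ b = 1ℤ + sgn (σ i′ j′) * f (lookup (v [ j ]≔ b) i′) (lookup (v [ j ]≔ b) j′)
  exchange : ∀ p u w → p * (u * w) ≡ u * (p * w)
  exchange = solve-∀
  forget : ∀ a b l → i ≢ l → lookup (v [ i ]≔ a [ j ]≔ b) l ≡ lookup (v [ j ]≔ b) l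
  forget a b l i≢l with l ≟ᶠ j
  ... | yes refl = trans (lookup∘update j (v [ i ]≔ a) b) (sym (lookup∘update j v b))
  ... | no l≢j   = trans (lookup∘update′ l≢j (v [ i ]≔ a) b)
    (trans (lookup∘update′ (i≢l ∘ sym) v a) (sym (lookup∘update′ l≢j v b)))
... | splits U V U≤ V≤ W≡UV | inj₂ (j≢i′ , j≢j′) = splits (λ a → φ a * U a) V
  (λ a → abs-*-≤ {φ a} {U a} (abs-1+sgn* (σ i′ j′) _ (bounded _ _)) (U≤ a))
  (λ b → ℕ.≤-trans (V≤ b) (ℕ.m≤m+n _ _))
  (λ a b → trans (cong₂ (λ x y → (1ℤ + sgn (σ i′ j′) * f x y) * weight f σ L (v [ i ]≔ a [ j ]≔ b))
      (lookup∘update′ (j≢i′ ∘ sym) (v [ i ]≔ a) b) (lookup∘update′ (j≢j′ ∘ sym) (v [ i ]≔ a) b))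
    (trans (cong (φ a *_) (W≡UV a b)) (sym (ℤ.*-assoc (φ a) (U a) (V b)))))
  where
  φ : _ → ℤ
  φ a = 1ℤ + sgn (σ i′ j′) * f (lookup (v [ i ]≔ a) i′) (lookup (v [ i ]≔ a) j′)

-- After resampling the endpoints i and j, `weight-splits` turns the sum over them into the bilinear
-- form that `discrepancy` bounds. The two factors n gained by resampling are cancelled at the end.
edge-weight-≤ : {A : Set} (xs : List A) {f : A → A → ℤ} → Skew f → Bounded f → (m : ℕ) →
  let n = length xs in .{{_ : ℕ.NonZero n}} →
  m ℕ.* m ℕ.* (m ℕ.* m) ℕ.* ℤ.∣ C₄ xs f ∣ ℕ.≤ n ℕ.* n ℕ.* (n ℕ.* n) →
  {k : ℕ} (σ : Fin k → Fin k → Bool) (i j : Fin k) (L : List (Fin k × Fin k)) →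
  All (Apart (i , j)) L → i ≢ j →
  m ℕ.* ℤ.∣ ∑ (allVecs xs k) (λ v → f (lookup v i) (lookup v j) * weight f σ L v) ∣ ℕ.≤
    2 ℕ.^ length L ℕ.* 2 ℕ.^ length L ℕ.* n ℕ.^ k
edge-weight-≤ {A} xs {f} skew bounded m few {k} σ i j L aparts i≢j =
  ℕ.*-cancelˡ-≤ n (ℕ.*-cancelˡ-≤ n (begin
    n ℕ.* (n ℕ.* (m ℕ.* ℤ.∣ ∑ V h ∣))
      ≡⟨ trans (regroup n m ℤ.∣ ∑ V h ∣) (cong (m ℕ.*_) (sym abs-averaged)) ⟩
    m ℕ.* ℤ.∣ ∑ V rectangle ∣
      ≤⟨ abs-bound ⟩
    length V ℕ.* (b ℕ.* b ℕ.* (n ℕ.* n))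
      ≡⟨ trans (cong (ℕ._* (b ℕ.* b ℕ.* (n ℕ.* n))) (length-allVecs xs k)) (regroup′ (n ℕ.^ k) b n) ⟩
    n ℕ.* (n ℕ.* (b ℕ.* b ℕ.* n ℕ.^ k)) ∎))
  where
  open ℕ.≤-Reasoning
  n b : ℕ
  n = length xs
  b = 2 ℕ.^ length L
  V : List (Vec A k)
  V = allVecs xs k
  h rectangle : Vec A k → ℤ
  h v = f (lookup v i) (lookup v j) * weight f σ L v
  rectangle v = ∑ xs λ x → ∑ xs λ y → h (v [ i ]≔ x [ j ]≔ y)
  regroup : ∀ n m x → n ℕ.* (n ℕ.* (m ℕ.* x)) ≡ m ℕ.* (n ℕ.* (n ℕ.* x))
  regroup = ℕ-solve-∀
  regroup′ : ∀ p b n → p ℕ.* (b ℕ.* b ℕ.* (n ℕ.* n)) ≡ n ℕ.* (n ℕ.* (b ℕ.* b ℕ.* p))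
  regroup′ = ℕ-solve-∀
  averaged : ∑ V rectangle ≡ + n * (+ n * ∑ V h)
  averaged = trans (∑-update xs i (λ v → ∑ xs λ y → h (v [ j ]≔ y))) (cong (+ n *_) (∑-update xs j h))
  abs-averaged : ℤ.∣ ∑ V rectangle ∣ ≡ n ℕ.* (n ℕ.* ℤ.∣ ∑ V h ∣)
  abs-averaged = trans (cong ℤ.∣_∣ averaged) (trans (ℤ.abs-* (+ n) _) (cong (n ℕ.*_) (ℤ.abs-* (+ n) _)))
  rectangle-≤ : ∀ v → m ℕ.* ℤ.∣ rectangle v ∣ ℕ.≤ b ℕ.* b ℕ.* (n ℕ.* n)
  rectangle-≤ v with weight-splits bounded σ i j L aparts i≢j v
  ... | splits U V U≤ V≤ W≡UV = subst (λ t → m ℕ.* ℤ.∣ t ∣ ℕ.≤ b ℕ.* b ℕ.* (n ℕ.* n))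
    (∑-cong xs λ x → ∑-cong xs λ y → sym (cong₂ _*_ (cong₂ f
      (trans (lookup∘update′ i≢j (v [ i ]≔ x) y) (lookup∘update i v x)) (lookup∘update j (v [ i ]≔ x) y)) (W≡UV x y)))
    (discrepancy xs skew m few b U V U≤ V≤)
  abs-bound : m ℕ.* ℤ.∣ ∑ V rectangle ∣ ℕ.≤ length V ℕ.* (b ℕ.* b ℕ.* (n ℕ.* n))
  abs-bound = subst (ℕ._≤ length V ℕ.* (b ℕ.* b ℕ.* (n ℕ.* n))) (trans (cong ℤ.∣_∣ (sym (*-distribˡ-∑ V (+ m) rectangle))) (ℤ.abs-* (+ m) _))
    (abs-∑-≤ V λ v → subst (ℕ._≤ b ℕ.* b ℕ.* (n ℕ.* n)) (sym (ℤ.abs-* (+ m) (rectangle v))) (rectangle-≤ v))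

-- The sum of 4ʳ over r < l, where 4ʳ is the bound of `edge-weight-≤` when r other edges remain.
error : ℕ → ℕ
error zero    = 0
error (suc l) = error l ℕ.+ 2 ℕ.^ l ℕ.* 2 ℕ.^ l

-- The edges are added one at a time.
weight-count : {A : Set} (xs : List A) {f : A → A → ℤ} → Skew f → Bounded f → (m : ℕ) →
  let n = length xs in .{{_ : ℕ.NonZero n}} →
  m ℕ.* m ℕ.* (m ℕ.* m) ℕ.* ℤ.∣ C₄ xs f ∣ ℕ.≤ n ℕ.* n ℕ.* (n ℕ.* n) →
  {k : ℕ} (σ : Fin k → Fin k → Bool) (L : List (Fin k × Fin k)) →
  AllPairs Apart L → All (λ (i , j) → i ≢ j) L →
  m ℕ.* ℤ.∣ ∑ (allVecs xs k) (weight f σ L) - + (n ℕ.^ k) ∣ ℕ.≤ error (length L) ℕ.* n ℕ.^ k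
weight-count xs {f} skew bounded m few {k} σ [] [] [] = ℕ.≤-reflexive (trans (cong (m ℕ.*_) (cong ℤ.∣_∣
  (trans (cong (_- + (length xs ℕ.^ k)) (trans (∑-const (allVecs xs k) 1ℤ)
    (trans (ℤ.*-identityʳ _) (cong +_ (length-allVecs xs k))))) (ℤ.+-inverseʳ (+ (length xs ℕ.^ k))))))
  (ℕ.*-zeroʳ m))
weight-count xs {f} skew bounded m few {k} σ ((i , j) ∷ L) (aparts ∷ apart) (i≢j ∷ distinct) = begin
  m ℕ.* ℤ.∣ ∑ V (weight f σ ((i , j) ∷ L)) - N ∣
    ≡⟨ cong (λ t → m ℕ.* ℤ.∣ t ∣) expand ⟩
  m ℕ.* ℤ.∣ (∑ V (weight f σ L) - N) + s * ∑ V h ∣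
    ≤⟨ ℕ.*-monoʳ-≤ m (ℤ.∣i+j∣≤∣i∣+∣j∣ (∑ V (weight f σ L) - N) (s * ∑ V h)) ⟩
  m ℕ.* (ℤ.∣ ∑ V (weight f σ L) - N ∣ ℕ.+ ℤ.∣ s * ∑ V h ∣)
    ≡⟨ trans (ℕ.*-distribˡ-+ m _ _) (cong (λ t → m ℕ.* ℤ.∣ ∑ V (weight f σ L) - N ∣ ℕ.+ m ℕ.* t) (abs-sgn* (σ i j) (∑ V h))) ⟩
  m ℕ.* ℤ.∣ ∑ V (weight f σ L) - N ∣ ℕ.+ m ℕ.* ℤ.∣ ∑ V h ∣
    ≤⟨ ℕ.+-mono-≤ (weight-count xs skew bounded m few σ L apart distinct)
         (edge-weight-≤ xs skew bounded m few σ i j L aparts i≢j) ⟩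
  error (length L) ℕ.* length xs ℕ.^ k ℕ.+ 2 ℕ.^ length L ℕ.* 2 ℕ.^ length L ℕ.* length xs ℕ.^ k
    ≡⟨ sym (ℕ.*-distribʳ-+ (length xs ℕ.^ k) (error (length L)) _) ⟩
  error (suc (length L)) ℕ.* length xs ℕ.^ k ∎
  where
  open ℕ.≤-Reasoning
  V : List (Vec _ k)
  V = allVecs xs k
  N s : ℤ
  N = + (length xs ℕ.^ k)
  s = sgn (σ i j)
  h : Vec _ k → ℤ
  h v = f (lookup v i) (lookup v j) * weight f σ L v
  abs-sgn* : ∀ b x → ℤ.∣ sgn b * x ∣ ≡ ℤ.∣ x ∣
  abs-sgn* true  x = cong ℤ.∣_∣ (ℤ.*-identityˡ x)
  abs-sgn* false x = trans (cong ℤ.∣_∣ (ℤ.-1*i≡-i x)) (ℤ.∣-i∣≡∣i∣ x)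
  distrib : ∀ s x w → (1ℤ + s * x) * w ≡ w + s * (x * w)
  distrib = solve-∀
  regroup : ∀ w x n → w + x - n ≡ (w - n) + x
  regroup = solve-∀
  expand : ∑ V (weight f σ ((i , j) ∷ L)) - N ≡ (∑ V (weight f σ L) - N) + s * ∑ V h
  expand = trans (cong (_- N) (trans (∑-cong V λ v → distrib s (f (lookup v i) (lookup v j)) (weight f σ L v))
    (trans (∑-distrib-+ V (weight f σ L) (λ v → s * h v)) (cong (_+_ (∑ V (weight f σ L))) (sym (*-distribˡ-∑ V s h))))))
    (regroup (∑ V (weight f σ L)) (s * ∑ V h) N)

-- Embeddings and induced copies

-- Lists without repetitions that have the same members are permutations of each other.
length-bijection : {A B : Set} {xs : List A} {ys : List B} → Unique xs → Unique ys →
  (to : A → B) → (∀ {x y} → to x ≡ to y → x ≡ y) →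
  (∀ {x} → x ∈ xs → to x ∈ ys) → (∀ {y} → y ∈ ys → ∃ λ x → x ∈ xs × y ≡ to x) →
  length xs ≡ length ys
length-bijection {xs = xs} {ys} xs! ys! to to-injective to-∈ from = trans (sym (List.length-map to xs))
  (↭-length (∼bag⇒↭ (unique∧set⇒bag (Unique.map⁺ to-injective xs!) ys! (mk⇔ into out))))
  where
  into : ∀ {y} → y ∈ map to xs → y ∈ ys
  into y∈ with x , x∈xs , refl ← ∈-map⁻ to y∈ = to-∈ x∈xs
  out : ∀ {y} → y ∈ ys → y ∈ map to xs
  out y∈ys with x , x∈xs , refl ← from y∈ys = ∈-map⁺ to x∈xs

allVecs-unique : {A : Set} {xs : List A} → Unique xs → ∀ n → Unique (allVecs xs n)
allVecs-unique xs! zero    = [] ∷ []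
allVecs-unique xs! (suc n) = Unique.cartesianProductWith⁺ _∷_ (λ { refl → refl , refl }) xs! (allVecs-unique xs! n)

functions : ∀ k n → List (Vec (Fin n) k)
functions k n = allVecs (allFin n) k

subsets : ∀ n → List (Subset n)
subsets = allVecs (inside ∷ outside ∷ [])

functions-unique : ∀ k n → Unique (functions k n)
functions-unique k n = allVecs-unique (Unique.allFin⁺ n) k

∈-functions : ∀ {k n} (v : Vec (Fin n) k) → v ∈ functions k n
∈-functions = ∈-allVecs ∈-allFin

subsets-unique : ∀ n → Unique (subsets n)
subsets-unique = allVecs-unique (((λ ()) ∷ []) ∷ [] ∷ [])

∈-subsets : ∀ {n} (S : Subset n) → S ∈ subsets n
∈-subsets = ∈-allVecs λ { true → here refl ; false → there (here refl) }

indicator : {P : Set} → Dec P → ℤ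
indicator P? = if does P? then 1ℤ else 0ℤ

length-filter-∑ : {A : Set} {P : A → Set} (P? : ∀ x → Dec (P x)) (xs : List A) →
  + length (filter P? xs) ≡ ∑ xs (λ x → indicator (P? x))
length-filter-∑ P? []       = refl
length-filter-∑ P? (x ∷ xs) with P? x
... | yes _ = cong (_+_ 1ℤ) (length-filter-∑ P? xs)
... | no  _ = trans (length-filter-∑ P? xs) (sym (ℤ.+-identityˡ _))

length-filter-singleton : {A : Set} (_≟_ : ∀ (x y : A) → Dec (x ≡ y)) {xs : List A} → Unique xs →
  ∀ {x} → x ∈ xs → length (filter (x ≟_) xs) ≡ 1
length-filter-singleton {A} _≟_ {xs} xs! {x} x∈xs = length-bijection {ys = x ∷ []} (Unique.filter⁺ (x ≟_) xs!) ([] ∷ []) id id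
  (λ {y} y∈ → here (sym (proj₂ (∈-filter⁻ (x ≟_) {y} {xs} y∈))))
  (λ { (here refl) → x , ∈-filter⁺ (x ≟_) x∈xs refl , refl })

length-fibers : {A B : Set} (_≟_ : ∀ (x y : B) → Dec (x ≡ y)) (g : A → B) (xs : List A) {ys : List B} →
  Unique ys → (∀ y → y ∈ ys) → + length xs ≡ ∑ ys (λ y → + length (filter (λ x → g x ≟ y) xs))
length-fibers _≟_ g xs {ys} ys! ∈ys = sym (begin
  ∑ ys (λ y → + length (filter (λ x → g x ≟ y) xs))
    ≡⟨ ∑-cong ys (λ y → length-filter-∑ (λ x → g x ≟ y) xs) ⟩
  ∑ ys (λ y → ∑ xs λ x → indicator (g x ≟ y))
    ≡⟨ ∑-swap ys xs _ ⟩
  ∑ xs (λ x → ∑ ys λ y → indicator (g x ≟ y))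
    ≡⟨ ∑-cong xs (λ x → trans (sym (length-filter-∑ (g x ≟_) ys)) (cong +_ (length-filter-singleton _≟_ ys! (∈ys (g x))))) ⟩
  ∑ xs (λ _ → 1ℤ)
    ≡⟨ trans (∑-const xs 1ℤ) (ℤ.*-identityʳ _) ⟩
  + length xs ∎)
  where open ≡-Reasoning

-- Working with arbitrary Boolean relations lets one count serve both tournaments and the empty
-- relation, whose embeddings are all injections.
Relation : ℕ → Set
Relation n = Fin n → Fin n → Bool

Iso : ∀ {m n} → Relation m → Relation n → (Fin m → Fin n) → Set
Iso R R′ f = Bijective _≡_ _≡_ f × (∀ i j → R i j ≡ R′ (f i) (f j))

Emb : ∀ {m n} → Relation m → Relation n → (Fin m → Fin n) → Set
Emb R R′ f = Injective _≡_ _≡_ f × (∀ i j → R i j ≡ R′ (f i) (f j))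

restrict : ∀ {n} → Relation n → (S : Subset n) → Relation ∣ S ∣
restrict R S i j = R (element S i) (element S j)

image : ∀ {k n} → Vec (Fin n) k → Subset n
image v = tabulate λ x → does (any? λ i → lookup v i ≟ᶠ x)

lookup-element : ∀ {n} (S : Subset n) j → lookup S (element S j) ≡ inside
lookup-element (inside  ∷ S) zero    = refl
lookup-element (inside  ∷ S) (suc j) = lookup-element S j
lookup-element (outside ∷ S) j       = lookup-element S j

element-surjective : ∀ {n} (S : Subset n) x → lookup S x ≡ inside → ∃ λ j → element S j ≡ x
element-surjective (inside  ∷ S) zero    e = zero , refl
element-surjective (inside  ∷ S) (suc x) e with j , refl ← element-surjective S x e = suc j , refl
element-surjective (outside ∷ S) (suc x) e with j , refl ← element-surjective S x e = j , refl

image-sound : ∀ {k n} (v : Vec (Fin n) k) x → lookup (image v) x ≡ inside → ∃ λ i → lookup v i ≡ x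
image-sound v x e with any? (λ i → lookup v i ≟ᶠ x) | trans (sym (lookup∘tabulate _ x)) e
... | yes p | _ = p

image-complete : ∀ {k n} (v : Vec (Fin n) k) i → lookup (image v) (lookup v i) ≡ inside
image-complete v i with any? (λ j → lookup v j ≟ᶠ lookup v i) | lookup∘tabulate (λ x → does (any? λ j → lookup v j ≟ᶠ x)) (lookup v i)
... | yes _ | e = e
... | no ¬p | _ = ⊥-elim (¬p (i , refl))

image-unique : ∀ {k n} (v : Vec (Fin n) k) (S : Subset n) →
  (∀ i → lookup S (lookup v i) ≡ inside) → (∀ x → lookup S x ≡ inside → ∃ λ i → lookup v i ≡ x) →
  image v ≡ S
image-unique v S in-S from-S = trans (tabulate-cong agree) (tabulate∘lookup S)
  where
  agree : ∀ x → does (any? λ i → lookup v i ≟ᶠ x) ≡ lookup S x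
  agree x with any? (λ i → lookup v i ≟ᶠ x) | lookup S x in e
  ... | yes _            | true  = refl
  ... | yes (i , refl)   | false = ⊥-elim (case trans (sym e) (in-S i) of λ ())
  ... | no ¬p            | true  = ⊥-elim (¬p (from-S x e))
  ... | no _             | false = refl

map-injective : {A B : Set} {g : A → B} → (∀ {x y} → g x ≡ g y → x ≡ y) →
  ∀ {k} {v w : Vec A k} → Vec.map g v ≡ Vec.map g w → v ≡ w
map-injective g-inj {v = []}    {[]}    e = refl
map-injective g-inj {v = x ∷ v} {y ∷ w} e = cong₂ _∷_ (g-inj (Vec.∷-injectiveˡ e)) (map-injective g-inj (Vec.∷-injectiveʳ e))

lookup-tabulate-map : ∀ {k} {A B : Set} (g : A → B) (v : Vec B k) (w : Fin k → A) →
  (∀ i → g (w i) ≡ lookup v i) → v ≡ Vec.map g (tabulate w)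
lookup-tabulate-map g v w e = trans (sym (tabulate∘lookup v))
  (trans (tabulate-cong (λ i → sym (e i))) (tabulate-∘ g w))

surjective : {A B : Set} {f : A → B} → Surjective _≡_ _≡_ f → ∀ y → ∃ λ x → f x ≡ y
surjective surj y = proj₁ (surj y) , proj₂ (surj y) refl

module _ {k n : ℕ} (R : Relation k) (R′ : Relation n)
  (emb? : (v : Vec (Fin n) k) → Dec (Emb R R′ (lookup v)))
  (iso? : (S : Subset n) (v : Vec (Fin ∣ S ∣) k) → Dec (Iso R (restrict R′ S) (lookup v)))
  where

  -- Composition with `element S` is a bijection from the isomorphisms onto the structure induced by
  -- S to the embeddings with image S. The decision procedures are parameters, so that the count
  -- applies literally to those used in the definition of density.
  embeddings-with-image : (S : Subset n) →
    length (filter (λ v → ≡-dec Bool._≟_ (image v) S) (filter emb? (functions k n))) ≡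
    length (filter (iso? S) (functions k ∣ S ∣))
  embeddings-with-image S = sym (length-bijection
    (Unique.filter⁺ (iso? S) (functions-unique k ∣ S ∣))
    (Unique.filter⁺ _ (Unique.filter⁺ emb? (functions-unique k n)))
    (Vec.map (element S)) (map-injective (element-injective S)) into out)
    where
    into : ∀ {w} → w ∈ filter (iso? S) (functions k ∣ S ∣) →
      Vec.map (element S) w ∈ filter (λ v → ≡-dec Bool._≟_ (image v) S) (filter emb? (functions k n))
    into {w} w∈ with _ , (inj , surj) , arcs ← ∈-filter⁻ (iso? S) {xs = functions k ∣ S ∣} w∈ =
      ∈-filter⁺ _ (∈-filter⁺ emb? (∈-functions v) ((λ {i} {j} → injective i j) , arcs′)) (image-unique v S in-S from-S)
      where
      v : Vec (Fin n) k
      v = Vec.map (element S) w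
      v≡ : ∀ i → lookup v i ≡ element S (lookup w i)
      v≡ i = lookup-map i (element S) w
      injective : ∀ i j → lookup v i ≡ lookup v j → i ≡ j
      injective i j e = inj (element-injective S (trans (sym (v≡ i)) (trans e (v≡ j))))
      arcs′ : ∀ i j → R i j ≡ R′ (lookup v i) (lookup v j)
      arcs′ i j = trans (arcs i j) (sym (cong₂ R′ (v≡ i) (v≡ j)))
      in-S : ∀ i → lookup S (lookup v i) ≡ inside
      in-S i = trans (cong (lookup S) (v≡ i)) (lookup-element S (lookup w i))
      from-S : ∀ x → lookup S x ≡ inside → ∃ λ i → lookup v i ≡ x
      from-S x e with j , refl ← element-surjective S x e with i , refl ← surjective surj j = i , v≡ i
    out : ∀ {v} → v ∈ filter (λ v → ≡-dec Bool._≟_ (image v) S) (filter emb? (functions k n)) →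
      ∃ λ w → w ∈ filter (iso? S) (functions k ∣ S ∣) × v ≡ Vec.map (element S) w
    out {v} v∈ with v∈′ , refl ← ∈-filter⁻ (λ v → ≡-dec Bool._≟_ (image v) S) {xs = filter emb? (functions k n)} v∈
      with _ , inj , arcs ← ∈-filter⁻ emb? {xs = functions k n} v∈′ =
      tabulate w , ∈-filter⁺ (iso? S) (∈-functions _) (((λ {i} {j} → injective i j) , strictlySurjective⇒surjective surj′) , arcs′)
        , lookup-tabulate-map (element S) v w w≡
      where
      w : Fin k → Fin ∣ S ∣
      w i = proj₁ (element-surjective S (lookup v i) (image-complete v i))
      w≡ : ∀ i → element S (w i) ≡ lookup v i
      w≡ i = proj₂ (element-surjective S (lookup v i) (image-complete v i))
      w′≡ : ∀ i → element S (lookup (tabulate w) i) ≡ lookup v i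
      w′≡ i = trans (cong (element S) (lookup∘tabulate w i)) (w≡ i)
      injective : ∀ i j → lookup (tabulate w) i ≡ lookup (tabulate w) j → i ≡ j
      injective i j e = inj (trans (sym (w′≡ i)) (trans (cong (element S) e) (w′≡ j)))
      surj′ : ∀ j → ∃ λ i → lookup (tabulate w) i ≡ j
      surj′ j with i , e ← image-sound v (element S j) (lookup-element S j) = i , element-injective S (trans (w′≡ i) e)
      arcs′ : ∀ i j → R i j ≡ R′ (element S (lookup (tabulate w) i)) (element S (lookup (tabulate w) j))
      arcs′ i j = trans (arcs i j) (sym (cong₂ R′ (w′≡ i) (w′≡ j)))

  module _ (aut? : (v : Vec (Fin k) k) → Dec (Iso R R (lookup v)))
    (isomorphic? : (S : Subset n) → Dec (∃ (Iso R (restrict R′ S)))) where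

    -- Composing automorphisms with one fixed isomorphism g reaches every isomorphism exactly once.
    isomorphisms≡automorphisms : (S : Subset n) → ∃ (Iso R (restrict R′ S)) →
      length (filter (iso? S) (functions k ∣ S ∣)) ≡ length (filter aut? (functions k k))
    isomorphisms≡automorphisms S (g , (g-inj , g-surj) , g-arcs) = sym (length-bijection
      (Unique.filter⁺ aut? (functions-unique k k)) (Unique.filter⁺ (iso? S) (functions-unique k ∣ S ∣))
      (Vec.map g) (map-injective g-inj) into out)
      where
      into : ∀ {u} → u ∈ filter aut? (functions k k) → Vec.map g u ∈ filter (iso? S) (functions k ∣ S ∣)
      into {u} u∈ with _ , (inj , surj) , arcs ← ∈-filter⁻ aut? {xs = functions k k} u∈ =
        ∈-filter⁺ (iso? S) (∈-functions _) (((λ {i} {j} → injective i j) , strictlySurjective⇒surjective surj′) , arcs′)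
        where
        ≡g : ∀ i → lookup (Vec.map g u) i ≡ g (lookup u i)
        ≡g i = lookup-map i g u
        injective : ∀ i j → lookup (Vec.map g u) i ≡ lookup (Vec.map g u) j → i ≡ j
        injective i j e = inj (g-inj (trans (sym (≡g i)) (trans e (≡g j))))
        surj′ : ∀ y → ∃ λ i → lookup (Vec.map g u) i ≡ y
        surj′ y with j , refl ← surjective g-surj y with i , refl ← surjective surj j = i , ≡g i
        arcs′ : ∀ i j → R i j ≡ restrict R′ S (lookup (Vec.map g u) i) (lookup (Vec.map g u) j)
        arcs′ i j = trans (arcs i j) (trans (g-arcs _ _) (sym (cong₂ (restrict R′ S) (≡g i) (≡g j))))
      out : ∀ {w} → w ∈ filter (iso? S) (functions k ∣ S ∣) → ∃ λ u → u ∈ filter aut? (functions k k) × w ≡ Vec.map g u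
      out {w} w∈ with _ , (inj , surj) , arcs ← ∈-filter⁻ (iso? S) {xs = functions k ∣ S ∣} w∈ =
        tabulate u , ∈-filter⁺ aut? (∈-functions _) (((λ {i} {j} → injective i j) , strictlySurjective⇒surjective surj′) , arcs′)
          , lookup-tabulate-map g w u u≡
        where
        u : Fin k → Fin k
        u i = proj₁ (surjective g-surj (lookup w i))
        u≡ : ∀ i → g (u i) ≡ lookup w i
        u≡ i = proj₂ (surjective g-surj (lookup w i))
        u′≡ : ∀ i → g (lookup (tabulate u) i) ≡ lookup w i
        u′≡ i = trans (cong g (lookup∘tabulate u i)) (u≡ i)
        injective : ∀ i j → lookup (tabulate u) i ≡ lookup (tabulate u) j → i ≡ j
        injective i j e = inj (trans (sym (u′≡ i)) (trans (cong g e) (u′≡ j)))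
        surj′ : ∀ y → ∃ λ i → lookup (tabulate u) i ≡ y
        surj′ y with i , e ← surjective surj (g y) = i , g-inj (trans (u′≡ i) e)
        arcs′ : ∀ i j → R i j ≡ R (lookup (tabulate u) i) (lookup (tabulate u) j)
        arcs′ i j = trans (arcs i j) (trans (sym (cong₂ (restrict R′ S) (u′≡ i) (u′≡ j))) (sym (g-arcs _ _)))

    isomorphisms : (S : Subset n) → + length (filter (iso? S) (functions k ∣ S ∣)) ≡
      + length (filter aut? (functions k k)) * indicator (isomorphic? S)
    isomorphisms S with isomorphic? S
    ... | yes R≅S = trans (cong +_ (isomorphisms≡automorphisms S R≅S)) (sym (ℤ.*-identityʳ _))
    ... | no  R≇S = trans (cong (λ l → + length l)
        (List.filter-none (iso? S) {functions k ∣ S ∣} (All.universal (λ w iso → R≇S (lookup w , iso)) _)))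
      (sym (ℤ.*-zeroʳ (+ length (filter aut? (functions k k)))))

    -- Every embedding is an isomorphism onto the substructure induced by its
    -- image, and all nonempty sets of isomorphisms have |Aut R| elements.
    length-embeddings : length (filter emb? (functions k n)) ≡
      length (filter aut? (functions k k)) ℕ.* length (filter isomorphic? (subsets n))
    length-embeddings = ℤ.+-injective (begin
      + length (filter emb? (functions k n))
        ≡⟨ length-fibers (≡-dec Bool._≟_) image (filter emb? (functions k n)) (subsets-unique n) ∈-subsets ⟩
      ∑ (subsets n) (λ S → + length (filter (λ v → ≡-dec Bool._≟_ (image v) S) (filter emb? (functions k n))))
        ≡⟨ ∑-cong (subsets n) (λ S → trans (cong +_ (embeddings-with-image S)) (isomorphisms S)) ⟩
      ∑ (subsets n) (λ S → α * indicator (isomorphic? S))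
        ≡⟨ sym (*-distribˡ-∑ (subsets n) α _) ⟩
      α * ∑ (subsets n) (λ S → indicator (isomorphic? S))
        ≡⟨ cong (α *_) (sym (length-filter-∑ isomorphic? (subsets n))) ⟩
      α * + length (filter isomorphic? (subsets n))
        ≡⟨ sym (ℤ.pos-* (length (filter aut? (functions k k))) _) ⟩
      + (length (filter aut? (functions k k)) ℕ.* length (filter isomorphic? (subsets n))) ∎)
      where
      open ≡-Reasoning
      α : ℤ
      α = + length (filter aut? (functions k k))

-- Counting injections

injective? : ∀ {k n} (f : Fin k → Fin n) → Dec (Injective _≡_ _≡_ f)
injective? f = map′ (λ h {x} {y} → h x y) (λ h x y → h {x} {y})
  (all? λ x → all? λ y → (f x ≟ᶠ f y) →-dec (x ≟ᶠ y))

surjective? : ∀ {k n} (f : Fin k → Fin n) → Dec (Surjective _≡_ _≡_ f)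
surjective? f = map′ strictlySurjective⇒surjective surjective (all? λ y → any? λ x → f x ≟ᶠ y)

emb? : ∀ {k n} (R : Relation k) (R′ : Relation n) f → Dec (Emb R R′ f)
emb? R R′ f = injective? f ×-dec (all? λ i → all? λ j → R i j Bool.≟ R′ (f i) (f j))

injections : ℕ → ℕ → ℕ
injections k n = length (filter (injective? ∘ lookup) (functions k n))

length-image : ∀ {k n} (w : Vec (Fin n) k) → Injective _≡_ _≡_ (lookup w) →
  length (filter (λ a → any? λ i → lookup w i ≟ᶠ a) (allFin n)) ≡ k
length-image {k} {n} w inj = sym (trans (sym (List.length-tabulate {n = k} id)) (length-bijection
  (Unique.allFin⁺ k) (Unique.filter⁺ _ (Unique.allFin⁺ n)) (lookup w) inj
  (λ {i} _ → ∈-filter⁺ _ (∈-allFin _) (i , refl))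
  (λ {a} a∈ → let i , e = proj₂ (∈-filter⁻ (λ a → any? λ i → lookup w i ≟ᶠ a) {xs = allFin n} a∈) in i , ∈-allFin i , sym e)))

indicator-yes : {P : Set} (P? : Dec P) → P → indicator P? ≡ 1ℤ
indicator-yes (yes _) p = refl
indicator-yes (no ¬p) p = ⊥-elim (¬p p)

indicator-no : {P : Set} (P? : Dec P) → ¬ P → indicator P? ≡ 0ℤ
indicator-no (yes p) ¬p = ⊥-elim (¬p p)
indicator-no (no _)  ¬p = refl

-- An injective w extends by the n − k vertices outside its image.
extensions : ∀ {k n} (w : Vec (Fin n) k) →
  ∑ (allFin n) (λ a → indicator (injective? (lookup (a ∷ w)))) ≡ (+ n - + k) * indicator (injective? (lookup w))
extensions {k} {n} w = go (injective? (lookup w))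
  where
  open ≡-Reasoning
  inside? : ∀ a → Dec (∃ λ i → lookup w i ≡ a)
  inside? a = any? λ i → lookup w i ≟ᶠ a
  tidy : ∀ n k → n * 1ℤ + - 1ℤ * k ≡ (n - k) * 1ℤ
  tidy = solve-∀
  injective-∷ : ∀ {a} → Injective _≡_ _≡_ (lookup w) → ¬ (∃ λ i → lookup w i ≡ a) →
    ∀ x y → lookup (a ∷ w) x ≡ lookup (a ∷ w) y → x ≡ y
  injective-∷ inj a∉w zero    zero    e = refl
  injective-∷ inj a∉w zero    (suc y) e = ⊥-elim (a∉w (y , sym e))
  injective-∷ inj a∉w (suc x) zero    e = ⊥-elim (a∉w (x , e))
  injective-∷ inj a∉w (suc x) (suc y) e = cong suc (inj e)
  complement : Injective _≡_ _≡_ (lookup w) → ∀ a (d : Dec (∃ λ i → lookup w i ≡ a)) →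
    indicator (injective? (lookup (a ∷ w))) ≡ 1ℤ + - 1ℤ * indicator d
  complement inj a (yes (i , e)) = indicator-no (injective? (lookup (a ∷ w)))
    λ inj′ → case inj′ {suc i} {zero} e of λ ()
  complement inj a (no a∉w) = indicator-yes (injective? (lookup (a ∷ w))) λ {x} {y} → injective-∷ inj a∉w x y
  go : (d : Dec (Injective _≡_ _≡_ (lookup w))) →
    ∑ (allFin n) (λ a → indicator (injective? (lookup (a ∷ w)))) ≡ (+ n - + k) * indicator d
  go (no ¬inj) = trans (trans (∑-cong (allFin n) λ a → indicator-no (injective? (lookup (a ∷ w)))
      λ inj → ¬inj λ e → suc-injective (inj e)) (∑-zero (allFin n))) (sym (ℤ.*-zeroʳ (+ n - + k)))
  go (yes inj) = begin
    ∑ (allFin n) (λ a → indicator (injective? (lookup (a ∷ w))))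
      ≡⟨ ∑-cong (allFin n) (λ a → complement inj a (inside? a)) ⟩
    ∑ (allFin n) (λ a → 1ℤ + - 1ℤ * indicator (inside? a))
      ≡⟨ ∑-distrib-+ (allFin n) (λ _ → 1ℤ) (λ a → - 1ℤ * indicator (inside? a)) ⟩
    ∑ (allFin n) (λ _ → 1ℤ) + ∑ (allFin n) (λ a → - 1ℤ * indicator (inside? a))
      ≡⟨ cong₂ _+_ (∑-const (allFin n) 1ℤ) (sym (*-distribˡ-∑ (allFin n) (- 1ℤ) _)) ⟩
    + length (allFin n) * 1ℤ + - 1ℤ * ∑ (allFin n) (λ a → indicator (inside? a))
      ≡⟨ cong₂ (λ s t → + s * 1ℤ + - 1ℤ * t) (List.length-tabulate {n = n} id)
           (trans (sym (length-filter-∑ inside? (allFin n))) (cong +_ (length-image w inj))) ⟩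
    + n * 1ℤ + - 1ℤ * + k
      ≡⟨ tidy (+ n) (+ k) ⟩
    (+ n - + k) * 1ℤ ∎

-- The factor is an integer and is negative for k > n, where both counts are 0.
injections-suc : ∀ k n → + injections (suc k) n ≡ (+ n - + k) * + injections k n
injections-suc k n = begin
  + injections (suc k) n
    ≡⟨ length-filter-∑ (injective? ∘ lookup) (functions (suc k) n) ⟩
  ∑ (functions (suc k) n) (λ v → indicator (injective? (lookup v)))
    ≡⟨ trans (∑-allVecs (allFin n) k _) (∑-swap (allFin n) (functions k n) _) ⟩
  ∑ (functions k n) (λ w → ∑ (allFin n) λ a → indicator (injective? (lookup (a ∷ w))))
    ≡⟨ ∑-cong (functions k n) extensions ⟩
  ∑ (functions k n) (λ w → (+ n - + k) * indicator (injective? (lookup w)))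
    ≡⟨ sym (*-distribˡ-∑ (functions k n) (+ n - + k) _) ⟩
  (+ n - + k) * ∑ (functions k n) (λ w → indicator (injective? (lookup w)))
    ≡⟨ cong ((+ n - + k) *_) (sym (length-filter-∑ (injective? ∘ lookup) (functions k n))) ⟩
  (+ n - + k) * + injections k n ∎
  where open ≡-Reasoning

injections-zero : ∀ n → injections 0 n ≡ 1
injections-zero n = cong length (List.filter-accept (injective? ∘ lookup {A = Fin n}) {[]} {[]} λ { {()} })

-- The falling factorial is peeled off at its largest factor, which on the diagonal k = n gives the
-- recursion of the factorial.
injections-suc-suc : ∀ k n → + injections (suc k) (suc n) ≡ + suc n * + injections k n
injections-suc-suc zero    n = trans (injections-suc 0 (suc n)) (cong₂ (λ s t → s * + t)
  (ℤ.+-identityʳ (+ suc n)) (trans (injections-zero (suc n)) (sym (injections-zero n))))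
injections-suc-suc (suc k) n = begin
  + injections (suc (suc k)) (suc n)                    ≡⟨ injections-suc (suc k) (suc n) ⟩
  (+ suc n - + suc k) * + injections (suc k) (suc n)    ≡⟨ cong ((+ suc n - + suc k) *_) (injections-suc-suc k n) ⟩
  (1ℤ + + n - (1ℤ + + k)) * ((1ℤ + + n) * + injections k n) ≡⟨ regroup (+ n) (+ k) (+ injections k n) ⟩
  (1ℤ + + n) * ((+ n - + k) * + injections k n)         ≡⟨ cong (+ suc n *_) (sym (injections-suc k n)) ⟩
  + suc n * + injections (suc k) n ∎
  where
  open ≡-Reasoning
  regroup : ∀ n k i → (1ℤ + n - (1ℤ + k)) * ((1ℤ + n) * i) ≡ (1ℤ + n) * ((n - k) * i)
  regroup = solve-∀

injections-! : ∀ k → injections k k ≡ k !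
injections-! zero    = injections-zero 0
injections-! (suc k) = ℤ.+-injective (trans (injections-suc-suc k k)
  (trans (sym (ℤ.pos-* (suc k) (injections k k))) (cong (λ t → + (suc k ℕ.* t)) (injections-! k))))

length-functions : ∀ k n → length (functions k n) ≡ n ℕ.^ k
length-functions k n = trans (length-allVecs (allFin n) k) (cong (ℕ._^ k) (List.length-tabulate {n = n} id))

injections-≤ : ∀ k n → injections k n ℕ.≤ n ℕ.^ k
injections-≤ k n = subst (injections k n ℕ.≤_) (length-functions k n)
  (List.length-filter (injective? ∘ lookup) (functions k n))

-- At most k² nᵏ⁻¹ tuples have a collision; multiplying by n avoids the exponent k - 1 and truncated
-- subtraction.
injections-≥ : ∀ k n → n ℕ.* n ℕ.^ k ℕ.≤ n ℕ.* injections k n ℕ.+ k ℕ.* k ℕ.* n ℕ.^ k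
injections-≥ zero    n = ℕ.≤-reflexive (trans (cong (n ℕ.*_) (sym (injections-zero n))) (sym (ℕ.+-identityʳ _)))
injections-≥ (suc k) n = begin
  n ℕ.* (n ℕ.* n ℕ.^ k)
    ≤⟨ ℕ.*-monoʳ-≤ n (injections-≥ k n) ⟩
  n ℕ.* (n ℕ.* injections k n ℕ.+ k ℕ.* k ℕ.* n ℕ.^ k)
    ≡⟨ cong (λ t → n ℕ.* (t ℕ.+ k ℕ.* k ℕ.* n ℕ.^ k)) step ⟩
  n ℕ.* (injections (suc k) n ℕ.+ k ℕ.* injections k n ℕ.+ k ℕ.* k ℕ.* n ℕ.^ k)
    ≤⟨ ℕ.*-monoʳ-≤ n (ℕ.+-monoˡ-≤ _ (ℕ.+-monoʳ-≤ (injections (suc k) n) (ℕ.*-monoʳ-≤ k (injections-≤ k n)))) ⟩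
  n ℕ.* (injections (suc k) n ℕ.+ k ℕ.* n ℕ.^ k ℕ.+ k ℕ.* k ℕ.* n ℕ.^ k)
    ≡⟨ regroup n (injections (suc k) n) k (n ℕ.^ k) ⟩
  n ℕ.* injections (suc k) n ℕ.+ (k ℕ.+ k ℕ.* k) ℕ.* (n ℕ.* n ℕ.^ k)
    ≤⟨ ℕ.+-monoʳ-≤ (n ℕ.* injections (suc k) n) (ℕ.*-monoˡ-≤ (n ℕ.* n ℕ.^ k) (ℕ.≤-trans (ℕ.m≤n+m _ (suc k)) (ℕ.≤-reflexive (tidy k)))) ⟩
  n ℕ.* injections (suc k) n ℕ.+ suc k ℕ.* suc k ℕ.* (n ℕ.* n ℕ.^ k) ∎
  where
  open ℕ.≤-Reasoning
  regroup : ∀ n i k p → n ℕ.* (i ℕ.+ k ℕ.* p ℕ.+ k ℕ.* k ℕ.* p) ≡ n ℕ.* i ℕ.+ (k ℕ.+ k ℕ.* k) ℕ.* (n ℕ.* p)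
  regroup = ℕ-solve-∀
  tidy : ∀ k → suc k ℕ.+ (k ℕ.+ k ℕ.* k) ≡ suc k ℕ.* suc k
  tidy = ℕ-solve-∀
  isolate : ∀ n k i → n * i ≡ (n - k) * i + k * i
  isolate = solve-∀
  step : n ℕ.* injections k n ≡ injections (suc k) n ℕ.+ k ℕ.* injections k n
  step = ℤ.+-injective (trans (ℤ.pos-* n _) (trans (isolate (+ n) (+ k) (+ injections k n))
    (sym (cong₂ _+_ (injections-suc k n) (ℤ.pos-* k (injections k n))))))

filter-filter : {A : Set} {P Q : A → Set} (P? : ∀ x → Dec (P x)) (Q? : ∀ x → Dec (Q x)) →
  (∀ {x} → P x → Q x) → ∀ xs → filter P? (filter Q? xs) ≡ filter P? xs
filter-filter P? Q? P⇒Q []       = refl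
filter-filter P? Q? P⇒Q (x ∷ xs) with Q? x
... | no ¬q = trans (filter-filter P? Q? P⇒Q xs) (sym (List.filter-reject P? (¬q ∘ P⇒Q)))
... | yes _ with P? x
... | yes _ = cong (x ∷_) (filter-filter P? Q? P⇒Q xs)
... | no _  = filter-filter P? Q? P⇒Q xs

bijective⇒≡ : ∀ {m n} {f : Fin m → Fin n} → Bijective _≡_ _≡_ f → m ≡ n
bijective⇒≡ {f = f} (inj , surj) = ℕ.≤-antisym (Fin.injective⇒≤ inj)
  (Fin.injective⇒≤ {f = λ y → proj₁ (surjective surj y)} λ {x} {y} e →
    trans (sym (proj₂ (surjective surj x))) (trans (cong f e) (proj₂ (surjective surj y))))

-- Injections are the embeddings of relations that hold nowhere.
length-injections : ∀ k n → injections k n ≡ k ! ℕ.* length (subsetsOfSize n k)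
length-injections k n = begin
  injections k n
    ≡⟨ embeddings n ⟩
  length (filter bijective? (functions k k)) ℕ.* length (subsetsOfSize n k)
    -- The number of self-bijections is found from the same formula with n = k, where there is just
    -- one subset of size k.
    ≡⟨ cong (ℕ._* length (subsetsOfSize n k)) (trans (sym (ℕ.*-identityʳ (length (filter bijective? (functions k k))))) (trans
         (cong (length (filter bijective? (functions k k)) ℕ.*_) (sym full-subset))
         (trans (sym (embeddings k)) (injections-! k)))) ⟩
  k ! ℕ.* length (subsetsOfSize n k) ∎
  where
  open ≡-Reasoning
  nowhere : ∀ {n} → Relation n
  nowhere _ _ = false
  bijective? : ∀ {n} (v : Vec (Fin n) k) → Dec (Iso nowhere nowhere (lookup v))
  bijective? v = map′ (_, λ _ _ → refl) proj₁ (injective? (lookup v) ×-dec surjective? (lookup v))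
  bijection : ∀ {n} → n ≡ k → ∃ (Iso {k} {n} nowhere nowhere)
  bijection refl = id , (id , strictlySurjective⇒surjective (λ y → y , refl)) , λ _ _ → refl
  isomorphic? : ∀ {n} (S : Subset n) → Dec (∃ (Iso {k} nowhere (restrict nowhere S)))
  isomorphic? S = map′ bijection (λ (_ , bij , _) → sym (bijective⇒≡ bij)) (∣ S ∣ ℕ.≟ k)
  embeddings : ∀ n → injections k n ≡ length (filter bijective? (functions k k)) ℕ.* length (subsetsOfSize n k)
  embeddings n = trans (cong length (List.filter-≐ (injective? ∘ lookup) (λ v → map′ (_, λ _ _ → refl) proj₁ (injective? (lookup v)))
      ((λ inj → (λ {x} {y} → inj {x} {y}) , λ _ _ → refl) , λ p {x} {y} → proj₁ p {x} {y}) (functions k n)))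
    (trans (length-embeddings {k} {n} nowhere nowhere _ (λ S → bijective?) bijective? isomorphic?)
      (cong (λ l → length (filter bijective? (functions k k)) ℕ.* length l)
        (List.filter-≐ isomorphic? (λ S → ∣ S ∣ ℕ.≟ k) ((λ (_ , bij , _) → sym (bijective⇒≡ bij)) , bijection) (subsets n))))
  full-subset : length (subsetsOfSize k k) ≡ 1
  full-subset = trans (cong length (List.filter-≐ (λ S → ∣ S ∣ ℕ.≟ k) (≡-dec Bool._≟_ ⊤)
      ((λ e → sym (∣p∣≡n⇒p≡⊤ e)) , λ { refl → ∣⊤∣≡n k }) (subsets k)))
    (length-filter-singleton (≡-dec Bool._≟_) (subsets-unique k) (∈-subsets ⊤))

copies : ∀ {k n} → Tournament k → Tournament n → ℕ
copies {k} {n} S T = length (filter (λ A → S ≅? induced T A) (subsetsOfSize n k))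

embeddings : ∀ {k n} → Tournament k → Tournament n → ℕ
embeddings {k} {n} S T = length (filter (λ v → emb? (arc S) (arc T) (lookup v)) (functions k n))

embeddings≡Aut*copies : ∀ {k n} (S : Tournament k) (T : Tournament n) → embeddings S T ≡ ∣Aut S ∣ ℕ.* copies S T
embeddings≡Aut*copies {k} {n} S T = trans
  (length-embeddings (arc S) (arc T) _ (λ A → isIsomorphism? S (induced T A) ∘ lookup)
    (isIsomorphism? S S ∘ lookup) (λ A → S ≅? induced T A))
  -- The density restricts to subsets of size k first; an isomorphism forces that size anyway.
  (cong (λ l → ∣Aut S ∣ ℕ.* length l) (sym (filter-filter (λ A → S ≅? induced T A) (λ A → ∣ A ∣ ℕ.≟ k)
    (λ (_ , bij , _) → sym (bijective⇒≡ bij)) (subsets n))))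

-- Arc signs of a tournament

bit : Bool → ℤ
bit b = if b then 1ℤ else 0ℤ

-- As a difference it is skew and vanishes on the diagonal, with no need to decide x = y.
arcSign : ∀ {n} → Tournament n → Fin n → Fin n → ℤ
arcSign T x y = bit (arc T x y) - bit (arc T y x)

arcSign-skew : ∀ {n} (T : Tournament n) → Skew (arcSign T)
arcSign-skew T x y = antisymmetric (bit (arc T y x)) (bit (arc T x y))
  where
  antisymmetric : ∀ a b → a - b ≡ - (b - a)
  antisymmetric = solve-∀

arcSign-bounded : ∀ {n} (T : Tournament n) → Bounded (arcSign T)
arcSign-bounded T x y with arc T x y | arc T y x
... | true  | true  = z≤n
... | true  | false = ℕ.≤-refl
... | false | true  = ℕ.≤-refl
... | false | false = z≤n

arcSign-≢ : ∀ {n} (T : Tournament n) {x y} → x ≢ y → arcSign T x y ≡ sgn (arc T x y)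
arcSign-≢ T {x} {y} x≢y with arc T x y | arc T y x | exactly-one T x y x≢y
... | true  | false | _ = refl
... | false | true  | _ = refl

pairs-complete : ∀ {k} (i j : Fin k) → i ≢ j → ((i , j) ∈ pairs k) ⊎ ((j , i) ∈ pairs k)
pairs-complete zero    zero    i≢j = ⊥-elim (i≢j refl)
pairs-complete zero    (suc j) i≢j = inj₁ (∈-++⁺ˡ (∈-map⁺ _ (∈-allFin j)))
pairs-complete (suc i) zero    i≢j = inj₂ (∈-++⁺ˡ (∈-map⁺ _ (∈-allFin i)))
pairs-complete (suc i) (suc j) i≢j with pairs-complete i j (i≢j ∘ cong suc)
... | inj₁ ij∈ = inj₁ (∈-++⁺ʳ (map (λ j → zero , suc j) (allFin _)) (∈-map⁺ _ ij∈))
... | inj₂ ji∈ = inj₂ (∈-++⁺ʳ (map (λ j → zero , suc j) (allFin _)) (∈-map⁺ _ ji∈))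

length-pairs : ∀ k → length (pairs k) ≡ k C 2
length-pairs zero    = refl
length-pairs (suc k) = trans (List.length-++ (map (λ j → zero , suc j) (allFin k))) (trans
  (cong₂ ℕ._+_ (trans (List.length-map _ (allFin k)) (trans (List.length-tabulate {n = k} id) (sym (nC1≡n k))))
    (trans (List.length-map _ (pairs k)) (length-pairs k)))
  (nCk+nC[k+1]≡[n+1]C[k+1] k 1))

-- Weights compared with embeddings

weight-nonneg : {A : Set} {f : A → A → ℤ} → Bounded f → ∀ {k} (σ : Relation k) L v → 0ℤ ≤ weight f σ L v
weight-nonneg bounded σ []            v = +≤+ z≤n
weight-nonneg bounded σ ((i , j) ∷ L) v = 0≤* (0≤1+sgn* (σ i j) _ (bounded _ _)) (weight-nonneg bounded σ L v)

weight-≤ : {A : Set} {f : A → A → ℤ} → Bounded f → ∀ {k} (σ : Relation k) L v → weight f σ L v ≤ + (2 ℕ.^ length L)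
weight-≤ {f = f} bounded σ L v = subst (_≤ + (2 ℕ.^ length L)) (ℤ.0≤i⇒+∣i∣≡i (weight-nonneg bounded σ L v)) (+≤+ (go L))
  where
  go : ∀ L → ℤ.∣ weight f σ L v ∣ ℕ.≤ 2 ℕ.^ length L
  go []            = ℕ.≤-refl
  go ((i , j) ∷ L) = abs-*-≤ {1ℤ + sgn (σ i j) * f (lookup v i) (lookup v j)} {weight f σ L v}
    (abs-1+sgn* (σ i j) _ (bounded _ _)) (go L)

module _ {k n : ℕ} (S : Tournament k) (T : Tournament n) where

  private
    f : Fin n → Fin n → ℤ
    f = arcSign T
    w : Vec (Fin n) k → ℤ
    w = weight f (arc S) (pairs k)
    P : ℕ
    P = 2 ℕ.^ length (pairs k)

  weight-embedding : ∀ {v} → Emb (arc S) (arc T) (lookup v) → ∀ {L} → All (λ (i , j) → i ≢ j) L →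
    weight f (arc S) L v ≡ + (2 ℕ.^ length L)
  weight-embedding emb [] = refl
  weight-embedding {v} emb@(inj , arcs) {(i , j) ∷ L} (i≢j ∷ distinct) = trans
    (cong₂ _*_ (trans (cong₂ (λ b x → 1ℤ + sgn b * x) (arcs i j) (arcSign-≢ T (i≢j ∘ inj))) (factor (arc T (lookup v i) (lookup v j))))
      (weight-embedding emb distinct))
    (sym (ℤ.pos-* 2 (2 ℕ.^ length L)))
    where
    factor : ∀ b → 1ℤ + sgn b * sgn b ≡ + 2
    factor true  = refl
    factor false = refl

  weight-injection : ∀ {v} → Injective _≡_ _≡_ (lookup v) → ∀ {L} → All (λ (i , j) → i ≢ j) L →
    (weight f (arc S) L v ≡ 0ℤ) ⊎ All (λ (i , j) → arc S i j ≡ arc T (lookup v i) (lookup v j)) L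
  weight-injection inj [] = inj₂ []
  weight-injection {v} inj {(i , j) ∷ L} (i≢j ∷ distinct) with weight-injection {v} inj distinct
  ... | inj₁ w≡0 = inj₁ (trans (cong ((1ℤ + sgn (arc S i j) * f (lookup v i) (lookup v j)) *_) w≡0)
    (ℤ.*-zeroʳ (1ℤ + sgn (arc S i j) * f (lookup v i) (lookup v j))))
  ... | inj₂ agree with arc S i j Bool.≟ arc T (lookup v i) (lookup v j)
  ...   | yes e = inj₂ (e ∷ agree)
  ...   | no ¬e = inj₁ (cong (_* weight f (arc S) L v) (trans
    (cong (λ x → 1ℤ + sgn (arc S i j) * x) (arcSign-≢ T (i≢j ∘ inj))) (factor (arc S i j) (arc T (lookup v i) (lookup v j)) ¬e)))
    where
    factor : ∀ a b → a ≢ b → 1ℤ + sgn a * sgn b ≡ 0ℤ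
    factor true  true  a≢b = ⊥-elim (a≢b refl)
    factor true  false a≢b = refl
    factor false true  a≢b = refl
    factor false false a≢b = ⊥-elim (a≢b refl)

  -- Each unordered pair occurs in `pairs k` in one orientation; the other orientation and the
  -- diagonal follow from the tournament axioms.
  agree⇒embedding : ∀ {v} → Injective _≡_ _≡_ (lookup v) →
    All (λ (i , j) → arc S i j ≡ arc T (lookup v i) (lookup v j)) (pairs k) → Emb (arc S) (arc T) (lookup v)
  agree⇒embedding {v} inj agree = (λ {x} {y} → inj {x} {y}) , arcs
    where
    arcs : ∀ i j → arc S i j ≡ arc T (lookup v i) (lookup v j)
    arcs i j with i ≟ᶠ j
    ... | yes refl = trans (loopless S i) (sym (loopless T (lookup v i)))
    ... | no i≢j with pairs-complete i j i≢j
    ...   | inj₁ ij∈ = All.lookup agree ij∈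
    ...   | inj₂ ji∈ = trans (exactly-one S i j i≢j) (trans (cong not (All.lookup agree ji∈))
      (sym (exactly-one T _ _ (i≢j ∘ inj))))

  weight-≥-indicator : ∀ v → + P * indicator (emb? (arc S) (arc T) (lookup v)) ≤ w v
  weight-≥-indicator v = go (emb? (arc S) (arc T) (lookup v))
    where
    go : (d : Dec (Emb (arc S) (arc T) (lookup v))) → + P * indicator d ≤ w v
    go (yes emb) = ℤ.≤-reflexive (trans (ℤ.*-identityʳ (+ P)) (sym (weight-embedding {v} emb (pairs-distinct k))))
    go (no _)    = subst (_≤ w v) (sym (ℤ.*-zeroʳ (+ P))) (weight-nonneg {f = f} (arcSign-bounded T) (arc S) (pairs k) v)

  -- An injective tuple that is no embedding has a vanishing factor `1 ± f`. Other tuples have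
  -- weight at most P, and the second term pays for those with a collision.
  weight-≤-indicator : ∀ v → w v ≤ + P * indicator (emb? (arc S) (arc T) (lookup v)) + (+ P + - + P * indicator (injective? (lookup v)))
  weight-≤-indicator v = go (emb? (arc S) (arc T) (lookup v)) (injective? (lookup v))
    where
    cancel : ∀ p → p ≡ p * 1ℤ + (p + - p * 1ℤ)
    cancel = solve-∀
    keep : ∀ p → p ≡ p * 0ℤ + (p + - p * 0ℤ)
    keep = solve-∀
    vanish : ∀ p → 0ℤ ≡ p * 0ℤ + (p + - p * 1ℤ)
    vanish = solve-∀
    w≤P : w v ≤ + P
    w≤P = weight-≤ {f = f} (arcSign-bounded T) (arc S) (pairs k) v
    go : (d : Dec (Emb (arc S) (arc T) (lookup v))) (d′ : Dec (Injective _≡_ _≡_ (lookup v))) →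
      w v ≤ + P * indicator d + (+ P + - + P * indicator d′)
    go (yes emb) (no ¬inj) = ⊥-elim (¬inj (proj₁ emb))
    go (yes emb) (yes _)   = subst (w v ≤_) (cancel (+ P)) w≤P
    go (no _)    (no _)    = subst (w v ≤_) (keep (+ P)) w≤P
    go (no ¬emb) (yes inj) with weight-injection {v} inj (pairs-distinct k)
    ... | inj₁ w≡0   = subst₂ _≤_ (sym w≡0) (vanish (+ P)) ℤ.≤-refl
    ... | inj₂ agree = ⊥-elim (¬emb (agree⇒embedding {v} inj agree))

  -- In this direction collisions cost nothing, since dropping nonnegative weights only decreases
  -- the sum.
  embeddings-≤-weight : + (P ℕ.* embeddings S T) ≤ ∑ (functions k n) w
  embeddings-≤-weight = subst (_≤ ∑ (functions k n) w) sum≡ (∑-mono-≤ (functions k n) weight-≥-indicator)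
    where
    sum≡ : ∑ (functions k n) (λ v → + P * indicator (emb? (arc S) (arc T) (lookup v))) ≡ + (P ℕ.* embeddings S T)
    sum≡ = trans (sym (*-distribˡ-∑ (functions k n) (+ P) _)) (trans
      (cong (+ P *_) (sym (length-filter-∑ (λ v → emb? (arc S) (arc T) (lookup v)) (functions k n)))) (sym (ℤ.pos-* P _)))

  weight-≤-embeddings : ∑ (functions k n) w ≤ + (P ℕ.* embeddings S T) + + (P ℕ.* (n ℕ.^ k ℕ.∸ injections k n))
  weight-≤-embeddings = subst (∑ V w ≤_) sum≡ (∑-mono-≤ V weight-≤-indicator)
    where
    open ≡-Reasoning
    V : List (Vec (Fin n) k)
    V = functions k n
    e i : Vec (Fin n) k → ℤ
    e v = indicator (emb? (arc S) (arc T) (lookup v))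
    i v = indicator (injective? (lookup v))
    regroup : ∀ p a n b → p * a + (n * p + - p * b) ≡ p * a + p * (n - b)
    regroup = solve-∀
    difference : + (n ℕ.^ k) - + injections k n ≡ + (n ℕ.^ k ℕ.∸ injections k n)
    difference = trans (ℤ.[+m]-[+n]≡m⊖n (n ℕ.^ k) (injections k n)) (ℤ.⊖-≥ (injections-≤ k n))
    sum≡ : ∑ V (λ v → + P * e v + (+ P + - + P * i v)) ≡ + (P ℕ.* embeddings S T) + + (P ℕ.* (n ℕ.^ k ℕ.∸ injections k n))
    sum≡ = begin
      ∑ V (λ v → + P * e v + (+ P + - + P * i v))
        ≡⟨ trans (∑-distrib-+ V (λ v → + P * e v) (λ v → + P + - + P * i v))
             (cong (_+_ (∑ V (λ v → + P * e v))) (∑-distrib-+ V (λ _ → + P) (λ v → - + P * i v))) ⟩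
      ∑ V (λ v → + P * e v) + (∑ V (λ _ → + P) + ∑ V (λ v → - + P * i v))
        ≡⟨ cong₂ _+_ (sym (*-distribˡ-∑ V (+ P) e)) (cong₂ _+_ (∑-const V (+ P)) (sym (*-distribˡ-∑ V (- + P) i))) ⟩
      + P * ∑ V e + (+ length V * + P + - + P * ∑ V i)
        ≡⟨ cong₂ (λ x y → + P * x + (+ length V * + P + - + P * y))
             (sym (length-filter-∑ (λ v → emb? (arc S) (arc T) (lookup v)) V)) (sym (length-filter-∑ (injective? ∘ lookup) V)) ⟩
      + P * + embeddings S T + (+ length V * + P + - + P * + injections k n)
        ≡⟨ regroup (+ P) (+ embeddings S T) (+ length V) (+ injections k n) ⟩
      + P * + embeddings S T + + P * (+ length V - + injections k n)
        ≡⟨ cong (λ x → + P * + embeddings S T + + P * x) (trans (cong (λ l → + l - + injections k n) (length-functions k n)) difference) ⟩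
      + P * + embeddings S T + + P * + (n ℕ.^ k ℕ.∸ injections k n)
        ≡⟨ sym (cong₂ _+_ (ℤ.pos-* P _) (ℤ.pos-* P _)) ⟩
      + (P ℕ.* embeddings S T) + + (P ℕ.* (n ℕ.^ k ℕ.∸ injections k n)) ∎

  -- The two error terms come from tuples with collisions and from replacing the weighted count by
  -- nᵏ.
  embeddings-estimate : (m : ℕ) .{{_ : ℕ.NonZero n}} →
    m ℕ.* m ℕ.* (m ℕ.* m) ℕ.* ℤ.∣ C₄ (allFin n) f ∣ ℕ.≤ n ℕ.* n ℕ.* (n ℕ.* n) →
    m ℕ.* ℤ.∣ + (P ℕ.* embeddings S T) - + (n ℕ.^ k) ∣ ℕ.≤
      m ℕ.* (P ℕ.* (n ℕ.^ k ℕ.∸ injections k n)) ℕ.+ error (length (pairs k)) ℕ.* n ℕ.^ k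
  embeddings-estimate m few = begin
    m ℕ.* ℤ.∣ X - N ∣
      ≡⟨ cong (λ t → m ℕ.* ℤ.∣ t ∣) (telescope X W N) ⟩
    m ℕ.* ℤ.∣ (X - W) + (W - N) ∣
      ≤⟨ ℕ.*-monoʳ-≤ m (ℤ.∣i+j∣≤∣i∣+∣j∣ (X - W) (W - N)) ⟩
    m ℕ.* (ℤ.∣ X - W ∣ ℕ.+ ℤ.∣ W - N ∣)
      ≡⟨ ℕ.*-distribˡ-+ m _ _ ⟩
    m ℕ.* ℤ.∣ X - W ∣ ℕ.+ m ℕ.* ℤ.∣ W - N ∣
      ≤⟨ ℕ.+-mono-≤ (ℕ.*-monoʳ-≤ m X-W) W-N ⟩
    m ℕ.* (P ℕ.* (n ℕ.^ k ℕ.∸ injections k n)) ℕ.+ error (length (pairs k)) ℕ.* n ℕ.^ k ∎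
    where
    open ℕ.≤-Reasoning
    X W N D : ℤ
    X = + (P ℕ.* embeddings S T)
    W = ∑ (functions k n) w
    N = + (n ℕ.^ k)
    D = + (P ℕ.* (n ℕ.^ k ℕ.∸ injections k n))
    telescope : ∀ x w n → x - n ≡ (x - w) + (w - n)
    telescope = solve-∀
    length-allFin : length (allFin n) ≡ n
    length-allFin = List.length-tabulate {n = n} id
    W-N : m ℕ.* ℤ.∣ W - N ∣ ℕ.≤ error (length (pairs k)) ℕ.* n ℕ.^ k
    W-N = subst (λ l → m ℕ.* ℤ.∣ W - + (l ℕ.^ k) ∣ ℕ.≤ error (length (pairs k)) ℕ.* l ℕ.^ k) length-allFin
      (weight-count (allFin n) (arcSign-skew T) (arcSign-bounded T) m
        {{subst ℕ.NonZero (sym length-allFin) (ℕ.≢-nonZero (ℕ.≢-nonZero⁻¹ n))}}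
        (subst (λ l → m ℕ.* m ℕ.* (m ℕ.* m) ℕ.* ℤ.∣ C₄ (allFin n) f ∣ ℕ.≤ l ℕ.* l ℕ.* (l ℕ.* l)) (sym length-allFin) few)
        (arc S) (pairs k) (pairs-apart k) (pairs-distinct k))
    X-W : ℤ.∣ X - W ∣ ℕ.≤ P ℕ.* (n ℕ.^ k ℕ.∸ injections k n)
    X-W = ℤ.drop‿+≤+ (subst (_≤ D) (sym (trans (cong +_ (ℤ.∣i-j∣≡∣j-i∣ X W)) (ℤ.0≤i⇒+∣i∣≡i (ℤ.i≤j⇒0≤j-i embeddings-≤-weight))))
      (subst (W - X ≤_) (cancel X D) (ℤ.+-monoˡ-≤ (- X) weight-≤-embeddings)))
      where
      cancel : ∀ x d → x + d + - x ≡ d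
      cancel = solve-∀

embeddings₅⁸-bound : ∀ {n} (T : Tournament n) →
  54 ℕ.* (1024 ℕ.* embeddings T₅⁸ T) ℕ.+ 36 ℕ.* (n ℕ.* ℤ.∣ C₄ (allFin n) (arcSign T) ∣) ℕ.≤ 54 ℕ.* n ℕ.^ 5
embeddings₅⁸-bound {n} T = ℤ.drop‿+≤+ (begin
  + (54 ℕ.* (1024 ℕ.* embeddings T₅⁸ T) ℕ.+ 36 ℕ.* (n ℕ.* c))
    ≡⟨ cong₂ _+_ (ℤ.pos-* 54 (1024 ℕ.* embeddings T₅⁸ T)) (trans (ℤ.pos-* 36 (n ℕ.* c)) (cong (+ 36 *_) (trans (ℤ.pos-* n c) (cong (+ n *_) +c≡)))) ⟩
  + 54 * + (1024 ℕ.* embeddings T₅⁸ T) + + 36 * (+ n * C)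
    ≤⟨ ℤ.+-monoˡ-≤ _ (ℤ.*-monoˡ-≤-nonNeg (+ 54) (subst (+ (1024 ℕ.* embeddings T₅⁸ T) ≤_) (∑-cong (functions 5 n) agree) (embeddings-≤-weight T₅⁸ T))) ⟩
  + 54 * ∑ (functions 5 n) (λ v → linearFactors signs₅⁸ (edges f v)) + + 36 * (+ n * C)
    ≤⟨ subst (λ l → + 54 * ∑ (functions 5 n) (λ v → linearFactors signs₅⁸ (edges f v)) + + 36 * (+ l * C) ≤ + 54 * + (l ℕ.^ 5))
         (List.length-tabulate {n = n} id) (weighted-count₅⁸ (allFin n) (arcSign-skew T) (arcSign-bounded T)) ⟩
  + 54 * + (n ℕ.^ 5)
    ≡⟨ sym (ℤ.pos-* 54 (n ℕ.^ 5)) ⟩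
  + (54 ℕ.* n ℕ.^ 5) ∎)
  where
  open ℤ.≤-Reasoning
  f : Fin n → Fin n → ℤ
  f = arcSign T
  C : ℤ
  C = C₄ (allFin n) f
  c : ℕ
  c = ℤ.∣ C ∣
  +c≡ : + c ≡ C
  +c≡ = ℤ.0≤i⇒+∣i∣≡i (∑-nonneg (allFin n) λ x → ∑-nonneg (allFin n) λ y → 0≤i*i (codegree (allFin n) f x y))
  agree : ∀ v → weight f (arc T₅⁸) (pairs 5) v ≡ linearFactors signs₅⁸ (edges f v)
  -- Both `pairs 5` and `edges` list the pairs in lexicographic order, and `signs₅⁸` holds the arcs
  -- of `T₅⁸` in that order.
  agree (_ ∷ _ ∷ _ ∷ _ ∷ _ ∷ []) = refl

-- Tournaments with few four-cycles

-- Skew Hadamard matrices by doubling: from S with S Sᵀ = (N − 1) I one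
-- passes to ((S , S + I) , (S − I , − S)).
δ : ∀ {j} → Vec Bool j → Vec Bool j → ℤ
δ []          []          = 1ℤ
δ (true ∷ x)  (true ∷ y)  = δ x y
δ (false ∷ x) (false ∷ y) = δ x y
δ (true ∷ x)  (false ∷ y) = 0ℤ
δ (false ∷ x) (true ∷ y)  = 0ℤ

hadamard : ∀ {j} → Vec Bool j → Vec Bool j → ℤ
hadamard []          []          = 0ℤ
hadamard (false ∷ x) (false ∷ y) = hadamard x y
hadamard (false ∷ x) (true ∷ y)  = hadamard x y + δ x y
hadamard (true ∷ x)  (false ∷ y) = hadamard x y - δ x y
hadamard (true ∷ x)  (true ∷ y)  = - hadamard x y

δ-sym : ∀ {j} (x y : Vec Bool j) → δ y x ≡ δ x y
δ-sym []          []          = refl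
δ-sym (true ∷ x)  (true ∷ y)  = δ-sym x y
δ-sym (false ∷ x) (false ∷ y) = δ-sym x y
δ-sym (true ∷ x)  (false ∷ y) = refl
δ-sym (false ∷ x) (true ∷ y)  = refl

hadamard-skew : ∀ {j} → Skew (hadamard {j})
hadamard-skew []          []          = refl
hadamard-skew (false ∷ x) (false ∷ y) = hadamard-skew x y
hadamard-skew (true ∷ x)  (true ∷ y)  = cong -_ (hadamard-skew x y)
hadamard-skew (false ∷ x) (true ∷ y)  = trans (cong₂ _-_ (hadamard-skew x y) (δ-sym x y)) (negate (hadamard x y) (δ x y))
  where
  negate : ∀ h d → - h - d ≡ - (h + d)
  negate = solve-∀
hadamard-skew (true ∷ x)  (false ∷ y) = trans (cong₂ _+_ (hadamard-skew x y) (δ-sym x y)) (negate (hadamard x y) (δ x y))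
  where
  negate : ∀ h d → - h + d ≡ - (h - d)
  negate = solve-∀

-- The matrix and the identity are tracked together: the blocks S ± I have all entries ±1 because
-- exactly one of the two summands is nonzero at each place.
data Entry {j : ℕ} (x y : Vec Bool j) : ℤ → ℤ → Set where
  diagonal : x ≡ y → Entry x y 0ℤ 1ℤ
  positive : x ≢ y → Entry x y 1ℤ 0ℤ
  negative : x ≢ y → Entry x y (- 1ℤ) 0ℤ

entry : ∀ {j} (x y : Vec Bool j) → Entry x y (hadamard x y) (δ x y)
entry []          []          = diagonal refl
entry (false ∷ x) (false ∷ y) with hadamard x y | δ x y | entry x y
... | _ | _ | diagonal refl = diagonal refl
... | _ | _ | positive x≢y  = positive λ { refl → x≢y refl }
... | _ | _ | negative x≢y  = negative λ { refl → x≢y refl }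
entry (true ∷ x)  (true ∷ y)  with hadamard x y | δ x y | entry x y
... | _ | _ | diagonal refl = diagonal refl
... | _ | _ | positive x≢y  = negative λ { refl → x≢y refl }
... | _ | _ | negative x≢y  = positive λ { refl → x≢y refl }
entry (false ∷ x) (true ∷ y)  with hadamard x y | δ x y | entry x y
... | _ | _ | diagonal refl = positive λ ()
... | _ | _ | positive x≢y  = positive λ ()
... | _ | _ | negative x≢y  = negative λ ()
entry (true ∷ x)  (false ∷ y) with hadamard x y | δ x y | entry x y
... | _ | _ | diagonal refl = negative λ ()
... | _ | _ | positive x≢y  = positive λ ()
... | _ | _ | negative x≢y  = negative λ ()

words : ∀ j → List (Vec Bool j)
words = allVecs (true ∷ false ∷ [])

∑-words : ∀ j (h : Vec Bool (suc j) → ℤ) →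
  ∑ (words (suc j)) h ≡ ∑ (words j) (λ z → h (true ∷ z)) + ∑ (words j) (λ z → h (false ∷ z))
∑-words j h = trans (∑-allVecs (true ∷ false ∷ []) j h) (cong (_+_ (∑ (words j) (λ z → h (true ∷ z)))) (ℤ.+-identityʳ _))

∑-δ : ∀ {j} (g : Vec Bool j → ℤ) y → ∑ (words j) (λ z → g z * δ y z) ≡ g y
∑-δ g [] = trans (ℤ.+-identityʳ _) (ℤ.*-identityʳ _)
∑-δ {suc j} g (true ∷ y) = trans (∑-words j _) (trans
  (cong₂ _+_ (∑-δ (λ z → g (true ∷ z)) y) (trans (∑-cong (words j) λ z → ℤ.*-zeroʳ (g (false ∷ z))) (∑-zero (words j))))
  (ℤ.+-identityʳ _))
∑-δ {suc j} g (false ∷ y) = trans (∑-words j _) (trans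
  (cong₂ _+_ (trans (∑-cong (words j) λ z → ℤ.*-zeroʳ (g (true ∷ z))) (∑-zero (words j))) (∑-δ (λ z → g (false ∷ z)) y))
  (ℤ.+-identityˡ _))

-- Every block of the doubled matrix is u S + s I; recording u and s allows one expansion for all
-- pairs of block rows.
hCoefficient δCoefficient : Bool → Bool → ℤ
hCoefficient true  true  = - 1ℤ
hCoefficient _     _     = 1ℤ
δCoefficient true  false = - 1ℤ
δCoefficient false true  = 1ℤ
δCoefficient _     _     = 0ℤ

hadamard-block : ∀ {j} a c (x z : Vec Bool j) →
  hadamard (a ∷ x) (c ∷ z) ≡ hCoefficient a c * hadamard x z + δCoefficient a c * δ x z
hadamard-block true true x z = block (hadamard x z) (δ x z)
  where
  block : ∀ h d → - h ≡ - 1ℤ * h + 0ℤ * d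
  block = solve-∀
hadamard-block true false x z = block (hadamard x z) (δ x z)
  where
  block : ∀ h d → h - d ≡ 1ℤ * h + - 1ℤ * d
  block = solve-∀
hadamard-block false true x z = block (hadamard x z) (δ x z)
  where
  block : ∀ h d → h + d ≡ 1ℤ * h + 1ℤ * d
  block = solve-∀
hadamard-block false false x z = block (hadamard x z) (δ x z)
  where
  block : ∀ h d → h ≡ 1ℤ * h + 0ℤ * d
  block = solve-∀

-- For equal first letters the mixed terms cancel by skewness, and two copies of (N - 1) I with one
-- I give 2 N - 1. For different letters the two copies of S Sᵀ have opposite signs and the mixed
-- terms cancel between the blocks.
hadamard-orthogonal : ∀ {j} (x y : Vec Bool j) → codegree (words j) hadamard x y ≡ (+ (2 ℕ.^ j) - 1ℤ) * δ x y
hadamard-orthogonal []      []      = refl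
hadamard-orthogonal {suc j} (a ∷ x) (b ∷ y) = begin
  codegree (words (suc j)) hadamard (a ∷ x) (b ∷ y)
    ≡⟨ ∑-words j _ ⟩
  block true + block false
    ≡⟨ cong₂ _+_ (block≡ true) (block≡ false) ⟩
  value a b true + value a b false
    ≡⟨ by-cases a b ⟩
  (+ 2 * N - 1ℤ) * δ (a ∷ x) (b ∷ y)
    ≡⟨ cong (λ t → (t - 1ℤ) * δ (a ∷ x) (b ∷ y)) (sym (ℤ.pos-* 2 (2 ℕ.^ j))) ⟩
  (+ (2 ℕ.^ suc j) - 1ℤ) * δ (a ∷ x) (b ∷ y) ∎
  where
  open ≡-Reasoning
  Z : List (Vec Bool j)
  Z = words j
  h d : Vec Bool j → Vec Bool j → ℤ
  h = hadamard
  d = δ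
  N : ℤ
  N = + (2 ℕ.^ j)
  block : Bool → ℤ
  block c = ∑ Z (λ z → hadamard (a ∷ x) (c ∷ z) * hadamard (b ∷ y) (c ∷ z))
  form : (u s v t p q e : ℤ) → ℤ
  form u s v t p q e = u * v * p + (u * t * q + (- (s * v) * q + s * t * e))
  value : Bool → Bool → Bool → ℤ
  value a b c = form (hCoefficient a c) (δCoefficient a c) (hCoefficient b c) (δCoefficient b c) ((N - 1ℤ) * d x y) (h x y) (d x y)
  scaled : ∀ c (p : Vec Bool j → ℤ) {r} → ∑ Z p ≡ r → ∑ Z (λ z → c * p z) ≡ c * r
  scaled c p e = trans (sym (*-distribˡ-∑ Z c p)) (cong (c *_) e)
  expand : ∀ u s v t → ∑ Z (λ z → (u * h x z + s * d x z) * (v * h y z + t * d y z)) ≡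
    form u s v t ((N - 1ℤ) * d x y) (h x y) (d x y)
  expand u s v t = begin
    ∑ Z (λ z → (u * h x z + s * d x z) * (v * h y z + t * d y z))
      ≡⟨ ∑-cong Z (λ z → multiply u s v t (h x z) (d x z) (h y z) (d y z)) ⟩
    ∑ Z (λ z → hh z + (hd z + (dh z + dd z)))
      ≡⟨ trans (∑-distrib-+ Z hh (λ z → hd z + (dh z + dd z))) (cong (_+_ (∑ Z hh))
           (trans (∑-distrib-+ Z hd (λ z → dh z + dd z)) (cong (_+_ (∑ Z hd)) (∑-distrib-+ Z dh dd)))) ⟩
    ∑ Z hh + (∑ Z hd + (∑ Z dh + ∑ Z dd))
      ≡⟨ cong₂ _+_ (scaled (u * v) _ (hadamard-orthogonal x y)) (cong₂ _+_ (scaled (u * t) _ (∑-δ (h x) y))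
           (cong₂ _+_ (scaled (s * v) _ (trans (∑-δ (h y) x) (hadamard-skew x y))) (scaled (s * t) _ (∑-δ (d x) y)))) ⟩
    u * v * ((N - 1ℤ) * d x y) + (u * t * h x y + (s * v * - h x y + s * t * d x y))
      ≡⟨ cong (λ r → u * v * ((N - 1ℤ) * d x y) + (u * t * h x y + (r + s * t * d x y))) (negate (s * v) (h x y)) ⟩
    form u s v t ((N - 1ℤ) * d x y) (h x y) (d x y) ∎
    where
    hh hd dh dd : Vec Bool j → ℤ
    hh z = u * v * (h x z * h y z)
    hd z = u * t * (h x z * d y z)
    dh z = s * v * (h y z * d x z)
    dd z = s * t * (d x z * d y z)
    multiply : ∀ u s v t p c q e → (u * p + s * c) * (v * q + t * e) ≡
      u * v * (p * q) + (u * t * (p * e) + (s * v * (q * c) + s * t * (c * e)))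
    multiply = solve-∀
    negate : ∀ r q → r * - q ≡ - r * q
    negate = solve-∀
  block≡ : ∀ c → block c ≡ value a b c
  block≡ c = trans (∑-cong Z λ z → cong₂ _*_ (hadamard-block a c x z) (hadamard-block b c y z))
    (expand (hCoefficient a c) (δCoefficient a c) (hCoefficient b c) (δCoefficient b c))
  by-cases : ∀ a b → value a b true + value a b false ≡ (+ 2 * N - 1ℤ) * δ (a ∷ x) (b ∷ y)
  by-cases true true = collect N (h x y) (d x y)
    where
    collect : ∀ n q e → (- 1ℤ * - 1ℤ * ((n - 1ℤ) * e) + (- 1ℤ * 0ℤ * q + (- (0ℤ * - 1ℤ) * q + 0ℤ * 0ℤ * e)))
      + (1ℤ * 1ℤ * ((n - 1ℤ) * e) + (1ℤ * - 1ℤ * q + (- (- 1ℤ * 1ℤ) * q + - 1ℤ * - 1ℤ * e))) ≡ (+ 2 * n - 1ℤ) * e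
    collect = solve-∀
  by-cases true false = collect N (h x y) (d x y)
    where
    collect : ∀ n q e → (- 1ℤ * 1ℤ * ((n - 1ℤ) * e) + (- 1ℤ * 1ℤ * q + (- (0ℤ * 1ℤ) * q + 0ℤ * 1ℤ * e)))
      + (1ℤ * 1ℤ * ((n - 1ℤ) * e) + (1ℤ * 0ℤ * q + (- (- 1ℤ * 1ℤ) * q + - 1ℤ * 0ℤ * e))) ≡ (+ 2 * n - 1ℤ) * 0ℤ
    collect = solve-∀
  by-cases false true = collect N (h x y) (d x y)
    where
    collect : ∀ n q e → (1ℤ * - 1ℤ * ((n - 1ℤ) * e) + (1ℤ * 0ℤ * q + (- (1ℤ * - 1ℤ) * q + 1ℤ * 0ℤ * e)))
      + (1ℤ * 1ℤ * ((n - 1ℤ) * e) + (1ℤ * - 1ℤ * q + (- (0ℤ * 1ℤ) * q + 0ℤ * - 1ℤ * e))) ≡ (+ 2 * n - 1ℤ) * 0ℤ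
    collect = solve-∀
  by-cases false false = collect N (h x y) (d x y)
    where
    collect : ∀ n q e → (1ℤ * 1ℤ * ((n - 1ℤ) * e) + (1ℤ * 1ℤ * q + (- (1ℤ * 1ℤ) * q + 1ℤ * 1ℤ * e)))
      + (1ℤ * 1ℤ * ((n - 1ℤ) * e) + (1ℤ * 0ℤ * q + (- (0ℤ * 1ℤ) * q + 0ℤ * 0ℤ * e))) ≡ (+ 2 * n - 1ℤ) * e
    collect = solve-∀

-- The matrices F Fᵀ and Fᵀ F have the same Frobenius norm: both sides sum the products of f over
-- the four corners of all rectangles.
∑-codegree²-transpose : {A B : Set} (xs : List A) (zs : List B) (f : A → B → ℤ) →
  ∑ xs (λ x → ∑ xs λ y → codegree zs f x y * codegree zs f x y) ≡
  ∑ zs (λ z → ∑ zs λ w → codegree xs (λ z x → f x z) z w * codegree xs (λ z x → f x z) z w)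
∑-codegree²-transpose xs zs f = begin
  ∑ xs (λ x → ∑ xs λ y → codegree zs f x y * codegree zs f x y)
    ≡⟨ ∑-cong xs (λ x → ∑-cong xs λ y → trans (∑-*-∑ zs zs _ _) (sym (∑-cartesianProduct zs zs _))) ⟩
  ∑ xs (λ x → ∑ xs λ y → ∑ (cartesianProduct zs zs) λ (z , w) → f x z * f y z * (f x w * f y w))
    ≡⟨ trans (∑-cong xs λ x → ∑-swap xs (cartesianProduct zs zs) _) (∑-swap xs (cartesianProduct zs zs) _) ⟩
  ∑ (cartesianProduct zs zs) (λ (z , w) → ∑ xs λ x → ∑ xs λ y → f x z * f y z * (f x w * f y w))
    ≡⟨ ∑-cartesianProduct zs zs _ ⟩
  ∑ zs (λ z → ∑ zs λ w → ∑ xs λ x → ∑ xs λ y → f x z * f y z * (f x w * f y w))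
    ≡⟨ ∑-cong zs (λ z → ∑-cong zs λ w → trans
         (∑-cong xs λ x → ∑-cong xs λ y → regroup (f x z) (f y z) (f x w) (f y w)) (sym (∑-*-∑ xs xs _ _))) ⟩
  ∑ zs (λ z → ∑ zs λ w → codegree xs (λ z x → f x z) z w * codegree xs (λ z x → f x z) z w) ∎
  where
  open ≡-Reasoning
  regroup : ∀ a b c d → a * b * (c * d) ≡ (a * c) * (b * d)
  regroup = solve-∀

∑-take-≤ : {A : Set} (n : ℕ) (xs : List A) {h : A → ℤ} → (∀ x → 0ℤ ≤ h x) → ∑ (take n xs) h ≤ ∑ xs h
∑-take-≤ zero    xs       0≤h = ∑-nonneg xs 0≤h
∑-take-≤ (suc n) []       0≤h = ℤ.≤-refl
∑-take-≤ (suc n) (x ∷ xs) {h} 0≤h = ℤ.+-monoʳ-≤ (h x) (∑-take-≤ n xs 0≤h)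

-- The codegrees within `ys` are signed sums and cannot be extended to all words termwise, but the
-- outer sums of squares can. Transposing then moves the full range inside, where orthogonality
-- applies, and the new outer sums are extended in turn.
C₄-hadamard : ∀ j n → C₄ (take n (words j)) hadamard ≤ + (2 ℕ.^ j ℕ.* 2 ℕ.^ j ℕ.* 2 ℕ.^ j)
C₄-hadamard j n = begin
  C₄ ys h
    ≤⟨ ℤ.≤-trans (∑-mono-≤ ys λ x → ∑-take-≤ n Z λ y → 0≤i*i (codegree ys h x y))
         (∑-take-≤ n Z λ x → ∑-nonneg Z λ y → 0≤i*i (codegree ys h x y)) ⟩
  ∑ Z (λ x → ∑ Z λ y → codegree ys h x y * codegree ys h x y)
    ≡⟨ ∑-codegree²-transpose Z ys h ⟩
  ∑ ys (λ z → ∑ ys λ w → codegree Z (λ z x → h x z) z w * codegree Z (λ z x → h x z) z w)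
    ≡⟨ ∑-cong ys (λ z → ∑-cong ys λ w → cong (λ t → t * t) (trans
         (∑-cong Z λ x → trans (cong₂ _*_ (hadamard-skew z x) (hadamard-skew w x)) (signs (h z x) (h w x)))
         (hadamard-orthogonal z w))) ⟩
  ∑ ys (λ z → ∑ ys λ w → q z w * q z w)
    ≤⟨ ℤ.≤-trans (∑-mono-≤ ys λ z → ∑-take-≤ n Z λ w → 0≤i*i (q z w))
         (∑-take-≤ n Z λ z → ∑-nonneg Z λ w → 0≤i*i (q z w)) ⟩
  ∑ Z (λ z → ∑ Z λ w → q z w * q z w)
    ≡⟨ ∑-cong Z (λ z → trans (∑-cong Z λ w → diagonal-square (N - 1ℤ) z w)
         (trans (sym (*-distribˡ-∑ Z ((N - 1ℤ) * (N - 1ℤ)) _)) (trans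
           (cong ((N - 1ℤ) * (N - 1ℤ) *_) (∑-δ (λ _ → 1ℤ) z)) (ℤ.*-identityʳ _)))) ⟩
  ∑ Z (λ z → (N - 1ℤ) * (N - 1ℤ))
    ≡⟨ trans (∑-const Z _) (cong (λ l → + l * ((N - 1ℤ) * (N - 1ℤ))) (length-allVecs (true ∷ false ∷ []) j)) ⟩
  N * ((N - 1ℤ) * (N - 1ℤ))
    ≤⟨ cube (2 ℕ.^ j) (ℕ.m^n>0 2 j) ⟩
  + (2 ℕ.^ j ℕ.* 2 ℕ.^ j ℕ.* 2 ℕ.^ j) ∎
  where
  open ℤ.≤-Reasoning
  Z ys : List (Vec Bool j)
  Z = words j
  ys = take n Z
  h q : Vec Bool j → Vec Bool j → ℤ
  h = hadamard
  N : ℤ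
  N = + (2 ℕ.^ j)
  q z w = (N - 1ℤ) * δ z w
  signs : ∀ a b → - a * - b ≡ a * b
  signs = solve-∀
  diagonal-square : ∀ c (z w : Vec Bool j) → (c * δ z w) * (c * δ z w) ≡ c * c * (1ℤ * δ z w)
  diagonal-square c z w with hadamard z w | δ z w | entry z w
  ... | _ | _ | diagonal _ = one-case c
    where
    one-case : ∀ c → c * 1ℤ * (c * 1ℤ) ≡ c * c * (1ℤ * 1ℤ)
    one-case = solve-∀
  ... | _ | _ | positive _ = zero-case c
    where
    zero-case : ∀ c → c * 0ℤ * (c * 0ℤ) ≡ c * c * (1ℤ * 0ℤ)
    zero-case = solve-∀
  ... | _ | _ | negative _ = zero-case c
    where
    zero-case : ∀ c → c * 0ℤ * (c * 0ℤ) ≡ c * c * (1ℤ * 0ℤ)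
    zero-case = solve-∀
  cube : ∀ m → 0 ℕ.< m → + m * ((+ m - 1ℤ) * (+ m - 1ℤ)) ≤ + (m ℕ.* m ℕ.* m)
  cube (suc m) _ = subst (_≤ + (suc m ℕ.* suc m ℕ.* suc m))
    (trans (ℤ.pos-* (suc m) (m ℕ.* m)) (cong (+ suc m *_) (ℤ.pos-* m m)))
    (+≤+ (ℕ.≤-trans (ℕ.*-monoʳ-≤ (suc m) (ℕ.*-mono-≤ (ℕ.n≤1+n m) (ℕ.n≤1+n m)))
      (ℕ.≤-reflexive (sym (ℕ.*-assoc (suc m) (suc m) (suc m))))))

list-lookup-injective : {A : Set} {xs : List A} → Unique xs → ∀ {i j} → List.lookup xs i ≡ List.lookup xs j → i ≡ j
list-lookup-injective (x∉ ∷ xs!) {zero}  {zero}  e = refl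
list-lookup-injective (x∉ ∷ xs!) {zero}  {suc j} e = ⊥-elim (All.lookup x∉ (∈-lookup j) e)
list-lookup-injective (x∉ ∷ xs!) {suc i} {zero}  e = ⊥-elim (All.lookup x∉ (∈-lookup i) (sym e))
list-lookup-injective (x∉ ∷ xs!) {suc i} {suc j} e = cong suc (list-lookup-injective xs! e)

C₄-map : {A B : Set} (g : A → B) (xs : List A) (f : B → B → ℤ) → C₄ (map g xs) f ≡ C₄ xs (λ x y → f (g x) (g y))
C₄-map g xs f = trans (∑-map g xs _) (∑-cong xs λ x → trans (∑-map g xs _) (∑-cong xs λ y →
  cong (λ t → t * t) (∑-map g xs _)))

C₄-cong : {A : Set} (xs : List A) {f g : A → A → ℤ} → (∀ x y → f x y ≡ g x y) → C₄ xs f ≡ C₄ xs g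
C₄-cong xs e = ∑-cong xs λ x → ∑-cong xs λ y → cong (λ t → t * t) (∑-cong xs λ z → cong₂ _*_ (e x z) (e y z))

isPositive : ℤ → Bool
isPositive (+ suc _) = true
isPositive _         = false

hadamardTournament : ∀ {j n} (v : Fin n → Vec Bool j) → (∀ {x y} → v x ≡ v y → x ≡ y) → Tournament n
hadamardTournament v v-inj = record
  { arc         = λ x y → isPositive (hadamard (v x) (v y))
  ; loopless    = λ x → no-loop (v x)
  ; exactly-one = λ x y x≢y → one-arc (v x) (v y) (x≢y ∘ v-inj)
  }
  where
  no-loop : ∀ x → isPositive (hadamard x x) ≡ false
  no-loop x with hadamard x x | δ x x | entry x x
  ... | _ | _ | diagonal _   = refl
  ... | _ | _ | positive x≢x = ⊥-elim (x≢x refl)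
  ... | _ | _ | negative _   = refl
  one-arc : ∀ x y → x ≢ y → isPositive (hadamard x y) ≡ not (isPositive (hadamard y x))
  one-arc x y x≢y = trans (go (entry x y)) (cong (not ∘ isPositive) (sym (hadamard-skew x y)))
    where
    go : ∀ {h d} → Entry x y h d → isPositive h ≡ not (isPositive (- h))
    go (diagonal x≡y) = ⊥-elim (x≢y x≡y)
    go (positive _)   = refl
    go (negative _)   = refl

arcSign-hadamard : ∀ {j n} (v : Fin n → Vec Bool j) (v-inj : ∀ {x y} → v x ≡ v y → x ≡ y) x y →
  arcSign (hadamardTournament v v-inj) x y ≡ hadamard (v x) (v y)
arcSign-hadamard v v-inj x y = trans (cong (λ h → bit (isPositive (hadamard (v x) (v y))) - bit (isPositive h)) (hadamard-skew (v x) (v y)))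
  (go (entry (v x) (v y)))
  where
  go : ∀ {a b h d} → Entry a b h d → bit (isPositive h) - bit (isPositive (- h)) ≡ h
  go (diagonal _) = refl
  go (positive _) = refl
  go (negative _) = refl

power-of-two : ∀ n → ∃ λ j → suc n ℕ.≤ 2 ℕ.^ j × 2 ℕ.^ j ℕ.≤ 2 ℕ.* suc n
power-of-two zero    = 0 , s≤s z≤n , s≤s z≤n
power-of-two (suc n) with power-of-two n
... | j , lower , upper with suc (suc n) ℕ.≤? 2 ℕ.^ j
...   | yes p = j , p , ℕ.≤-trans upper (ℕ.*-monoʳ-≤ 2 (ℕ.n≤1+n (suc n)))
...   | no ¬p = suc j , subst (λ t → suc (suc n) ℕ.≤ 2 ℕ.* t) n≡2^j (ℕ.≤-trans (s≤s (s≤s (ℕ.m≤m+n n _))) (ℕ.≤-reflexive (double n)))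
  , ℕ.*-monoʳ-≤ 2 (ℕ.≤-trans (ℕ.≤-reflexive (sym n≡2^j)) (ℕ.n≤1+n (suc n)))
  where
  n≡2^j : suc n ≡ 2 ℕ.^ j
  n≡2^j = ℕ.≤-antisym lower (ℕ.≤-pred (ℕ.≰⇒> ¬p))
  double : ∀ n → suc (suc (n ℕ.+ n)) ≡ 2 ℕ.* suc n
  double = ℕ-solve-∀

-- For n > 0 the tournament lives on n indices of a matrix of order 2ʲ ≤ 2 n, and 8 is the cube of
-- this factor 2.
few-four-cycles : ∀ n → ∃ λ (T : Tournament n) → ℤ.∣ C₄ (allFin n) (arcSign T) ∣ ℕ.≤ 8 ℕ.* (n ℕ.* n ℕ.* n)
few-four-cycles zero    = record { arc = λ () ; loopless = λ () ; exactly-one = λ () } , z≤n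
few-four-cycles (suc n) with j , lower , upper ← power-of-two n =
  subst (λ l → ∃ λ (T : Tournament l) → ℤ.∣ C₄ (allFin l) (arcSign T) ∣ ℕ.≤ 8 ℕ.* (suc n ℕ.* suc n ℕ.* suc n))
    length-ys (T , bound)
  where
  ys : List (Vec Bool j)
  ys = take (suc n) (words j)
  length-ys : length ys ≡ suc n
  length-ys = trans (List.length-take (suc n) (words j))
    (ℕ.m≤n⇒m⊓n≡m (subst (suc n ℕ.≤_) (sym (length-allVecs (true ∷ false ∷ []) j)) lower))
  ys! : Unique ys
  ys! = Unique.take⁺ (suc n) (allVecs-unique (((λ ()) ∷ []) ∷ [] ∷ []) j)
  T : Tournament (length ys)
  T = hadamardTournament (List.lookup ys) (list-lookup-injective ys!)
  C₄≡ : C₄ (allFin (length ys)) (arcSign T) ≡ C₄ ys hadamard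
  C₄≡ = trans (C₄-cong (allFin (length ys)) (arcSign-hadamard (List.lookup ys) (list-lookup-injective ys!)))
    (trans (sym (C₄-map (List.lookup ys) (allFin (length ys)) hadamard))
      (cong (λ l → C₄ l hadamard) (trans (List.map-tabulate id (List.lookup ys)) (List.tabulate-lookup ys))))
  cube : ∀ n → 2 ℕ.* n ℕ.* (2 ℕ.* n) ℕ.* (2 ℕ.* n) ≡ 8 ℕ.* (n ℕ.* n ℕ.* n)
  cube = ℕ-solve-∀
  bound : ℤ.∣ C₄ (allFin (length ys)) (arcSign T) ∣ ℕ.≤ 8 ℕ.* (suc n ℕ.* suc n ℕ.* suc n)
  bound = ℕ.≤-trans (ℤ.drop‿+≤+ (subst (_≤ + (2 ℕ.^ j ℕ.* 2 ℕ.^ j ℕ.* 2 ℕ.^ j))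
      (trans (sym C₄≡) (sym (ℤ.0≤i⇒+∣i∣≡i (∑-nonneg (allFin (length ys)) λ x → ∑-nonneg (allFin (length ys)) λ y →
        0≤i*i (codegree (allFin (length ys)) (arcSign T) x y)))))
      (C₄-hadamard j (suc n))))
    (ℕ.≤-trans (ℕ.*-mono-≤ (ℕ.*-mono-≤ upper upper) upper) (ℕ.≤-reflexive (cube (suc n))))

-- Limits

archimedean : ∀ ε → 0ℚ ℚ.< ε → ∃ λ K → + 1 / suc K ℚ.≤ ε
archimedean ε 0<ε with ε | ℚ.positive 0<ε
-- The numerator of ε is at least 1, so its own denominator `suc d` serves.
... | mkℚ (+ suc p) d c | _ = d , ℚ.toℚᵘ-cancel-≤ (ℚᵘ.≤-respˡ-≃ (ℚᵘ.≃-sym (ℚ.toℚᵘ-fromℚᵘ (mkℚᵘ (+ 1) d)))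
  (ℚᵘ.*≤* (ℤ.*-monoʳ-≤-nonNeg (+ suc d) {+ 1} {+ suc p} (+≤+ (s≤s z≤n)))))

-- `mkℚᵘ` stores the denominator minus one, and `suc y * suc w` is the successor of `w + y * suc w`.
÷-difference : ∀ x y z w → ℚ.toℚᵘ ℚ.∣ x ÷ suc y ℚ.- z ÷ suc w ∣ ℚᵘ.≃
  mkℚᵘ (+ ℤ.∣ + (x ℕ.* suc w) - + (z ℕ.* suc y) ∣) (w ℕ.+ y ℕ.* suc w)
÷-difference x y z w = ℚᵘ.≃-trans (ℚ.toℚᵘ-homo-∣-∣ (p ℚ.- q)) (ℚᵘ.≃-trans
  (ℚᵘ.∣-∣-cong {ℚ.toℚᵘ (p ℚ.- q)} {P ℚᵘ.- Q} (ℚᵘ.≃-trans (ℚ.toℚᵘ-homo-+ p (ℚ.- q)) (ℚᵘ.+-cong {ℚ.toℚᵘ p} {P}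
    (ℚ.toℚᵘ-fromℚᵘ P) (ℚᵘ.≃-trans (ℚ.toℚᵘ-homo‿- q) (ℚᵘ.-‿cong {ℚ.toℚᵘ q} {Q} (ℚ.toℚᵘ-fromℚᵘ Q))))))
  (ℚᵘ.≃-reflexive (cong (λ t → mkℚᵘ (+ ℤ.∣ t ∣) (w ℕ.+ y ℕ.* suc w)) numerator)))
  where
  p q : ℚ
  p = x ÷ suc y
  q = z ÷ suc w
  P Q : ℚᵘ
  P = mkℚᵘ (+ x) y
  Q = mkℚᵘ (+ z) w
  numerator : + x * + suc w + - + z * + suc y ≡ + (x ℕ.* suc w) - + (z ℕ.* suc y)
  numerator = cong₂ _+_ (sym (ℤ.pos-* x (suc w)))
    (trans (sym (ℤ.neg-distribˡ-* (+ z) (+ suc y))) (cong -_ (sym (ℤ.pos-* z (suc y)))))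

-- With its converse `÷-close⁻` this passes between ℚ and cross-multiplied inequalities in ℕ, where
-- the estimates are made.
÷-close⁺ : ∀ K x y z w .{{_ : ℕ.NonZero y}} .{{_ : ℕ.NonZero w}} →
  suc K ℕ.* ℤ.∣ + (x ℕ.* w) - + (z ℕ.* y) ∣ ℕ.< y ℕ.* w → ℚ.∣ x ÷ y ℚ.- z ÷ w ∣ ℚ.< + 1 / suc K
÷-close⁺ K x (suc y) z (suc w) close = ℚ.toℚᵘ-cancel-< (ℚᵘ.<-respˡ-≃ (ℚᵘ.≃-sym (÷-difference x y z w))
  (ℚᵘ.<-respʳ-≃ (ℚᵘ.≃-sym (ℚ.toℚᵘ-fromℚᵘ (mkℚᵘ (+ 1) K))) (ℚᵘ.*<* (subst₂ ℤ._<_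
    (trans (cong +_ (ℕ.*-comm (suc K) d)) (ℤ.pos-* d (suc K))) (sym (ℤ.*-identityˡ _)) (ℤ.+<+ close)))))
  where
  d : ℕ
  d = ℤ.∣ + (x ℕ.* suc w) - + (z ℕ.* suc y) ∣

÷-close⁻ : ∀ K x y z w .{{_ : ℕ.NonZero y}} .{{_ : ℕ.NonZero w}} →
  ℚ.∣ x ÷ y ℚ.- z ÷ w ∣ ℚ.< + 1 / suc K → suc K ℕ.* ℤ.∣ + (x ℕ.* w) - + (z ℕ.* y) ∣ ℕ.< y ℕ.* w
÷-close⁻ K x (suc y) z (suc w) close = ℤ.drop‿+<+ (subst₂ ℤ._<_
  (trans (sym (ℤ.pos-* d (suc K))) (cong +_ (ℕ.*-comm d (suc K)))) (ℤ.*-identityˡ _)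
  (ℚᵘ.drop-*<* (ℚᵘ.<-respˡ-≃ (÷-difference x y z w)
    (ℚᵘ.<-respʳ-≃ (ℚ.toℚᵘ-fromℚᵘ (mkℚᵘ (+ 1) K)) (ℚ.toℚᵘ-mono-< close)))))
  where
  d : ℕ
  d = ℤ.∣ + (x ℕ.* suc w) - + (z ℕ.* suc y) ∣

÷-monoˡ-≤ : ∀ {x x′} y → x ℕ.≤ x′ → x ÷ y ℚ.≤ x′ ÷ y
÷-monoˡ-≤ zero x≤x′ = ℚ.≤-refl
÷-monoˡ-≤ {x} {x′} (suc y) x≤x′ = ℚ.toℚᵘ-cancel-≤ (ℚᵘ.≤-respˡ-≃ (ℚᵘ.≃-sym (ℚ.toℚᵘ-fromℚᵘ (mkℚᵘ (+ x) y)))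
  (ℚᵘ.≤-respʳ-≃ (ℚᵘ.≃-sym (ℚ.toℚᵘ-fromℚᵘ (mkℚᵘ (+ x′) y))) (ℚᵘ.*≤* (ℤ.*-monoʳ-≤-nonNeg (+ suc y) (+≤+ x≤x′)))))

distance : ℕ → ℕ → ℕ
distance x y = ℤ.∣ + x - + y ∣

distance-≥ : ∀ {x y} → y ℕ.≤ x → distance x y ≡ x ℕ.∸ y
distance-≥ {x} {y} y≤x = trans (cong ℤ.∣_∣ (ℤ.[+m]-[+n]≡m⊖n x y)) (cong ℤ.∣_∣ (ℤ.⊖-≥ y≤x))

distance-≤ : ∀ {x y} → x ℕ.≤ y → distance x y ≡ y ℕ.∸ x
distance-≤ {x} {y} x≤y = trans (ℤ.∣i-j∣≡∣j-i∣ (+ x) (+ y)) (distance-≥ x≤y)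

distance-triangle : ∀ x y z → distance x z ℕ.≤ distance x y ℕ.+ distance y z
distance-triangle x y z = subst (λ t → ℤ.∣ t ∣ ℕ.≤ distance x y ℕ.+ distance y z) (telescope (+ x) (+ y) (+ z))
  (ℤ.∣i+j∣≤∣i∣+∣j∣ (+ x - + y) (+ y - + z))
  where
  telescope : ∀ x y z → x - y + (y - z) ≡ x - z
  telescope = solve-∀

≤+distance : ∀ x y → y ℕ.≤ x ℕ.+ distance x y
≤+distance x y with ℕ.≤-total x y
... | inj₁ x≤y = ℕ.≤-reflexive (sym (trans (cong (x ℕ.+_) (distance-≤ x≤y)) (ℕ.m+[n∸m]≡n x≤y)))
... | inj₂ y≤x = ℕ.≤-trans y≤x (ℕ.m≤m+n x _)

distance-between : ∀ {q x i d} → q ℕ.≤ x → x ℕ.≤ i ℕ.+ d → distance x i ℕ.≤ distance q i ℕ.+ d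
distance-between {q} {x} {i} {d} q≤x x≤i+d with ℕ.≤-total x i
... | inj₁ x≤i = subst₂ (λ s t → s ℕ.≤ t ℕ.+ d) (sym (distance-≤ x≤i)) (sym (distance-≤ (ℕ.≤-trans q≤x x≤i)))
  (ℕ.≤-trans (ℕ.∸-monoʳ-≤ i q≤x) (ℕ.m≤m+n _ d))
... | inj₂ i≤x = subst (ℕ._≤ distance q i ℕ.+ d) (sym (distance-≥ i≤x))
  (ℕ.≤-trans (ℕ.m≤n+o⇒m∸n≤o x i x≤i+d) (ℕ.m≤n+m d _))

injections-gap : ∀ c k n .{{_ : ℕ.NonZero n}} → c ℕ.* (k ℕ.* k) ℕ.≤ n →
  c ℕ.* (n ℕ.^ k ℕ.∸ injections k n) ℕ.≤ n ℕ.^ k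
injections-gap c k n large = ℕ.*-cancelˡ-≤ n (begin
  n ℕ.* (c ℕ.* (n ℕ.^ k ℕ.∸ injections k n))
    ≡⟨ trans (regroup n c _) (cong (c ℕ.*_) (ℕ.*-distribˡ-∸ n (n ℕ.^ k) (injections k n))) ⟩
  c ℕ.* (n ℕ.* n ℕ.^ k ℕ.∸ n ℕ.* injections k n)
    ≤⟨ ℕ.*-monoʳ-≤ c (ℕ.m≤n+o⇒m∸n≤o _ _ (injections-≥ k n)) ⟩
  c ℕ.* (k ℕ.* k ℕ.* n ℕ.^ k)
    ≡⟨ sym (ℕ.*-assoc c (k ℕ.* k) _) ⟩
  c ℕ.* (k ℕ.* k) ℕ.* n ℕ.^ k
    ≤⟨ ℕ.*-monoˡ-≤ (n ℕ.^ k) large ⟩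
  n ℕ.* n ℕ.^ k ∎)
  where
  open ℕ.≤-Reasoning
  regroup : ∀ n c d → n ℕ.* (c ℕ.* d) ≡ c ℕ.* (n ℕ.* d)
  regroup = ℕ-solve-∀

power≤2injections : ∀ k n .{{_ : ℕ.NonZero n}} → 2 ℕ.* (k ℕ.* k) ℕ.≤ n → n ℕ.^ k ℕ.≤ 2 ℕ.* injections k n
power≤2injections k n large = ℕ.+-cancelʳ-≤ (n ℕ.^ k) _ _ (begin
  n ℕ.^ k ℕ.+ n ℕ.^ k
    ≡⟨ cong₂ ℕ._+_ split split ⟩
  injections k n ℕ.+ D ℕ.+ (injections k n ℕ.+ D)
    ≡⟨ regroup (injections k n) D ⟩
  2 ℕ.* injections k n ℕ.+ 2 ℕ.* D
    ≤⟨ ℕ.+-monoʳ-≤ (2 ℕ.* injections k n) (injections-gap 2 k n large) ⟩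
  2 ℕ.* injections k n ℕ.+ n ℕ.^ k ∎)
  where
  open ℕ.≤-Reasoning
  D : ℕ
  D = n ℕ.^ k ℕ.∸ injections k n
  split : n ℕ.^ k ≡ injections k n ℕ.+ D
  split = sym (ℕ.m+[n∸m]≡n (injections-≤ k n))
  regroup : ∀ i d → i ℕ.+ d ℕ.+ (i ℕ.+ d) ≡ 2 ℕ.* i ℕ.+ 2 ℕ.* d
  regroup = ℕ-solve-∀

injections>0 : ∀ k n .{{_ : ℕ.NonZero n}} → 2 ℕ.* (k ℕ.* k) ℕ.≤ n → 0 ℕ.< injections k n
injections>0 k n large = ℕ.n≢0⇒n>0 λ I≡0 →
  ℕ.<⇒≱ (ℕ.m^n>0 n k) (ℕ.≤-trans (power≤2injections k n large) (ℕ.≤-reflexive (cong (2 ℕ.*_) I≡0)))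

Few : ℕ → ∀ {n} → Tournament n → Set
Few m {n} T = m ℕ.* m ℕ.* (m ℕ.* m) ℕ.* ℤ.∣ C₄ (allFin n) (arcSign T) ∣ ℕ.≤ n ℕ.* n ℕ.* (n ℕ.* n)

pairPower : ℕ → ℕ
pairPower k = 2 ℕ.^ length (pairs k)

-- Collisions enter `embeddings-close` P times through the weights and once in replacing nᵏ by the
-- number of injections, hence `suc (pairPower k)`. The factor k² is that of `injections-gap`.
threshold : ℕ → ℕ → ℕ
threshold L k = 4 ℕ.* suc L ℕ.* suc (pairPower k) ℕ.* (k ℕ.* k)

-- Makes the edge error at most nᵏ after scaling by 4 (L + 1); the successor keeps the parameter
-- positive, so that it can be cancelled.
fewness : ℕ → ℕ → ℕ
fewness L k = suc (4 ℕ.* suc L ℕ.* error (length (pairs k)))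

module _ (L : ℕ) {k n : ℕ} .{{_ : ℕ.NonZero n}} (large : threshold L k ℕ.≤ n) where

  private
    N I D P l : ℕ
    N = n ℕ.^ k
    I = injections k n
    D = N ℕ.∸ I
    P = pairPower k
    l = suc L

  gap-small : 4 ℕ.* l ℕ.* suc P ℕ.* D ℕ.≤ N
  gap-small = injections-gap (4 ℕ.* l ℕ.* suc P) k n large

  2k²≤n : 2 ℕ.* (k ℕ.* k) ℕ.≤ n
  2k²≤n = ℕ.≤-trans (ℕ.*-monoˡ-≤ (k ℕ.* k)
    (ℕ.*-mono-≤ (ℕ.*-mono-≤ {2} {4} {1} {l} (s≤s (s≤s z≤n)) (s≤s z≤n)) (s≤s {0} {P} z≤n))) large

  N≤2I : N ℕ.≤ 2 ℕ.* I
  N≤2I = power≤2injections k n 2k²≤n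

  embeddings-close : (S : Tournament k) (T : Tournament n) → Few (fewness L k) T →
    l ℕ.* distance (P ℕ.* embeddings S T) I ℕ.≤ I
  embeddings-close S T few = ℕ.*-cancelˡ-≤ 2 (ℕ.≤-trans (ℕ.*-cancelˡ-≤ 2 (ℕ.*-cancelˡ-≤ m (begin
    m ℕ.* (2 ℕ.* (2 ℕ.* (l ℕ.* distance X I)))
      ≤⟨ ℕ.*-monoʳ-≤ m (ℕ.*-monoʳ-≤ 2 (ℕ.*-monoʳ-≤ 2 (ℕ.*-monoʳ-≤ l (distance-triangle X N I)))) ⟩
    m ℕ.* (2 ℕ.* (2 ℕ.* (l ℕ.* (distance X N ℕ.+ distance N I))))
      ≡⟨ trans (regroup m l (distance X N) (distance N I)) (cong (λ t → 4 ℕ.* l ℕ.* (m ℕ.* distance X N) ℕ.+ 4 ℕ.* l ℕ.* (m ℕ.* t)) (distance-≥ (injections-≤ k n))) ⟩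
    4 ℕ.* l ℕ.* (m ℕ.* distance X N) ℕ.+ 4 ℕ.* l ℕ.* (m ℕ.* D)
      ≤⟨ ℕ.+-monoˡ-≤ _ (ℕ.*-monoʳ-≤ (4 ℕ.* l) (embeddings-estimate S T m few)) ⟩
    4 ℕ.* l ℕ.* (m ℕ.* (P ℕ.* D) ℕ.+ e ℕ.* N) ℕ.+ 4 ℕ.* l ℕ.* (m ℕ.* D)
      ≡⟨ collect m l P D e N ⟩
    m ℕ.* (4 ℕ.* l ℕ.* suc P ℕ.* D) ℕ.+ 4 ℕ.* l ℕ.* e ℕ.* N
      ≤⟨ ℕ.+-mono-≤ (ℕ.*-monoʳ-≤ m gap-small) (ℕ.*-monoˡ-≤ N (ℕ.n≤1+n (4 ℕ.* l ℕ.* e))) ⟩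
    m ℕ.* N ℕ.+ m ℕ.* N
      ≡⟨ double m N ⟩
    m ℕ.* (2 ℕ.* N) ∎))) N≤2I)
    where
    open ℕ.≤-Reasoning
    m e X : ℕ
    m = fewness L k
    e = error (length (pairs k))
    X = P ℕ.* embeddings S T
    regroup : ∀ m l a b → m ℕ.* (2 ℕ.* (2 ℕ.* (l ℕ.* (a ℕ.+ b)))) ≡ 4 ℕ.* l ℕ.* (m ℕ.* a) ℕ.+ 4 ℕ.* l ℕ.* (m ℕ.* b)
    regroup = ℕ-solve-∀
    collect : ∀ m l p d e n → 4 ℕ.* l ℕ.* (m ℕ.* (p ℕ.* d) ℕ.+ e ℕ.* n) ℕ.+ 4 ℕ.* l ℕ.* (m ℕ.* d) ≡
      m ℕ.* (4 ℕ.* l ℕ.* suc p ℕ.* d) ℕ.+ 4 ℕ.* l ℕ.* e ℕ.* n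
    collect = ℕ-solve-∀
    double : ∀ m n → m ℕ.* n ℕ.+ m ℕ.* n ≡ m ℕ.* (2 ℕ.* n)
    double = ℕ-solve-∀

∣Aut∣>0 : ∀ {k} (S : Tournament k) → 0 ℕ.< ∣Aut S ∣
∣Aut∣>0 {k} S = ∈-length (∈-filter⁺ (isIsomorphism? S S ∘ lookup) (∈-functions (tabulate id))
  (((λ {i} {j} e → trans (sym (lookup∘tabulate id i)) (trans e (lookup∘tabulate id j)))
    , strictlySurjective⇒surjective (λ y → y , lookup∘tabulate id y))
  , λ i j → sym (cong₂ (arc S) (lookup∘tabulate id i) (lookup∘tabulate id j))))

2m≤n⇒m<n : ∀ {m n} → 0 ℕ.< n → 2 ℕ.* m ℕ.≤ n → m ℕ.< n
2m≤n⇒m<n {zero}  0<n _    = 0<n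
2m≤n⇒m<n {suc m} _   2m≤n = ℕ.<-≤-trans (ℕ.m<m+n (suc m) (s≤s z≤n)) 2m≤n

subsetsOfSize>0 : ∀ k n → 0 ℕ.< injections k n → 0 ℕ.< length (subsetsOfSize n k)
subsetsOfSize>0 k n I>0 = ℕ.n≢0⇒n>0 λ b≡0 →
  ℕ.<⇒≢ I>0 (sym (trans (length-injections k n) (trans (cong (k ! ℕ.*_) b≡0) (ℕ.*-zeroʳ (k !)))))

-- Cross-multiplying `density S T` and `φqr S` gives exactly 2 to the power k C 2 times the
-- embeddings on one side and the injections on the other. The factor 2 in the hypothesis makes the
-- conclusion strict.
density-close : ∀ K {k n} (S : Tournament k) (T : Tournament n) → 0 ℕ.< injections k n →
  2 ℕ.* suc K ℕ.* k ! ℕ.* distance (pairPower k ℕ.* embeddings S T) (injections k n) ℕ.≤ injections k n →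
  ℚ.∣ density S T ℚ.- φqr S ∣ ℚ.< + 1 / suc K
density-close K {k} {n} S T I>0 close = ÷-close⁺ K a b (k !) (α ℕ.* 2 ℕ.^ (k C 2))
  {{ℕ.>-nonZero b>0}} {{ℕ.>-nonZero (ℕ.*-mono-< (∣Aut∣>0 S) (ℕ.m^n>0 2 (k C 2)))}} (begin-strict
  suc K ℕ.* distance (a ℕ.* (α ℕ.* 2 ℕ.^ (k C 2))) (k ! ℕ.* b)
    ≡⟨ cong₂ (λ x y → suc K ℕ.* distance x y) weighted (sym (length-injections k n)) ⟩
  d
    <⟨ 2m≤n⇒m<n b>0 cancelled ⟩
  b
    ≤⟨ ℕ.m≤m*n b (α ℕ.* 2 ℕ.^ (k C 2)) {{ℕ.>-nonZero (ℕ.*-mono-< (∣Aut∣>0 S) (ℕ.m^n>0 2 (k C 2)))}} ⟩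
  b ℕ.* (α ℕ.* 2 ℕ.^ (k C 2)) ∎)
  where
  open ℕ.≤-Reasoning
  a b α d : ℕ
  a = copies S T
  b = length (subsetsOfSize n k)
  α = ∣Aut S ∣
  d = suc K ℕ.* distance (pairPower k ℕ.* embeddings S T) (injections k n)
  rotate : ∀ a α p → a ℕ.* (α ℕ.* p) ≡ p ℕ.* (α ℕ.* a)
  rotate = ℕ-solve-∀
  weighted : a ℕ.* (α ℕ.* 2 ℕ.^ (k C 2)) ≡ pairPower k ℕ.* embeddings S T
  weighted = trans (rotate a α _) (cong₂ (λ s t → 2 ℕ.^ s ℕ.* t) (sym (length-pairs k)) (sym (embeddings≡Aut*copies S T)))
  b>0 : 0 ℕ.< b
  b>0 = subsetsOfSize>0 k n I>0
  cancelled : 2 ℕ.* d ℕ.≤ b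
  cancelled = ℕ.*-cancelˡ-≤ (k !) {{k !≢0}} (subst₂ ℕ._≤_ (regroup (suc K) (k !) _) (length-injections k n) close)
    where
    regroup : ∀ K f x → 2 ℕ.* K ℕ.* f ℕ.* x ≡ f ℕ.* (2 ℕ.* (K ℕ.* x))
    regroup = ℕ-solve-∀

few⇒close : ∀ K {k n} .{{_ : ℕ.NonZero n}} (S : Tournament k) (T : Tournament n) →
  let L = 2 ℕ.* suc K ℕ.* k ! in threshold L k ℕ.≤ n → Few (fewness L k) T →
  ℚ.∣ density S T ℚ.- φqr S ∣ ℚ.< + 1 / suc K
few⇒close K {k} {n} S T large few = density-close K S T (injections>0 k n (2k²≤n L {k} {n} large))
  (ℕ.≤-trans (ℕ.*-monoˡ-≤ _ (ℕ.n≤1+n L)) (embeddings-close L large S T few))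
  where
  L : ℕ
  L = 2 ℕ.* suc K ℕ.* k !

Eventually : (ℕ → Set) → Set
Eventually P = ∃ λ N → ∀ n → N ℕ.≤ n → P n

module _ {size : ℕ → ℕ} (increasing : ∀ n → size n ℕ.< size (suc n)) where

  n≤size : ∀ n → n ℕ.≤ size n
  n≤size zero    = z≤n
  n≤size (suc n) = ℕ.≤-<-trans (n≤size n) (increasing n)

  few⇒quasiRandom : (T : ∀ n → Tournament (size n)) → (∀ m → Eventually (λ n → Few m (T n))) → QuasiRandom T
  few⇒quasiRandom T few {k} S ε 0<ε with K , 1/K≤ε ← archimedean ε 0<ε
    with N , few-from-N ← few (fewness (2 ℕ.* suc K ℕ.* k !) k) =
    -- The successor guarantees a nonempty tournament; `n≤size` carries the bound on the index over
    -- to the size.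
    suc (threshold L k) ℕ.+ N , λ n n≥ →
      let n-large = ℕ.≤-trans (ℕ.≤-trans (ℕ.m≤m+n (suc (threshold L k)) N) n≥) (n≤size n)
      in ℚ.<-≤-trans (few⇒close K {{ℕ.>-nonZero (ℕ.≤-trans (s≤s z≤n) n-large)}} S (T n) (ℕ.≤-trans (ℕ.n≤1+n _) n-large)
           (few-from-N n (ℕ.≤-trans (ℕ.m≤n+m N (suc (threshold L k))) n≥))) 1/K≤ε
    where
    L : ℕ
    L = 2 ℕ.* suc K ℕ.* k !

-- By enumerating the 5⁵ self-maps.
∣AutT₅⁸∣≡1 : ∣Aut T₅⁸ ∣ ≡ 1
∣AutT₅⁸∣≡1 = refl

distance-scale : ∀ c x y → distance (c ℕ.* x) (c ℕ.* y) ≡ c ℕ.* distance x y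
distance-scale c x y = trans (cong ℤ.∣_∣ (trans (cong₂ _-_ (ℤ.pos-* c x) (ℤ.pos-* c y)) (factor (+ c) (+ x) (+ y))))
  (ℤ.abs-* (+ c) (+ x - + y))
  where
  factor : ∀ c x y → c * x - c * y ≡ c * (x - y)
  factor = solve-∀

-- Scaling 128 and 15 by 8 gives 2¹⁰ and 5!. The factor 9 is 1024/120 rounded up.
density₅⁸⇒embeddings : ∀ K {n} (T : Tournament n) → 0 ℕ.< injections 5 n →
  ℚ.∣ density T₅⁸ T ℚ.- + 15 / 128 ∣ ℚ.< + 1 / suc K →
  suc K ℕ.* distance (1024 ℕ.* embeddings T₅⁸ T) (injections 5 n) ℕ.≤ 9 ℕ.* injections 5 n
density₅⁸⇒embeddings K {n} T I>0 close = begin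
  suc K ℕ.* distance (1024 ℕ.* embeddings T₅⁸ T) (injections 5 n)
    ≡⟨ cong₂ (λ x y → suc K ℕ.* distance x y)
         (trans (cong (1024 ℕ.*_) (trans (embeddings≡Aut*copies T₅⁸ T) (trans (cong (ℕ._* a) ∣AutT₅⁸∣≡1) (ℕ.*-identityˡ a)))) (1024≡ a))
         (trans (length-injections 5 n) (120≡ b)) ⟩
  suc K ℕ.* distance (8 ℕ.* (a ℕ.* 128)) (8 ℕ.* (15 ℕ.* b))
    ≡⟨ trans (cong (suc K ℕ.*_) (distance-scale 8 (a ℕ.* 128) (15 ℕ.* b))) (exchange (suc K) (distance (a ℕ.* 128) (15 ℕ.* b))) ⟩
  8 ℕ.* (suc K ℕ.* distance (a ℕ.* 128) (15 ℕ.* b))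
    ≤⟨ ℕ.*-monoʳ-≤ 8 (ℕ.<⇒≤ (÷-close⁻ K a b 15 128 {{ℕ.>-nonZero (subsetsOfSize>0 5 n I>0)}} close)) ⟩
  8 ℕ.* (b ℕ.* 128)
    ≡⟨ 1024b b ⟩
  1024 ℕ.* b
    ≤⟨ ℕ.*-monoˡ-≤ b {1024} {1080} (ℕ.m≤m+n 1024 56) ⟩
  1080 ℕ.* b
    ≡⟨ trans (1080≡ b) (cong (9 ℕ.*_) (sym (length-injections 5 n))) ⟩
  9 ℕ.* injections 5 n ∎
  where
  open ℕ.≤-Reasoning
  a b : ℕ
  a = copies T₅⁸ T
  b = length (subsetsOfSize n 5)
  1024≡ : ∀ a → 1024 ℕ.* a ≡ 8 ℕ.* (a ℕ.* 128)
  1024≡ = ℕ-solve-∀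
  120≡ : ∀ b → 120 ℕ.* b ≡ 8 ℕ.* (15 ℕ.* b)
  120≡ = ℕ-solve-∀
  1080≡ : ∀ b → 1080 ℕ.* b ≡ 9 ℕ.* (120 ℕ.* b)
  1080≡ = ℕ-solve-∀
  1024b : ∀ b → 8 ℕ.* (b ℕ.* 128) ≡ 1024 ℕ.* b
  1024b = ℕ-solve-∀
  exchange : ∀ k d → k ℕ.* (8 ℕ.* d) ≡ 8 ℕ.* (k ℕ.* d)
  exchange = ℕ-solve-∀

-- In `embeddings₅⁸-bound` an almost optimal number of embeddings leaves little room for C₄. The
-- deviation `x` costs at most 9 n⁵ and the collisions at most n⁵ after scaling by K + 1, and 15 is
-- 54 · (9 + 1) / 36. The number 25 is the k² of `injections-gap`.
density₅⁸⇒few : ∀ m K {n} .{{_ : ℕ.NonZero n}} (T : Tournament n) →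
  15 ℕ.* (m ℕ.* m ℕ.* (m ℕ.* m)) ℕ.≤ K → 2 ℕ.* suc K ℕ.* 25 ℕ.≤ n →
  ℚ.∣ density T₅⁸ T ℚ.- + 15 / 128 ∣ ℚ.< + 1 / suc K → Few m T
density₅⁸⇒few m K {n} T 15m⁴≤K large close = ℕ.*-cancelˡ-≤ 15 (begin
  15 ℕ.* (m ℕ.* m ℕ.* (m ℕ.* m) ℕ.* c)
    ≡⟨ sym (ℕ.*-assoc 15 (m ℕ.* m ℕ.* (m ℕ.* m)) c) ⟩
  15 ℕ.* (m ℕ.* m ℕ.* (m ℕ.* m)) ℕ.* c
    ≤⟨ ℕ.*-monoˡ-≤ c (ℕ.≤-trans 15m⁴≤K (ℕ.n≤1+n K)) ⟩
  suc K ℕ.* c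
    ≤⟨ ℕ.*-cancelˡ-≤ n (ℕ.*-cancelˡ-≤ 36 scaled) ⟩
  15 ℕ.* (n ℕ.* n ℕ.* (n ℕ.* n)) ∎)
  where
  open ℕ.≤-Reasoning
  c x N I D : ℕ
  c = ℤ.∣ C₄ (allFin n) (arcSign T) ∣
  N = n ℕ.^ 5
  I = injections 5 n
  D = N ℕ.∸ I
  X : ℕ
  X = 1024 ℕ.* embeddings T₅⁸ T
  x = distance X I
  Kx : suc K ℕ.* x ℕ.≤ 9 ℕ.* N
  Kx = ℕ.≤-trans (density₅⁸⇒embeddings K T (injections>0 5 n (ℕ.≤-trans (ℕ.*-monoˡ-≤ 25 (ℕ.*-monoʳ-≤ 2 (s≤s {0} {K} z≤n))) large)) close)
    (ℕ.*-monoʳ-≤ 9 (injections-≤ 5 n))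
  KD : suc K ℕ.* D ℕ.≤ N
  KD = injections-gap (suc K) 5 n (ℕ.≤-trans (ℕ.*-monoˡ-≤ 25 (ℕ.m≤m+n (suc K) _)) large)
  deficiency : 36 ℕ.* (n ℕ.* c) ℕ.≤ 54 ℕ.* (x ℕ.+ D)
  deficiency = ℕ.+-cancelˡ-≤ (54 ℕ.* X) _ _ (begin
    54 ℕ.* X ℕ.+ 36 ℕ.* (n ℕ.* c)
      ≤⟨ embeddings₅⁸-bound T ⟩
    54 ℕ.* N
      ≡⟨ cong (54 ℕ.*_) (sym (ℕ.m+[n∸m]≡n (injections-≤ 5 n))) ⟩
    54 ℕ.* (I ℕ.+ D)
      ≤⟨ ℕ.*-monoʳ-≤ 54 (ℕ.+-monoˡ-≤ D (≤+distance X I)) ⟩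
    54 ℕ.* (X ℕ.+ x ℕ.+ D)
      ≡⟨ distribute X x D ⟩
    54 ℕ.* X ℕ.+ 54 ℕ.* (x ℕ.+ D) ∎)
    where
    distribute : ∀ a b d → 54 ℕ.* (a ℕ.+ b ℕ.+ d) ≡ 54 ℕ.* a ℕ.+ 54 ℕ.* (b ℕ.+ d)
    distribute = ℕ-solve-∀
  scaled : 36 ℕ.* (n ℕ.* (suc K ℕ.* c)) ℕ.≤ 36 ℕ.* (n ℕ.* (15 ℕ.* (n ℕ.* n ℕ.* (n ℕ.* n))))
  scaled = begin
    36 ℕ.* (n ℕ.* (suc K ℕ.* c))
      ≡⟨ regroup n (suc K) c ⟩
    suc K ℕ.* (36 ℕ.* (n ℕ.* c))
      ≤⟨ ℕ.*-monoʳ-≤ (suc K) deficiency ⟩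
    suc K ℕ.* (54 ℕ.* (x ℕ.+ D))
      ≡⟨ distribute (suc K) x D ⟩
    54 ℕ.* (suc K ℕ.* x ℕ.+ suc K ℕ.* D)
      ≤⟨ ℕ.*-monoʳ-≤ 54 (ℕ.+-mono-≤ Kx KD) ⟩
    54 ℕ.* (9 ℕ.* N ℕ.+ N)
      ≡⟨ power n ⟩
    36 ℕ.* (n ℕ.* (15 ℕ.* (n ℕ.* n ℕ.* (n ℕ.* n)))) ∎
    where
    regroup : ∀ n K c → 36 ℕ.* (n ℕ.* (K ℕ.* c)) ≡ K ℕ.* (36 ℕ.* (n ℕ.* c))
    regroup = ℕ-solve-∀
    distribute : ∀ K x d → K ℕ.* (54 ℕ.* (x ℕ.+ d)) ≡ 54 ℕ.* (K ℕ.* x ℕ.+ K ℕ.* d)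
    distribute = ℕ-solve-∀
    power : ∀ n → 54 ℕ.* (9 ℕ.* (n ℕ.* (n ℕ.* (n ℕ.* (n ℕ.* (n ℕ.* 1))))) ℕ.+ n ℕ.* (n ℕ.* (n ℕ.* (n ℕ.* (n ℕ.* 1))))) ≡
      36 ℕ.* (n ℕ.* (15 ℕ.* (n ℕ.* n ℕ.* (n ℕ.* n))))
    power = ℕ-solve-∀

0<1/K : ∀ K → 0ℚ ℚ.< + 1 / suc K
0<1/K K = ℚ.toℚᵘ-cancel-< (ℚᵘ.<-respʳ-≃ (ℚᵘ.≃-sym (ℚ.toℚᵘ-fromℚᵘ (mkℚᵘ (+ 1) K))) (ℚᵘ.*<* (ℤ.+<+ (s≤s z≤n))))

density₅⁸⇒quasiRandom : {size : ℕ → ℕ} (T : ∀ n → Tournament (size n)) → (∀ n → size n ℕ.< size (suc n)) →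
  ((λ n → density T₅⁸ (T n)) ⟶ + 15 / 128) → QuasiRandom T
density₅⁸⇒quasiRandom T increasing limit = few⇒quasiRandom increasing T few
  where
  few-from : ∀ m K → 15 ℕ.* (m ℕ.* m ℕ.* (m ℕ.* m)) ℕ.≤ K → Eventually (λ n → Few m (T n))
  few-from m K 15m⁴≤K = suc M ℕ.+ N , λ n n≥ →
    let n-large = ℕ.≤-trans (ℕ.≤-trans (ℕ.m≤m+n (suc M) N) n≥) (n≤size increasing n)
    in density₅⁸⇒few m K {{ℕ.>-nonZero (ℕ.≤-trans (s≤s z≤n) n-large)}} (T n) 15m⁴≤K (ℕ.≤-trans (ℕ.n≤1+n M) n-large)
         (proj₂ (limit (+ 1 / suc K) (0<1/K K)) n (ℕ.≤-trans (ℕ.m≤n+m N (suc M)) n≥))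
    where
    M N : ℕ
    M = 2 ℕ.* suc K ℕ.* 25
    N = proj₁ (limit (+ 1 / suc K) (0<1/K K))
  few : ∀ m → Eventually (λ n → Few m (T n))
  few m = few-from m _ ℕ.≤-refl

-- The maximum over all tournaments of a given size

fromMatrix : ∀ {n} → Vec (Vec Bool n) n → Tournament n
fromMatrix {n} M = record { arc = arcᴹ ; loopless = looplessᴹ ; exactly-one = exactly-oneᴹ }
  where
  arcᴹ : Fin n → Fin n → Bool
  arcᴹ i j with Fin.<-cmp i j
  -- Only entries above the diagonal are read, so every Boolean matrix gives a tournament and the
  -- list of all matrices can be used unfiltered.
  ... | tri< _ _ _ = lookup (lookup M i) j
  ... | tri≈ _ _ _ = false
  ... | tri> _ _ _ = not (lookup (lookup M j) i)
  looplessᴹ : ∀ i → arcᴹ i i ≡ false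
  looplessᴹ i with Fin.<-cmp i i
  ... | tri< _ i≢i _ = ⊥-elim (i≢i refl)
  ... | tri≈ _ _ _   = refl
  ... | tri> _ i≢i _ = ⊥-elim (i≢i refl)
  exactly-oneᴹ : ∀ i j → i ≢ j → arcᴹ i j ≡ not (arcᴹ j i)
  exactly-oneᴹ i j i≢j with Fin.<-cmp i j | Fin.<-cmp j i
  ... | tri≈ _ i≡j _   | _              = ⊥-elim (i≢j i≡j)
  ... | _              | tri≈ _ j≡i _   = ⊥-elim (i≢j (sym j≡i))
  ... | tri< _ _ j≮i   | tri< j<i _ _   = ⊥-elim (j≮i j<i)
  ... | tri< _ _ _     | tri> _ _ _     = sym (Bool.not-involutive _)
  ... | tri> _ _ _     | tri< _ _ _     = refl
  ... | tri> i≮j _ _   | tri> _ _ i<j   = ⊥-elim (i≮j i<j)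

matrix : ∀ {n} → Tournament n → Vec (Vec Bool n) n
matrix T = tabulate λ i → tabulate (arc T i)

fromMatrix-matrix : ∀ {n} (T : Tournament n) i j → arc (fromMatrix (matrix T)) i j ≡ arc T i j
fromMatrix-matrix T i j with Fin.<-cmp i j
... | tri< _ _ _    = trans (cong (λ r → lookup r j) (lookup∘tabulate _ i)) (lookup∘tabulate _ j)
... | tri≈ _ refl _ = sym (loopless T i)
... | tri> _ i≢j _  = trans (cong not (trans (cong (λ r → lookup r i) (lookup∘tabulate _ j)) (lookup∘tabulate _ i)))
  (sym (exactly-one T i j i≢j))

-- A tournament rebuilt from its matrix has the same arcs pointwise, which replaces propositional
-- equality of the records.
copies-cong : ∀ {k n} (S : Tournament k) (T T′ : Tournament n) → (∀ i j → arc T i j ≡ arc T′ i j) → copies S T ≡ copies S T′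
copies-cong {k} {n} S T T′ same = cong length (List.filter-≐ (λ A → S ≅? induced T A) (λ A → S ≅? induced T′ A)
  ((λ (f , bij , arcs) → f , bij , λ i j → trans (arcs i j) (same _ _))
  , λ (f , bij , arcs) → f , bij , λ i j → trans (arcs i j) (sym (same _ _))) (subsetsOfSize n k))

quasiRandomTournament : ∀ n → Tournament n
quasiRandomTournament n = proj₁ (few-four-cycles n)

tournaments : ∀ n → List (Tournament n)
tournaments n = map fromMatrix (allVecs (allVecs (true ∷ false ∷ []) n) n)

best₅⁸ : ∀ n → Tournament n
best₅⁸ n = argmax (copies T₅⁸) (quasiRandomTournament n) (tournaments n)

best₅⁸-maximal : ∀ {n} (T : Tournament n) → copies T₅⁸ T ℕ.≤ copies T₅⁸ (best₅⁸ n)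
best₅⁸-maximal {n} T = subst (ℕ._≤ copies T₅⁸ (best₅⁸ n)) (copies-cong T₅⁸ (fromMatrix (matrix T)) T (fromMatrix-matrix T))
  (All.lookup (f[xs]≤f[argmax] {f = copies T₅⁸} (quasiRandomTournament n) (tournaments n))
    (∈-map⁺ fromMatrix (∈-allVecs (∈-allVecs λ { true → here refl ; false → there (here refl) }) (matrix T))))

quasiRandomTournament-few : ∀ m n → 8 ℕ.* (m ℕ.* m ℕ.* (m ℕ.* m)) ℕ.≤ n → Few m (quasiRandomTournament n)
quasiRandomTournament-few m n large = begin
  m⁴ ℕ.* ℤ.∣ C₄ (allFin n) (arcSign (quasiRandomTournament n)) ∣ ≤⟨ ℕ.*-monoʳ-≤ m⁴ (proj₂ (few-four-cycles n)) ⟩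
  m⁴ ℕ.* (8 ℕ.* (n ℕ.* n ℕ.* n))  ≡⟨ regroup m⁴ (n ℕ.* n ℕ.* n) ⟩
  8 ℕ.* m⁴ ℕ.* (n ℕ.* n ℕ.* n)    ≤⟨ ℕ.*-monoˡ-≤ (n ℕ.* n ℕ.* n) large ⟩
  n ℕ.* (n ℕ.* n ℕ.* n)           ≡⟨ regroup′ n ⟩
  n ℕ.* n ℕ.* (n ℕ.* n) ∎
  where
  open ℕ.≤-Reasoning
  m⁴ : ℕ
  m⁴ = m ℕ.* m ℕ.* (m ℕ.* m)
  regroup : ∀ a b → a ℕ.* (8 ℕ.* b) ≡ 8 ℕ.* a ℕ.* b
  regroup = ℕ-solve-∀
  regroup′ : ∀ n → n ℕ.* (n ℕ.* n ℕ.* n) ≡ n ℕ.* n ℕ.* (n ℕ.* n)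
  regroup′ = ℕ-solve-∀

-- T needs no lower bound of its own, having at least as many copies of S as Q.
maximal⇒close : ∀ K L {k n} .{{_ : ℕ.NonZero n}} (S : Tournament k) (Q T : Tournament n) →
  4 ℕ.* suc K ℕ.* k ! ℕ.≤ suc L → threshold L k ℕ.≤ n → Few (fewness L k) Q →
  copies S Q ℕ.≤ copies S T → pairPower k ℕ.* embeddings S T ℕ.≤ n ℕ.^ k →
  ℚ.∣ density S T ℚ.- φqr S ∣ ℚ.< + 1 / suc K
maximal⇒close K L {k} {n} S Q T K≤L large few Q≤T T≤N = density-close K S T (injections>0 k n (2k²≤n L {k} {n} large))
  (ℕ.*-cancelˡ-≤ 2 (begin
    2 ℕ.* (2 ℕ.* suc K ℕ.* k ! ℕ.* distance (P ℕ.* embeddings S T) I)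
      ≡⟨ regroup (suc K) (k !) _ ⟩
    4 ℕ.* suc K ℕ.* k ! ℕ.* distance (P ℕ.* embeddings S T) I
      ≤⟨ ℕ.*-mono-≤ K≤L (distance-between {P ℕ.* embeddings S Q} {P ℕ.* embeddings S T} {I} {D} (ℕ.*-monoʳ-≤ P more) (subst (P ℕ.* embeddings S T ℕ.≤_) (sym (ℕ.m+[n∸m]≡n (injections-≤ k n))) T≤N)) ⟩
    suc L ℕ.* (distance (P ℕ.* embeddings S Q) I ℕ.+ D)
      ≡⟨ ℕ.*-distribˡ-+ (suc L) _ D ⟩
    suc L ℕ.* distance (P ℕ.* embeddings S Q) I ℕ.+ suc L ℕ.* D
      ≤⟨ ℕ.+-mono-≤ (embeddings-close L large S Q few) LD≤I ⟩
    I ℕ.+ I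
      ≡⟨ cong (I ℕ.+_) (sym (ℕ.+-identityʳ I)) ⟩
    2 ℕ.* I ∎))
  where
  open ℕ.≤-Reasoning
  P I D : ℕ
  P = pairPower k
  I = injections k n
  D = n ℕ.^ k ℕ.∸ I
  regroup : ∀ K f x → 2 ℕ.* (2 ℕ.* K ℕ.* f ℕ.* x) ≡ 4 ℕ.* K ℕ.* f ℕ.* x
  regroup = ℕ-solve-∀
  more : embeddings S Q ℕ.≤ embeddings S T
  more = subst₂ ℕ._≤_ (sym (embeddings≡Aut*copies S Q)) (sym (embeddings≡Aut*copies S T)) (ℕ.*-monoʳ-≤ ∣Aut S ∣ Q≤T)
  LD≤I : suc L ℕ.* D ℕ.≤ I
  LD≤I = ℕ.*-cancelˡ-≤ 2 (begin
    2 ℕ.* (suc L ℕ.* D)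
      ≡⟨ sym (ℕ.*-assoc 2 (suc L) D) ⟩
    2 ℕ.* suc L ℕ.* D
      ≤⟨ ℕ.*-monoˡ-≤ D (ℕ.≤-trans (ℕ.*-monoˡ-≤ (suc L) {2} {4} (s≤s (s≤s z≤n))) (ℕ.m≤m*n (4 ℕ.* suc L) (suc P))) ⟩
    4 ℕ.* suc L ℕ.* suc P ℕ.* D
      ≤⟨ gap-small L {k} {n} large ⟩
    n ℕ.^ k
      ≤⟨ N≤2I L {k} {n} large ⟩
    2 ℕ.* I ∎)

maximal⇒limit : ∀ {k} (S : Tournament k) (T : ∀ n → Tournament n) →
  (∀ n (Q : Tournament n) → copies S Q ℕ.≤ copies S (T n)) →
  (∀ n → pairPower k ℕ.* embeddings S (T n) ℕ.≤ n ℕ.^ k) →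
  (λ n → density S (T n)) ⟶ φqr S
maximal⇒limit {k} S T maximal bound ε 0<ε = suc (threshold L k) ℕ.+ 8 ℕ.* m⁴ , λ n n≥ →
  let n-large = ℕ.≤-trans (ℕ.m≤m+n (suc (threshold L k)) (8 ℕ.* m⁴)) n≥ in
  ℚ.<-≤-trans (maximal⇒close K L {{ℕ.>-nonZero (ℕ.≤-trans (s≤s z≤n) n-large)}} S (quasiRandomTournament n) (T n)
    (ℕ.n≤1+n L) (ℕ.≤-trans (ℕ.n≤1+n _) n-large)
    (quasiRandomTournament-few (fewness L k) n (ℕ.≤-trans (ℕ.m≤n+m (8 ℕ.* m⁴) (suc (threshold L k))) n≥))
    (maximal n (quasiRandomTournament n)) (bound n)) (proj₂ (archimedean ε 0<ε))
  where
  K L m⁴ : ℕ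
  K  = proj₁ (archimedean ε 0<ε)
  L  = 4 ℕ.* suc K ℕ.* k !
  m⁴ = fewness L k ℕ.* fewness L k ℕ.* (fewness L k ℕ.* fewness L k)

embeddings₅⁸-≤ : ∀ {n} (T : Tournament n) → pairPower 5 ℕ.* embeddings T₅⁸ T ℕ.≤ n ℕ.^ 5
embeddings₅⁸-≤ {n} T = ℕ.*-cancelˡ-≤ {pairPower 5 ℕ.* embeddings T₅⁸ T} {n ℕ.^ 5} 54
  (ℕ.≤-trans (ℕ.m≤m+n (54 ℕ.* (1024 ℕ.* embeddings T₅⁸ T)) _) (embeddings₅⁸-bound T))

best₅⁸-limit : (λ n → density T₅⁸ (best₅⁸ n)) ⟶ φqr T₅⁸
best₅⁸-limit = maximal⇒limit T₅⁸ best₅⁸ (λ n → best₅⁸-maximal) (λ n → embeddings₅⁸-≤ (best₅⁸ n))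

theorem1p1 : (∃ λ (M : ℕ → ℚ) →
    (∀ n → IsMaximum (λ q → ∃ λ (T : Tournament n) → density T₅⁸ T ≡ q) (M n)) ×
    (M ⟶ + 15 / 128))
    ×
    ((size : ℕ → ℕ) (T : ∀ n → Tournament (size n)) →
    (∀ n → size n < size (suc n)) →
    ((λ n → density T₅⁸ (T n)) ⟶ + 15 / 128) ⇔ QuasiRandom T)
theorem1p1 =
    ( (λ n → density T₅⁸ (best₅⁸ n))
    -- For n < 5 there are no 5-subsets and all densities are 0 by the convention for `_÷_`.
    , (λ n → (best₅⁸ n , refl) , λ { _ (T , refl) → ÷-monoˡ-≤ (length (subsetsOfSize n 5)) (best₅⁸-maximal T) })
    -- `φqr T₅⁸` evaluates to 5!/2¹⁰ in lowest terms, which is 15/128.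
    , best₅⁸-limit)
  , λ size T increasing → mk⇔ (density₅⁸⇒quasiRandom T increasing) (λ quasiRandom → quasiRandom T₅⁸)
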